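{- There exists $n_1 \in \mathbb{N}$ such that the following holds for all integers $n \ge n_1$ and all positive integers $s \le n/3$. If $H$ is a $3$-uniform hypergraph on $n$ vertices with no isolated vertex and $\sigma_2(H) > 2(s-1)(n-1)$, then $H$ contains a matching of size $s$.
   Context: A $3$-uniform hypergraph ($3$-graph) $H=(V,E)$ has $E$ a family of $3$-element subsets of the finite set $V$. For $v\in V$, $\deg(v)$ is the number of edges containing $v$. Two vertices are adjacent if some edge contains both of them. $\sigma_2(H)$ denotes the minimum of $\deg(u)+\deg(v)$ over all pairs of distinct adjacent vertices $u,v$. A matching of size $s$ is a set of $s$ pairwise disjoint edges. An isolated vertex is a vertex contained in no edge. -}

module Defs where

open import Data.Nat using (ℕ; _+_; _*_; _∸_; _≤_; _<_; _>_)
open import Data.Fin using (Fin)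
import Data.Fin as F
open import Data.List using (List; length; filter)
open import Data.List.Membership.Propositional using (_∈_)
open import Data.List.Relation.Unary.Unique.Propositional using (Unique)
open import Data.List.Relation.Unary.AllPairs using (AllPairs)
open import Data.List.Relation.Binary.Subset.Propositional using (_⊆_)
open import Data.Product using (Σ; ∃; _×_; _,_)
open import Data.Sum using (_⊎_)
open import Relation.Binary.PropositionalEquality using (_≡_; _≢_)
open import Relation.Nullary using (¬_; Dec)
open import Relation.Nullary.Decidable using (_⊎-dec_)

-- A 3-element subset {a,b,c} of Fin n, represented canonically with a < b < c.
record Edge (n : ℕ) : Set where
  constructor edge
  field
    a b c : Fin n
    a<b : a F.< b
    b<c : b F.< c
open Edge public

_∈ₑ_ : ∀ {n} → Fin n → Edge n → Set
v ∈ₑ e = v ≡ a e ⊎ v ≡ b e ⊎ v ≡ c e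

_∈ₑ?_ : ∀ {n} (v : Fin n) (e : Edge n) → Dec (v ∈ₑ e)
v ∈ₑ? e = (v F.≟ a e) ⊎-dec ((v F.≟ b e) ⊎-dec (v F.≟ c e))

record Hypergraph3 (n : ℕ) : Set where
  field
    edges  : List (Edge n)
    unique : Unique edges
open Hypergraph3 public

deg : ∀ {n} → Hypergraph3 n → Fin n → ℕ
deg H v = length (filter (v ∈ₑ?_) (edges H))

Adjacent : ∀ {n} → Hypergraph3 n → Fin n → Fin n → Set
Adjacent H u v = u ≢ v × ∃ λ e → e ∈ edges H × u ∈ₑ e × v ∈ₑ e

-- σ₂(H) > t : every pair of distinct adjacent vertices has degree sum > t
-- (σ₂ is the minimum of deg u + deg v over such pairs)
σ₂> : ∀ {n} → Hypergraph3 n → ℕ → Set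
σ₂> H t = ∀ u v → Adjacent H u v → deg H u + deg H v > t

NoIsolated : ∀ {n} → Hypergraph3 n → Set
NoIsolated H = ∀ v → ∃ λ e → e ∈ edges H × v ∈ₑ e

Disjoint : ∀ {n} → Edge n → Edge n → Set
Disjoint e f = ∀ v → v ∈ₑ e → ¬ (v ∈ₑ f)

HasMatching : ∀ {n} → Hypergraph3 n → ℕ → Set
HasMatching H s = ∃ λ (M : List (Edge _)) →
  M ⊆ edges H × Unique M × AllPairs Disjoint M × length M ≡ s

{-# OPTIONS --safe #-}
module Submission where

-- Write m = s - 1 and suppose that there is no matching of size m + 1. Call a vertex low if its degree is at most
-- about m (n - 1); by the degree-sum condition an edge has at most one low vertex. Take a maximal matching M.
--
-- Three edges cannot be formed from two edges e, e′ of M and three uncovered vertices. Averaging over the nine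
-- ways in which they could be, the links of the three vertices have at most 18 of the possible 27 pairs between
-- e and e′, so that the three degrees sum to at most 3 m n + O(n). With four uncovered vertices, four edges formed
-- from three edges of M make this bound smaller by a constant factor. Hence at most three high vertices are
-- left uncovered.
--
-- Suppose that M, being of maximal size, also covers as many low vertices as possible, and let w be an uncovered low
-- vertex. If w has a neighbour x in an edge {x , y , z} of M without low vertices, then the argument for w, x, y,
-- with {x , y , z} removed from M, is sharpened by the edges of M with a low vertex and contradicts the degree sum
-- of w and x. Otherwise the neighbours of w lie in the edges of M with a low vertex, and counting the pairs that are
-- left for the links of w and of a neighbour contradicts their degree sum, unless there are at most 2 m + o(n) high
-- vertices. In that case all degrees are nearly as large as possible, and the bound 3 m n + O(n) suffices.
--
-- If no low vertex is left, then n = 3 s and three high vertices remain. They are absorbed by edges {u , a , b} and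
-- {v , c , e} from a small family reserved in advance: x u v, y a b and z c e are edges as well. Such pairs have
-- positive density for each triple x, y, z, and a greedy choice serves all triples.
--
-- When n is large compared to m, vertices of degree at least 3 (m + 1) n can be matched greedily at the end, which
-- leaves O(m) high vertices, and then edges with a low vertex form the matching.

open import Data.Bool using (Bool; true; false; T; _∧_; _∨_; not; if_then_else_)
open import Data.Bool.ListAction using (all; any)
open import Data.Bool.Properties using (T-∧; T-∨)
open import Data.Empty using (⊥; ⊥-elim)
open import Data.Fin as F using (Fin; toℕ)
open import Data.Fin.Patterns
import Data.Fin.Properties as F
open import Data.List using (List; []; _∷_; _++_; length; map; lookup; allFin; take; drop; filter; cartesianProduct)
open import Data.List.Properties using (tabulate-lookup; map-tabulate; ++-assoc; ++-identityʳ; length-++; length-map; length-take; length-tabulate; take++drop≡id)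
open import Data.List.Membership.Propositional using (_∈_; find; lose)
open import Data.List.Membership.Propositional.Properties using (∈-∃++; ∈-allFin; ∈-cartesianProduct⁺; ∈-cartesianProduct⁻)
open import Data.List.Relation.Unary.All as All using (All; []; _∷_; all?)
import Data.List.Relation.Unary.All.Properties as All
open import Data.List.Relation.Unary.AllPairs using (AllPairs; []; _∷_)
open import Data.List.Relation.Unary.Any as Any using (Any; here; there; any?)
import Data.List.Relation.Unary.Any.Properties as Any
open import Data.List.Relation.Unary.Unique.Propositional using (Unique)
import Data.List.Relation.Unary.Unique.Propositional.Properties as Unique
open import Data.List.Relation.Binary.Permutation.Propositional renaming (trans to transₚ)
open import Data.List.Relation.Binary.Permutation.Propositional.Properties hiding (++-assoc; ++-identityʳ; ++-identityˡ)
import Data.List.Relation.Binary.Permutation.Setoid.Properties as Permutation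
open import Data.Maybe using (Maybe; just; nothing)
open import Data.Nat
open import Data.Nat.DivMod using (_/_; _%_; m/n*n≤m; m≡m%n+[m/n]*n; m%n<n; /-monoˡ-≤; m*n/n≡m)
open import Data.Nat.Properties
open import Data.Product using (_×_; _,_; proj₁; proj₂; ∃; ∃₂)
open import Data.Sum using (_⊎_; inj₁; inj₂)
open import Data.Unit using (⊤; tt)
open import Data.Vec as Vec using (Vec; []; _∷_)
open import Function using (_∘_; Equivalence)
open import Relation.Binary.PropositionalEquality hiding ([_])
open import Relation.Nullary using (Dec; yes; no; ¬_)
open import Relation.Nullary.Decidable using (_×-dec_; _⊎-dec_; _→-dec_; ¬?; from-yes; decidable-stable)

-- Every exchange argument loses an error of order n, whereas the degree-sum hypothesis leaves
-- nothing to spare, so a gain of quadratic order has to make up for the loss: K² from the K edges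
-- of a matching against four uncovered vertices, 2 k² from the k edges with a low vertex, 3 t² from
-- the t edges without one. The gain 2 k² needs a large k, which a largest matching need not
-- provide. Therefore a family of edges with a low vertex is chosen beforehand, of size κ unless no
-- larger one exists, and matchings are optimised under the constraint that they leave no more low
-- vertices uncovered than this family does. Absorbing edges and the edges that secure the
-- constraint are locked: exchanges never touch them, at a cost of their number times n, which the
-- quadratic gains must exceed.
--
-- Degrees count ordered pairs, hence are doubled, and subtraction is avoided: the hypothesis reads
-- 4 m n + 2 ≤ d u + d v + 4 m. The absence of a matching is refuted, which suffices because
-- existence is decidable.

-- Polynomial inequalities over ℕ, proved by certificates.

module Inequality where

  infixl 6 _:+_
  infixl 7 _:*_

  -- There is no subtraction: both sides of an inequality stay polynomials with natural
  -- coefficients, and terms are only ever added to them.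
  data Ex : Set where
    con : ℕ → Ex
    var : ℕ → Ex
    _:+_ _:*_ : Ex → Ex → Ex

  _!_ : List ℕ → ℕ → ℕ
  [] ! _ = 0
  (x ∷ _) ! zero = x
  (_ ∷ xs) ! suc i = xs ! i

  ⟦_⟧ : Ex → List ℕ → ℕ
  ⟦ con c ⟧ ρ = c
  ⟦ var i ⟧ ρ = ρ ! i
  ⟦ a :+ b ⟧ ρ = ⟦ a ⟧ ρ + ⟦ b ⟧ ρ
  ⟦ a :* b ⟧ ρ = ⟦ a ⟧ ρ * ⟦ b ⟧ ρ

  -- A monomial is the sorted list of its variables, with repetition.
  Mono Poly : Set
  Mono = List ℕ
  Poly = List (ℕ × Mono)

  ⟦_⟧ₘ : Mono → List ℕ → ℕ
  ⟦ [] ⟧ₘ ρ = 1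
  ⟦ i ∷ μ ⟧ₘ ρ = ρ ! i * ⟦ μ ⟧ₘ ρ

  ⟦_⟧ₚ : Poly → List ℕ → ℕ
  ⟦ [] ⟧ₚ ρ = 0
  ⟦ (c , μ) ∷ p ⟧ₚ ρ = c * ⟦ μ ⟧ₘ ρ + ⟦ p ⟧ₚ ρ

  _≟ₘ_ : Mono → Mono → Bool
  [] ≟ₘ [] = true
  (i ∷ μ) ≟ₘ (j ∷ ν) = (i ≡ᵇ j) ∧ (μ ≟ₘ ν)
  _ ≟ₘ _ = false

  ≟ₘ-sound : ∀ μ ν → T (μ ≟ₘ ν) → μ ≡ ν
  ≟ₘ-sound [] [] _ = refl
  ≟ₘ-sound (i ∷ μ) (j ∷ ν) t with i ≡ᵇ j in eq
  ... | true = cong₂ _∷_ (≡ᵇ⇒≡ i j (subst T (sym eq) tt)) (≟ₘ-sound μ ν t)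

  insVar : ℕ → Mono → Mono
  insVar i [] = i ∷ []
  insVar i (j ∷ μ) = if i ≤ᵇ j then i ∷ j ∷ μ else j ∷ insVar i μ

  mulₘ : Mono → Mono → Mono
  mulₘ [] ν = ν
  mulₘ (i ∷ μ) ν = insVar i (mulₘ μ ν)

  addₚ : ℕ → Mono → Poly → Poly
  addₚ c μ [] = (c , μ) ∷ []
  addₚ c μ ((c′ , ν) ∷ p) = if μ ≟ₘ ν then (c + c′ , ν) ∷ p else (c′ , ν) ∷ addₚ c μ p

  plusₚ : Poly → Poly → Poly
  plusₚ [] q = q
  plusₚ ((c , μ) ∷ p) q = addₚ c μ (plusₚ p q)

  scaleₚ : ℕ → Mono → Poly → Poly
  scaleₚ c μ [] = []
  scaleₚ c μ ((c′ , ν) ∷ p) = addₚ (c * c′) (mulₘ μ ν) (scaleₚ c μ p)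

  timesₚ : Poly → Poly → Poly
  timesₚ [] q = []
  timesₚ ((c , μ) ∷ p) q = plusₚ (scaleₚ c μ q) (timesₚ p q)

  norm : Ex → Poly
  norm (con c) = (c , []) ∷ []
  norm (var i) = (1 , i ∷ []) ∷ []
  norm (a :+ b) = plusₚ (norm a) (norm b)
  norm (a :* b) = timesₚ (norm a) (norm b)

  x+yz : ∀ x y z → x + (y + z) ≡ y + (x + z)
  x+yz x y z = trans (sym (+-assoc x y z)) (trans (cong (_+ z) (+-comm x y)) (+-assoc y x z))

  x*yz : ∀ x y z → x * (y * z) ≡ y * (x * z)
  x*yz x y z = trans (sym (*-assoc x y z)) (trans (cong (_* z) (*-comm x y)) (*-assoc y x z))

  module _ (ρ : List ℕ) where

    insVar-≡ : ∀ i μ → ⟦ insVar i μ ⟧ₘ ρ ≡ ρ ! i * ⟦ μ ⟧ₘ ρ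
    insVar-≡ i [] = refl
    insVar-≡ i (j ∷ μ) with i ≤ᵇ j
    ... | true = refl
    ... | false = trans (cong (ρ ! j *_) (insVar-≡ i μ)) (x*yz (ρ ! j) (ρ ! i) _)

    mulₘ-≡ : ∀ μ ν → ⟦ mulₘ μ ν ⟧ₘ ρ ≡ ⟦ μ ⟧ₘ ρ * ⟦ ν ⟧ₘ ρ
    mulₘ-≡ [] ν = sym (+-identityʳ _)
    mulₘ-≡ (i ∷ μ) ν = trans (insVar-≡ i (mulₘ μ ν))
      (trans (cong (ρ ! i *_) (mulₘ-≡ μ ν)) (sym (*-assoc (ρ ! i) _ _)))

    addₚ-≡ : ∀ c μ p → ⟦ addₚ c μ p ⟧ₚ ρ ≡ c * ⟦ μ ⟧ₘ ρ + ⟦ p ⟧ₚ ρ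
    addₚ-≡ c μ [] = refl
    addₚ-≡ c μ ((c′ , ν) ∷ p) with μ ≟ₘ ν in eq
    ... | false = trans (cong (c′ * ⟦ ν ⟧ₘ ρ +_) (addₚ-≡ c μ p)) (x+yz (c′ * _) (c * _) _)
    ... | true rewrite ≟ₘ-sound μ ν (subst T (sym eq) tt) =
      trans (cong (_+ ⟦ p ⟧ₚ ρ) (*-distribʳ-+ (⟦ ν ⟧ₘ ρ) c c′)) (+-assoc (c * _) _ _)

    plusₚ-≡ : ∀ p q → ⟦ plusₚ p q ⟧ₚ ρ ≡ ⟦ p ⟧ₚ ρ + ⟦ q ⟧ₚ ρ
    plusₚ-≡ [] q = refl
    plusₚ-≡ ((c , μ) ∷ p) q = trans (addₚ-≡ c μ (plusₚ p q))
      (trans (cong (c * ⟦ μ ⟧ₘ ρ +_) (plusₚ-≡ p q)) (sym (+-assoc (c * _) _ _)))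

    scaleₚ-≡ : ∀ c μ p → ⟦ scaleₚ c μ p ⟧ₚ ρ ≡ c * ⟦ μ ⟧ₘ ρ * ⟦ p ⟧ₚ ρ
    scaleₚ-≡ c μ [] = sym (*-zeroʳ (c * ⟦ μ ⟧ₘ ρ))
    scaleₚ-≡ c μ ((c′ , ν) ∷ p) = trans (addₚ-≡ (c * c′) (mulₘ μ ν) (scaleₚ c μ p))
      (trans (cong₂ _+_ (trans (cong (c * c′ *_) (mulₘ-≡ μ ν)) lem) (scaleₚ-≡ c μ p))
        (sym (*-distribˡ-+ (c * ⟦ μ ⟧ₘ ρ) _ _)))
      where
      lem : c * c′ * (⟦ μ ⟧ₘ ρ * ⟦ ν ⟧ₘ ρ) ≡ c * ⟦ μ ⟧ₘ ρ * (c′ * ⟦ ν ⟧ₘ ρ)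
      lem = trans (*-assoc c c′ _) (trans (cong (c *_) (x*yz c′ (⟦ μ ⟧ₘ ρ) _)) (sym (*-assoc c _ _)))

    timesₚ-≡ : ∀ p q → ⟦ timesₚ p q ⟧ₚ ρ ≡ ⟦ p ⟧ₚ ρ * ⟦ q ⟧ₚ ρ
    timesₚ-≡ [] q = refl
    timesₚ-≡ ((c , μ) ∷ p) q = trans (plusₚ-≡ (scaleₚ c μ q) (timesₚ p q))
      (trans (cong₂ _+_ (scaleₚ-≡ c μ q) (timesₚ-≡ p q)) (sym (*-distribʳ-+ (⟦ q ⟧ₚ ρ) (c * _) _)))

    norm-≡ : ∀ e → ⟦ norm e ⟧ₚ ρ ≡ ⟦ e ⟧ ρ
    norm-≡ (con c) = trans (+-identityʳ _) (*-identityʳ c)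
    norm-≡ (var i) = trans (+-identityʳ _) (trans (*-identityˡ _) (*-identityʳ _))
    norm-≡ (a :+ b) = trans (plusₚ-≡ (norm a) (norm b)) (cong₂ _+_ (norm-≡ a) (norm-≡ b))
    norm-≡ (a :* b) = trans (timesₚ-≡ (norm a) (norm b)) (cong₂ _*_ (norm-≡ a) (norm-≡ b))

  -- Domination of coefficients is tested by subtracting the terms one by one. Whatever remains of
  -- the larger polynomial has natural coefficients, hence is nonnegative. Only soundness is proved;
  -- a term overlooked here could at worst reject a valid certificate.
  takeₚ : ℕ → Mono → Poly → Maybe Poly
  takeₚ zero μ q = just q
  takeₚ (suc c) μ [] = nothing
  takeₚ (suc c) μ ((c′ , ν) ∷ q) with μ ≟ₘ ν | suc c ≤ᵇ c′
  ... | true | true = just ((c′ ∸ suc c , ν) ∷ q)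
  ... | true | false = nothing
  ... | false | _ with takeₚ (suc c) μ q
  ...   | just q′ = just ((c′ , ν) ∷ q′)
  ...   | nothing = nothing

  _⊑_ : Poly → Poly → Bool
  [] ⊑ q = true
  ((c , μ) ∷ p) ⊑ q with takeₚ c μ q
  ... | just q′ = p ⊑ q′
  ... | nothing = false

  module _ (ρ : List ℕ) where

    takeₚ-≡ : ∀ c μ q {q′} → takeₚ c μ q ≡ just q′ → ⟦ q ⟧ₚ ρ ≡ c * ⟦ μ ⟧ₘ ρ + ⟦ q′ ⟧ₚ ρ
    takeₚ-≡ zero μ q refl = refl
    takeₚ-≡ (suc c) μ ((c′ , ν) ∷ q) e with μ ≟ₘ ν in eq | suc c ≤ᵇ c′ in le
    takeₚ-≡ (suc c) μ ((c′ , ν) ∷ q) refl | true | true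
      rewrite ≟ₘ-sound μ ν (subst T (sym eq) tt) =
      trans (cong (λ z → z * ⟦ ν ⟧ₘ ρ + ⟦ q ⟧ₚ ρ) (sym (m+[n∸m]≡n (≤ᵇ⇒≤ (suc c) c′ (subst T (sym le) tt)))))
        (trans (cong (_+ ⟦ q ⟧ₚ ρ) (*-distribʳ-+ (⟦ ν ⟧ₘ ρ) (suc c) (c′ ∸ suc c))) (+-assoc (suc c * ⟦ ν ⟧ₘ ρ) ((c′ ∸ suc c) * ⟦ ν ⟧ₘ ρ) (⟦ q ⟧ₚ ρ)))
    takeₚ-≡ (suc c) μ ((c′ , ν) ∷ q) e | false | _ with takeₚ (suc c) μ q in rec
    takeₚ-≡ (suc c) μ ((c′ , ν) ∷ q) refl | false | _ | just q′ =
      trans (cong (c′ * ⟦ ν ⟧ₘ ρ +_) (takeₚ-≡ (suc c) μ q rec)) (x+yz (c′ * ⟦ ν ⟧ₘ ρ) (suc c * ⟦ μ ⟧ₘ ρ) (⟦ q′ ⟧ₚ ρ))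

    ⊑-sound : ∀ p q → T (p ⊑ q) → ⟦ p ⟧ₚ ρ ≤ ⟦ q ⟧ₚ ρ
    ⊑-sound [] q _ = z≤n
    ⊑-sound ((c , μ) ∷ p) q t with takeₚ c μ q in eq
    ... | just q′ rewrite takeₚ-≡ c μ q eq = +-monoʳ-≤ (c * ⟦ μ ⟧ₘ ρ) (⊑-sound p q′ t)

  -- Hypotheses l ≤ r, each with the (nonnegative) polynomial by which it is multiplied.
  Hyps : Set
  Hyps = List (Ex × Ex × Ex)

  Holds : Hyps → List ℕ → Set
  Holds [] ρ = ⊤
  Holds ((l , r , _) ∷ hs) ρ = ⟦ l ⟧ ρ ≤ ⟦ r ⟧ ρ × Holds hs ρ

  lhs rhs : Hyps → Ex
  lhs [] = con 0
  lhs ((l , _ , c) ∷ hs) = c :* l :+ lhs hs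
  rhs [] = con 0
  rhs ((_ , r , c) ∷ hs) = c :* r :+ rhs hs

  -- L ≤ R follows when L + Σ c r ≤ R + Σ c l holds coefficientwise.
  abstract
    polyle : ∀ ρ hs L R → {T (norm (L :+ rhs hs) ⊑ norm (R :+ lhs hs))} → Holds hs ρ → ⟦ L ⟧ ρ ≤ ⟦ R ⟧ ρ
    polyle ρ hs L R {t} h = +-cancelʳ-≤ (⟦ rhs hs ⟧ ρ) _ _ (≤-trans
      (subst₂ _≤_ (norm-≡ ρ (L :+ rhs hs)) (norm-≡ ρ (R :+ lhs hs))
        (⊑-sound ρ (norm (L :+ rhs hs)) (norm (R :+ lhs hs)) t))
      (+-monoʳ-≤ (⟦ R ⟧ ρ) (comb hs h)))
      where
      comb : ∀ hs → Holds hs ρ → ⟦ lhs hs ⟧ ρ ≤ ⟦ rhs hs ⟧ ρ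
      comb [] _ = z≤n
      comb ((l , r , c) ∷ hs) (p , h) = +-mono-≤ (*-monoʳ-≤ (⟦ c ⟧ ρ) p) (comb hs h)

open Inequality

-- Finite sums over lists.

private variable
  El El′ : Set

∑ : List El → (El → ℕ) → ℕ
∑ [] f = 0
∑ (x ∷ xs) f = f x + ∑ xs f

∑-cong : ∀ {f g : El → ℕ} xs → (∀ x → f x ≡ g x) → ∑ xs f ≡ ∑ xs g
∑-cong [] h = refl
∑-cong (x ∷ xs) h = cong₂ _+_ (h x) (∑-cong xs h)

∑-mono : ∀ {f g : El → ℕ} xs → (∀ {x} → x ∈ xs → f x ≤ g x) → ∑ xs f ≤ ∑ xs g
∑-mono [] h = z≤n
∑-mono (x ∷ xs) h = +-mono-≤ (h (here refl)) (∑-mono xs (h ∘ there))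

∑-+ : ∀ (f g : El → ℕ) xs → ∑ xs (λ x → f x + g x) ≡ ∑ xs f + ∑ xs g
∑-+ f g [] = refl
∑-+ f g (x ∷ xs) = trans (cong (f x + g x +_) (∑-+ f g xs)) (lem (f x) (g x) _ _)
  where
  lem : ∀ a b c d → a + b + (c + d) ≡ a + c + (b + d)
  lem a b c d = trans (+-assoc a b _) (trans (cong (a +_) (x+yz b c d)) (sym (+-assoc a c _)))

∑-*ʳ : ∀ (f : El → ℕ) c xs → ∑ xs (λ x → f x * c) ≡ ∑ xs f * c
∑-*ʳ f c [] = refl
∑-*ʳ f c (x ∷ xs) = trans (cong (f x * c +_) (∑-*ʳ f c xs)) (sym (*-distribʳ-+ c (f x) _))

∑-*ˡ : ∀ (f : El → ℕ) c xs → ∑ xs (λ x → c * f x) ≡ c * ∑ xs f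
∑-*ˡ f c xs = trans (∑-cong xs (λ x → *-comm c (f x))) (trans (∑-*ʳ f c xs) (*-comm _ c))

∑-const : ∀ (xs : List El) c → ∑ xs (λ _ → c) ≡ length xs * c
∑-const [] c = refl
∑-const (_ ∷ xs) c = cong (c +_) (∑-const xs c)

∑-zero : ∀ (xs : List El) → ∑ xs (λ _ → 0) ≡ 0
∑-zero xs = trans (∑-const xs 0) (*-zeroʳ (length xs))

∑-≤-const : ∀ {f : El → ℕ} xs c → (∀ {x} → x ∈ xs → f x ≤ c) → ∑ xs f ≤ length xs * c
∑-≤-const xs c h = ≤-trans (∑-mono xs h) (≤-reflexive (∑-const xs c))

∑-++ : ∀ (f : El → ℕ) xs ys → ∑ (xs ++ ys) f ≡ ∑ xs f + ∑ ys f
∑-++ f [] ys = refl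
∑-++ f (x ∷ xs) ys = trans (cong (f x +_) (∑-++ f xs ys)) (sym (+-assoc (f x) _ _))

∑-↭ : ∀ (f : El → ℕ) {xs ys} → xs ↭ ys → ∑ xs f ≡ ∑ ys f
∑-↭ f refl = refl
∑-↭ f (prep x p) = cong (f x +_) (∑-↭ f p)
∑-↭ f (swap x y p) = trans (cong (λ z → f x + (f y + z)) (∑-↭ f p)) (x+yz (f x) (f y) _)
∑-↭ f (transₚ p q) = trans (∑-↭ f p) (∑-↭ f q)

∑-swap : ∀ (f : El → El′ → ℕ) xs ys → ∑ xs (λ x → ∑ ys (f x)) ≡ ∑ ys (λ y → ∑ xs (λ x → f x y))
∑-swap f [] ys = sym (∑-zero ys)
∑-swap f (x ∷ xs) ys = trans (cong (∑ ys (f x) +_) (∑-swap f xs ys)) (sym (∑-+ (f x) _ ys))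

∈⇒≤∑ : ∀ (f : El → ℕ) {x xs} → x ∈ xs → f x ≤ ∑ xs f
∈⇒≤∑ f (here refl) = m≤m+n _ _
∈⇒≤∑ f {xs = y ∷ _} (there i) = ≤-trans (∈⇒≤∑ f i) (m≤n+m _ (f y))

∑>0⇒∃ : ∀ (f : El → ℕ) xs → 0 < ∑ xs f → ∃ λ x → x ∈ xs × 0 < f x
∑>0⇒∃ f (x ∷ xs) p with f x in eq
... | suc _ = x , here refl , subst (0 <_) (sym eq) (s≤s z≤n)
... | zero with ∑>0⇒∃ f xs p
...   | y , i , q = y , there i , q

∈⇒↭ : ∀ {x : El} {xs} → x ∈ xs → ∃ λ r → xs ↭ x ∷ r
∈⇒↭ {x = x} i with ∈-∃++ i
... | ys , zs , refl = ys ++ zs , shift x ys zs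

∑∑ : List El → (El → El → ℕ) → ℕ
∑∑ xs G = ∑ xs (λ x → ∑ xs (G x))

-- The hypothesis `xs ↭ x ∷ y ∷ r` puts `x` and `y` at different positions and names what is left
-- without them, which is what an exchange needs. In the induction a new element adds its diagonal
-- entry, a row and a column.
∑∑-≤-off : ∀ (G : El → El → ℕ) b c xs → (∀ x y r → xs ↭ x ∷ y ∷ r → G x y ≤ b) →
  (∀ x → G x x ≤ c) → ∑∑ xs G + length xs * b ≤ length xs * length xs * b + length xs * c
∑∑-≤-off G b c [] off diag = z≤n
∑∑-≤-off G b c (x ∷ xs) off diag = begin
  G x x + ∑ xs (G x) + ∑ xs (λ y → G y x + ∑ xs (G y)) + suc (length xs) * b
    ≡⟨ cong (λ z → G x x + ∑ xs (G x) + z + suc (length xs) * b) (∑-+ (λ y → G y x) (λ y → ∑ xs (G y)) xs) ⟩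
  G x x + ∑ xs (G x) + (∑ xs (λ y → G y x) + ∑∑ xs G) + suc (length xs) * b
    ≤⟨ polyle (length xs ∷ b ∷ c ∷ G x x ∷ ∑ xs (G x) ∷ ∑ xs (λ y → G y x) ∷ ∑∑ xs G ∷ [])
         ((var 3 , var 2 , con 1) ∷ (var 4 , var 0 :* var 1 , con 1) ∷ (var 5 , var 0 :* var 1 , con 1) ∷
          (var 6 :+ var 0 :* var 1 , var 0 :* var 0 :* var 1 :+ var 0 :* var 2 , con 1) ∷ [])
         (var 3 :+ var 4 :+ (var 5 :+ var 6) :+ (con 1 :+ var 0) :* var 1)
         ((con 1 :+ var 0) :* (con 1 :+ var 0) :* var 1 :+ (con 1 :+ var 0) :* var 2)
         (diag x ,
          ∑-≤-const xs b (λ {y} i → let r , p = ∈⇒↭ i in off x y r (prep x p)) ,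
          ∑-≤-const xs b (λ {y} i → let r , p = ∈⇒↭ i in off y x r (↭-trans (prep x p) (swap x y ↭-refl))) ,
          ∑∑-≤-off G b c xs (λ y z r p → off y z (x ∷ r)
            (↭-trans (prep x p) (↭-trans (swap x y ↭-refl) (prep y (swap x z ↭-refl))))) diag , tt) ⟩
  suc (length xs) * suc (length xs) * b + suc (length xs) * c ∎
  where open ≤-Reasoning

∑∑-≤ : ∀ (G : El → El → ℕ) b c xs → (∀ x y r → xs ↭ x ∷ y ∷ r → G x y ≤ b) →
  (∀ x → G x x ≤ c) → ∑∑ xs G ≤ length xs * length xs * b + length xs * c
∑∑-≤ G b c xs off diag = ≤-trans (m≤m+n _ _) (∑∑-≤-off G b c xs off diag)

-- Rearrangements of short lists, decided on indices.

remove : ∀ {k} → Fin k → List (Fin k) → Maybe (List (Fin k))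
remove i [] = nothing
remove i (j ∷ js) with i F.≟ j
... | yes _ = just js
... | no _ with remove i js
...   | just r = just (j ∷ r)
...   | nothing = nothing

isPerm : ∀ {k} → List (Fin k) → List (Fin k) → Bool
isPerm [] [] = true
isPerm [] (_ ∷ _) = false
isPerm (i ∷ is) js with remove i js
... | just r = isPerm is r
... | nothing = false

remove-↭ : ∀ {k} (i : Fin k) js {r} → remove i js ≡ just r → i ∷ r ↭ js
remove-↭ i (j ∷ js) e with i F.≟ j
remove-↭ i (j ∷ js) refl | yes refl = ↭-refl
... | no _ with remove i js in eq
remove-↭ i (j ∷ js) refl | no _ | just r = ↭-trans (swap i j ↭-refl) (prep j (remove-↭ i js eq))

isPerm-↭ : ∀ {k} (is js : List (Fin k)) → T (isPerm is js) → is ↭ js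
isPerm-↭ [] [] _ = ↭-refl
isPerm-↭ (i ∷ is) js t with remove i js in eq
... | just r = ↭-trans (prep i (isPerm-↭ is r t)) (remove-↭ i js eq)

-- The exchanges regroup a dozen named vertices. The new order is written as a list of positions,
-- and evaluation of `isPerm` settles that each position occurs once, so that the implicit proof is
-- found by unification.
permBy : ∀ (xs : List El) (is : List (Fin (length xs))) → {T (isPerm is (allFin (length xs)))} →
  xs ↭ map (lookup xs) is
permBy xs is {t} = ↭-sym (↭-trans (map⁺ (lookup xs) (isPerm-↭ is _ t))
  (↭-reflexive (trans (map-tabulate (λ i → i) (lookup xs)) (tabulate-lookup xs))))

-- Triples, exchanges, and sums over pairs split along a matching.

Tri : Set → Set
Tri El = El × El × El

vx : Tri El → List El
vx (a , b , c) = a ∷ b ∷ c ∷ []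

flat : List (Tri El) → List El
flat [] = []
flat (t ∷ ts) = vx t ++ flat ts

flat-++ : ∀ (ts us : List (Tri El)) → flat (ts ++ us) ≡ flat ts ++ flat us
flat-++ [] us = refl
flat-++ ((a , b , c) ∷ ts) us = cong (λ z → a ∷ b ∷ c ∷ z) (flat-++ ts us)

flat-↭ : ∀ {ts us : List (Tri El)} → ts ↭ us → flat ts ↭ flat us
flat-↭ refl = ↭-refl
flat-↭ (prep t p) = ++⁺ˡ (vx t) (flat-↭ p)
flat-↭ (swap {xs} {ys} t u p) = ↭-trans (++⁺ˡ (vx t) (++⁺ˡ (vx u) (flat-↭ p))) (shifts (vx t) (vx u))
flat-↭ (transₚ p q) = ↭-trans (flat-↭ p) (flat-↭ q)

length-flat : ∀ (ts : List (Tri El)) → length (flat ts) ≡ length ts * 3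
length-flat [] = refl
length-flat (t ∷ ts) = cong (λ z → suc (suc (suc z))) (length-flat ts)

∑-flat : ∀ (f : El → ℕ) ts → ∑ (flat ts) f ≡ ∑ ts (λ t → ∑ (vx t) f)
∑-flat f [] = refl
∑-flat f (t ∷ ts) = trans (∑-++ f (vx t) (flat ts)) (cong (∑ (vx t) f +_) (∑-flat f ts))

reorder : ∀ (a b c d : List El) → (a ++ b) ++ c ++ d ↭ (a ++ c) ++ (b ++ d)
reorder a b c d = ↭-trans (↭-reflexive (++-assoc a b (c ++ d)))
  (↭-trans (++⁺ˡ a (shifts b c)) (↭-reflexive (sym (++-assoc a c (b ++ d)))))

-- The triples `old` and the uncovered vertices `out` are cut anew into the triples `new` and the
-- vertices `back`, which become uncovered. The block `X` is locked and stays in place.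
exchange : ∀ {X vs L out back L′ : List El} {M old new M′} → flat M ++ X ++ L ↭ vs →
  M ↭ old ++ M′ → L ↭ out ++ L′ → flat old ++ out ↭ flat new ++ back →
  flat (new ++ M′) ++ X ++ (back ++ L′) ↭ vs
exchange {X = X} {vs} {L} {out} {back} {L′} {M} {old} {new} {M′} part pM pL e = begin
  flat (new ++ M′) ++ X ++ (back ++ L′)       ≡⟨ cong (_++ X ++ (back ++ L′)) (flat-++ new M′) ⟩
  (flat new ++ flat M′) ++ X ++ (back ++ L′)  ↭⟨ ++⁺ˡ (flat new ++ flat M′) (shifts X back) ⟩
  (flat new ++ flat M′) ++ back ++ (X ++ L′)  ↭⟨ reorder (flat new) (flat M′) back (X ++ L′) ⟩
  (flat new ++ back) ++ (flat M′ ++ X ++ L′)  ↭⟨ ++⁺ʳ (flat M′ ++ X ++ L′) (↭-sym e) ⟩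
  (flat old ++ out) ++ (flat M′ ++ X ++ L′)   ↭⟨ reorder (flat old) (flat M′) out (X ++ L′) ⟨
  (flat old ++ flat M′) ++ out ++ (X ++ L′)   ↭⟨ ++⁺ˡ (flat old ++ flat M′) (shifts out X) ⟩
  (flat old ++ flat M′) ++ X ++ (out ++ L′)   ≡⟨ cong (_++ X ++ (out ++ L′)) (flat-++ old M′) ⟨
  flat (old ++ M′) ++ X ++ (out ++ L′)        ↭⟨ ++⁺ (flat-↭ (↭-sym pM)) (++⁺ˡ X (↭-sym pL)) ⟩
  flat M ++ X ++ L                            ↭⟨ part ⟩
  vs                                          ∎
  where open PermutationReasoning

cross : (El → El → ℕ) → Tri El → Tri El → ℕ
cross F e e′ = ∑ (vx e) (λ p → ∑ (vx e′) (F p))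

∑∑-++ : ∀ (F : El → El → ℕ) → (∀ x y → F x y ≡ F y x) → ∀ xs ys →
  ∑∑ (xs ++ ys) F ≡ ∑∑ xs F + 2 * ∑ xs (λ x → ∑ ys (F x)) + ∑∑ ys F
∑∑-++ F F-sym xs ys = begin
  ∑∑ (xs ++ ys) F                                       ≡⟨ ∑-cong (xs ++ ys) (λ x → ∑-++ (F x) xs ys) ⟩
  ∑ (xs ++ ys) (λ x → ∑ xs (F x) + ∑ ys (F x))          ≡⟨ ∑-+ _ _ (xs ++ ys) ⟩
  ∑ (xs ++ ys) (λ x → ∑ xs (F x)) + ∑ (xs ++ ys) (λ x → ∑ ys (F x))
    ≡⟨ cong₂ _+_ (∑-++ _ xs ys) (∑-++ _ xs ys) ⟩
  (∑∑ xs F + ∑ ys (λ x → ∑ xs (F x))) + (c + ∑∑ ys F)   ≡⟨ cong (λ z → ∑∑ xs F + z + (c + ∑∑ ys F)) flip′ ⟩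
  (∑∑ xs F + c) + (c + ∑∑ ys F)                         ≡⟨ +-assoc (∑∑ xs F + c) c _ ⟨
  ∑∑ xs F + c + c + ∑∑ ys F                             ≡⟨ cong (_+ ∑∑ ys F) (+-assoc (∑∑ xs F) c c) ⟩
  ∑∑ xs F + (c + c) + ∑∑ ys F        ≡⟨ cong (λ z → ∑∑ xs F + (c + z) + ∑∑ ys F) (+-identityʳ c) ⟨
  ∑∑ xs F + 2 * c + ∑∑ ys F                             ∎
  where
  open ≡-Reasoning
  c = ∑ xs (λ x → ∑ ys (F x))
  flip′ : ∑ ys (λ x → ∑ xs (F x)) ≡ c
  flip′ = trans (∑-cong ys (λ y → ∑-cong xs (F-sym y))) (∑-swap (λ y x → F x y) ys xs)

∑∑-flat : ∀ (F : El → El → ℕ) ts → ∑∑ (flat ts) F ≡ ∑∑ ts (cross F)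
∑∑-flat F ts = trans (∑-flat _ ts) (∑-cong ts (λ t →
  trans (∑-cong (vx t) (λ p → ∑-flat (F p) ts)) (∑-swap (λ p u → ∑ (vx u) (F p)) (vx t) ts)))

-- `R` collects the few exceptional vertices: at most 2 |R| n ordered pairs meet it, each counting
-- at most `c`. The other pairs have two, one or no vertices in `M`.
∑∑-split : ∀ (F : El → El → ℕ) → (∀ x y → F x y ≡ F y x) → ∀ c → (∀ x y → F x y ≤ c) →
  ∀ {vs} M Y R → vs ↭ (flat M ++ Y) ++ R →
  ∑∑ vs F ≤ ∑∑ M (cross F) + 2 * ∑ M (λ e → ∑ Y (λ z → ∑ (vx e) (λ p → F p z))) + ∑∑ Y F
            + 2 * (length R * length vs * c)
∑∑-split F F-sym c F≤c {vs} M Y R p = begin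
  ∑∑ vs F                                ≡⟨ ∑-↭ _ p ⟩
  ∑ (P ++ R) (λ x → ∑ vs (F x))          ≡⟨ ∑-cong (P ++ R) (λ x → ∑-↭ (F x) p) ⟩
  ∑∑ (P ++ R) F                          ≡⟨ ∑∑-++ F F-sym P R ⟩
  ∑∑ P F + 2 * ∑ P (λ x → ∑ R (F x)) + ∑∑ R F
    ≤⟨ polyle (∑∑ P F ∷ ∑ P (λ x → ∑ R (F x)) ∷ ∑∑ R F ∷ length P ∷ length R ∷ c ∷ length vs ∷ [])
         ((var 1 , var 3 :* (var 4 :* var 5) , con 2) ∷ (var 2 , var 4 :* (var 4 :* var 5) , con 1) ∷
          (var 3 :+ var 4 , var 6 , con 2 :* var 4 :* var 5) ∷ [])
         (var 0 :+ con 2 :* var 1 :+ var 2) (var 0 :+ con 2 :* (var 4 :* var 6 :* var 5))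
         (∑-≤-const P _ (λ {x} _ → ∑-≤-const R c (λ {y} _ → F≤c x y)) ,
          ∑-≤-const R _ (λ {x} _ → ∑-≤-const R c (λ {y} _ → F≤c x y)) ,
          ≤-reflexive (sym (trans (↭-length p) (length-++ P))) , tt) ⟩
  ∑∑ P F + 2 * (length R * length vs * c)
    ≡⟨ cong (_+ 2 * (length R * length vs * c)) (trans (∑∑-++ F F-sym (flat M) Y)
         (cong₂ (λ u v → u + 2 * v + ∑∑ Y F) (∑∑-flat F M)
           (trans (∑-flat _ M) (∑-cong M (λ e → ∑-swap F (vx e) Y))))) ⟩
  ∑∑ M (cross F) + 2 * ∑ M (λ e → ∑ Y (λ z → ∑ (vx e) (λ p → F p z))) + ∑∑ Y F
    + 2 * (length R * length vs * c) ∎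
  where
  open ≤-Reasoning
  P = flat M ++ Y

-- Functions with values 0 and 1 that exclude each other.

bits₃ : ∀ {a b c} → a ≤ 1 → b ≤ 1 → c ≤ 1 → (a ≡ 1 → b ≡ 1 → c ≡ 1 → ⊥) → a + b + c ≤ 2
bits₃ {0} z≤n p q h = +-mono-≤ p q
bits₃ {1} {0} (s≤s z≤n) p q h = s≤s q
bits₃ {1} {1} {0} (s≤s z≤n) p q h = ≤-refl
bits₃ {1} {1} {1} (s≤s z≤n) p q h = ⊥-elim (h refl refl refl)
bits₃ {1} {1} {suc (suc _)} p q (s≤s ()) h
bits₃ {1} {suc (suc _)} p (s≤s ()) q h
bits₃ {suc (suc _)} (s≤s ()) p q h

bit-0 : ∀ {a} → a ≤ 1 → (a ≡ 1 → ⊥) → a ≤ 0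
bit-0 z≤n h = z≤n
bit-0 (s≤s z≤n) h = ⊥-elim (h refl)

-- If `f` is 1 at `y`, then `g` vanishes at all other positions, so that only `y` itself can
-- contribute to the sum of `g`.
∑-two : ∀ (f g : El → ℕ) → (∀ x → f x ≤ 1) → (∀ x → g x ≤ 1) → ∀ ys →
  (∀ y z r → ys ↭ y ∷ z ∷ r → f y ≡ 1 → g z ≡ 1 → ⊥) → ∑ ys f ≤ 1 ⊎ ∑ ys g ≤ 1
∑-two f g f≤ g≤ ys h with ∑ ys f in eq
... | zero = inj₁ z≤n
... | suc _ with ∑>0⇒∃ f ys (subst (0 <_) (sym eq) (s≤s z≤n))
...   | y , i , p with ∈⇒↭ i
...     | r , ys↭ = inj₂ (≤-trans (≤-reflexive (∑-↭ g ys↭)) (≤-trans (+-mono-≤ (g≤ y)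
            (≤-trans (∑-≤-const r 0 (λ {z} j → let r′ , q = ∈⇒↭ j in
              bit-0 (g≤ z) (h y z r′ (↭-trans ys↭ (prep y q)) (≤-antisym (f≤ y) p))))
              (≤-reflexive (*-zeroʳ (length r))))) (s≤s z≤n)))

∑-two-≤ : ∀ (f g : El → ℕ) → (∀ x → f x ≤ 1) → (∀ x → g x ≤ 1) → ∀ ys →
  (∀ y z r → ys ↭ y ∷ z ∷ r → f y ≡ 1 → g z ≡ 1 → ⊥) → ∑ ys (λ y → f y + g y) ≤ length ys + 1
∑-two-≤ f g f≤ g≤ ys h = ≤-trans (≤-reflexive (∑-+ f g ys)) (go (∑-two f g f≤ g≤ ys h))
  where
  go : ∑ ys f ≤ 1 ⊎ ∑ ys g ≤ 1 → ∑ ys f + ∑ ys g ≤ length ys + 1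
  go (inj₁ p) = polyle (∑ ys f ∷ ∑ ys g ∷ length ys ∷ [])
    ((var 0 , con 1 , con 1) ∷ (var 1 , var 2 :* con 1 , con 1) ∷ [])
    (var 0 :+ var 1) (var 2 :+ con 1) (p , ∑-≤-const ys 1 (λ _ → g≤ _) , tt)
  go (inj₂ p) = polyle (∑ ys f ∷ ∑ ys g ∷ length ys ∷ [])
    ((var 1 , con 1 , con 1) ∷ (var 0 , var 2 :* con 1 , con 1) ∷ [])
    (var 0 :+ var 1) (var 2 :+ con 1) (p , ∑-≤-const ys 1 (λ _ → f≤ _) , tt)

-- Pairwise, one of any two of the three sums is at most 1.
∑-three-≤ : ∀ (f g h : El → ℕ) → (∀ x → f x ≤ 1) → (∀ x → g x ≤ 1) → (∀ x → h x ≤ 1) → ∀ ys →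
  (∀ y z r → ys ↭ y ∷ z ∷ r → f y ≡ 1 → g z ≡ 1 → ⊥) →
  (∀ y z r → ys ↭ y ∷ z ∷ r → f y ≡ 1 → h z ≡ 1 → ⊥) →
  (∀ y z r → ys ↭ y ∷ z ∷ r → g y ≡ 1 → h z ≡ 1 → ⊥) →
  ∑ ys (λ y → f y + g y + h y) ≤ length ys + 2
∑-three-≤ f g h f≤ g≤ h≤ ys fg fh gh with ∑-two f g f≤ g≤ ys fg
... | inj₁ p = ≤-trans
    (≤-reflexive (trans (∑-cong ys (λ y → +-assoc (f y) (g y) (h y))) (∑-+ f (λ y → g y + h y) ys)))
    (≤-trans (+-mono-≤ p (∑-two-≤ g h g≤ h≤ ys gh)) (≤-reflexive (trans (+-comm 1 _) (+-assoc (length ys) 1 1))))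
... | inj₂ p = ≤-trans
    (≤-reflexive (trans (∑-cong ys (λ y → trans (cong (_+ h y) (+-comm (f y) (g y))) (+-assoc (g y) (f y) (h y))))
      (∑-+ g (λ y → f y + h y) ys)))
    (≤-trans (+-mono-≤ p (∑-two-≤ f h f≤ h≤ ys fh)) (≤-reflexive (trans (+-comm 1 _) (+-assoc (length ys) 1 1))))

-- Hypergraphs, and three links between two edges of a matching.

-- E u v w is 1 if {u , v , w} is an edge, and 0 otherwise.
record Hypergraph : Set₁ where
  field
    V : Set
    E : V → V → V → ℕ
    E≤1 : ∀ u v w → E u v w ≤ 1
    E₁₂ : ∀ u v w → E u v w ≡ E v u w
    E₂₃ : ∀ u v w → E u v w ≡ E u w v
    E-irr : ∀ u v → E u v v ≡ 0
    vs : List V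
    complete : ∀ v → v ∈ vs
    covered : ∀ v → ∃₂ λ a b → E v a b ≡ 1

module Exchange (G : Hypergraph) where

  open Hypergraph G

  Edge : Tri V → Set
  Edge (a , b , c) = E a b c ≡ 1

  F₃ : V → V → V → V → V → ℕ
  F₃ x y z p q = E x p q + E y p q + E z p q

  F₃-sym : ∀ x y z p q → F₃ x y z p q ≡ F₃ x y z q p
  F₃-sym x y z p q = cong₂ _+_ (cong₂ _+_ (E₂₃ x p q) (E₂₃ y p q)) (E₂₃ z p q)

  F₃≤3 : ∀ x y z p q → F₃ x y z p q ≤ 3
  F₃≤3 x y z p q = +-mono-≤ (+-mono-≤ (E≤1 x p q) (E≤1 y p q)) (E≤1 z p q)

  cross-F₃≤27 : ∀ x y z e e′ → cross (F₃ x y z) e e′ ≤ 27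
  cross-F₃≤27 x y z e e′ = ∑-≤-const (vx e) 9 (λ {p} _ → ∑-≤-const (vx e′) 3 (λ {q} _ → F₃≤3 x y z p q))

  -- Maximality is used through this local condition: three such edges would enlarge the matching in
  -- `Three` and `Four`, and would cover one more low vertex in `LowVertex`.
  No₃ : List V → Tri V → Tri V → Set
  No₃ xs e e′ = ∀ t u v → Edge t → Edge u → Edge v → vx e ++ vx e′ ++ xs ↭ flat (t ∷ u ∷ v ∷ []) → ⊥

  module Rainbow (x y z : V) (e e′ : Tri V) (no : No₃ (x ∷ y ∷ z ∷ []) e e′) where
    private
      L = vx e ++ vx e′ ++ x ∷ y ∷ z ∷ []
      at : Fin 9 → V
      at = lookup L

    -- Positions 0-2 are the vertices of `e`, 3-5 those of `e′`, 6-8 the vertices `x`, `y`, `z`.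
    -- Three cells from three different links, in different rows and columns, would be three
    -- disjoint edges on the nine vertices.
    rainbow : ∀ (u₀ u₁ u₂ c₀ c₁ c₂ : Fin 9) →
      {T (isPerm (u₀ ∷ 0F ∷ c₀ ∷ u₁ ∷ 1F ∷ c₁ ∷ u₂ ∷ 2F ∷ c₂ ∷ []) (allFin 9))} →
      E (at u₀) (at 0F) (at c₀) + E (at u₁) (at 1F) (at c₁) + E (at u₂) (at 2F) (at c₂) ≤ 2
    rainbow u₀ u₁ u₂ c₀ c₁ c₂ {t} = bits₃ (E≤1 _ _ _) (E≤1 _ _ _) (E≤1 _ _ _) (λ p q r →
      no _ _ _ p q r (permBy L (u₀ ∷ 0F ∷ c₀ ∷ u₁ ∷ 1F ∷ c₁ ∷ u₂ ∷ 2F ∷ c₂ ∷ []) {t}))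

  -- Variables 9 i + 3 r + c stand for the entry in row r, column c of the i-th link.
  private
    cell : ℕ → ℕ → ℕ → Ex
    cell i r c = var (i * 9 + r * 3 + c)

    S₃ : (ℕ → Ex) → Ex
    S₃ f = f 0 :+ (f 1 :+ (f 2 :+ con 0))

    links : V → V → V → Tri V → Tri V → List ℕ
    links x y z (a₀ , a₁ , a₂) (b₀ , b₁ , b₂) =
      go x ++ go y ++ go z
      where
      row : V → V → List ℕ
      row v a = E v a b₀ ∷ E v a b₁ ∷ E v a b₂ ∷ []
      go : V → List ℕ
      go v = row v a₀ ++ row v a₁ ++ row v a₂

    crossEx : Ex
    crossEx = S₃ (λ r → S₃ (λ c → cell 0 r c :+ cell 1 r c :+ cell 2 r c))

    rb : ℕ → ℕ → ℕ → ℕ → ℕ → ℕ → Ex × Ex × Ex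
    rb u₀ u₁ u₂ c₀ c₁ c₂ = cell u₀ 0 c₀ :+ cell u₁ 1 c₁ :+ cell u₂ 2 c₂ , con 2 , con 1

  module _ (x y z : V) (e e′ : Tri V) (no : No₃ (x ∷ y ∷ z ∷ []) e e′) where
    open Rainbow x y z e e′ no

    -- Cyclic shifts of the links and of the columns yield nine rainbow triples, which meet each of
    -- the 27 cells exactly once; each triple holds at most 2.
    cross-≤18 : cross (F₃ x y z) e e′ ≤ 18
    cross-≤18 = polyle (links x y z e e′)
      (rb 0 1 2 0 1 2 ∷ rb 0 1 2 1 2 0 ∷ rb 0 1 2 2 0 1 ∷
       rb 2 0 1 0 1 2 ∷ rb 2 0 1 1 2 0 ∷ rb 2 0 1 2 0 1 ∷
       rb 1 2 0 0 1 2 ∷ rb 1 2 0 1 2 0 ∷ rb 1 2 0 2 0 1 ∷ [])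
      crossEx (con 18)
      (rainbow 6F 7F 8F 3F 4F 5F , rainbow 6F 7F 8F 4F 5F 3F , rainbow 6F 7F 8F 5F 3F 4F ,
       rainbow 8F 6F 7F 3F 4F 5F , rainbow 8F 6F 7F 4F 5F 3F , rainbow 8F 6F 7F 5F 3F 4F ,
       rainbow 7F 8F 6F 3F 4F 5F , rainbow 7F 8F 6F 4F 5F 3F , rainbow 7F 8F 6F 5F 3F 4F , tt)

    private
      at = lookup (vx e ++ vx e′)
      zero-cell : ℕ → ℕ → ℕ → Ex × Ex × Ex
      zero-cell i r c = cell i r c , con 0 , con 2
      one-cell : ℕ → ℕ → ℕ → Ex × Ex × Ex
      one-cell i r c = cell i r c , con 1 , con 2

    -- The eight rainbow triples through one of the four remaining pairs in the link of x sharpen 18 to 16.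
    cross-≤16 : (∀ q → E x (at 2F) q ≡ 0) → (∀ p → E x p (at 5F) ≡ 0) →
      E y (at 2F) (at 5F) ≡ 0 → E z (at 2F) (at 5F) ≡ 0 → cross (F₃ x y z) e e′ + 2 ≤ 18
    cross-≤16 h₂ h₅ hy hz = *-cancelˡ-≤ 2 (polyle (links x y z e e′)
      (zero-cell 0 0 2 ∷ zero-cell 0 1 2 ∷ zero-cell 0 2 0 ∷ zero-cell 0 2 1 ∷ zero-cell 0 2 2 ∷
       zero-cell 1 2 2 ∷ zero-cell 2 2 2 ∷
       rb 0 1 2 0 2 1 ∷ rb 0 1 2 1 2 0 ∷ rb 0 2 1 0 2 1 ∷ rb 0 2 1 1 2 0 ∷
       rb 1 0 2 2 0 1 ∷ rb 1 0 2 2 1 0 ∷ rb 2 0 1 2 0 1 ∷ rb 2 0 1 2 1 0 ∷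
       one-cell 1 0 0 ∷ one-cell 1 0 1 ∷ one-cell 1 1 0 ∷ one-cell 1 1 1 ∷
       one-cell 2 0 0 ∷ one-cell 2 0 1 ∷ one-cell 2 1 0 ∷ one-cell 2 1 1 ∷ [])
      (con 2 :* (crossEx :+ con 2)) (con 2 :* con 18)
      (≤-reflexive (h₅ _) , ≤-reflexive (h₅ _) , ≤-reflexive (h₂ _) , ≤-reflexive (h₂ _) , ≤-reflexive (h₂ _) ,
       ≤-reflexive hy , ≤-reflexive hz ,
       rainbow 6F 7F 8F 3F 5F 4F , rainbow 6F 7F 8F 4F 5F 3F , rainbow 6F 8F 7F 3F 5F 4F , rainbow 6F 8F 7F 4F 5F 3F ,
       rainbow 7F 6F 8F 5F 3F 4F , rainbow 7F 6F 8F 5F 4F 3F , rainbow 8F 6F 7F 5F 3F 4F , rainbow 8F 6F 7F 5F 4F 3F ,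
       E≤1 _ _ _ , E≤1 _ _ _ , E≤1 _ _ _ , E≤1 _ _ _ , E≤1 _ _ _ , E≤1 _ _ _ , E≤1 _ _ _ , E≤1 _ _ _ , tt))

-- The degree sum of three uncovered vertices.

module Three (G : Hypergraph) where

  open Hypergraph G

  open Exchange G

  n : ℕ
  n = length vs

  d : V → ℕ
  d v = ∑∑ vs (E v)

  ∑∑-F₃ : ∀ x y z → ∑∑ vs (F₃ x y z) ≡ d x + d y + d z
  ∑∑-F₃ x y z = begin
    ∑∑ vs (F₃ x y z)
      ≡⟨ ∑-cong vs (λ p → trans (∑-+ (λ q → E x p q + E y p q) (E z p) vs) (cong (_+ ∑ vs (E z p)) (∑-+ (E x p) (E y p) vs))) ⟩
    ∑ vs (λ p → ∑ vs (E x p) + ∑ vs (E y p) + ∑ vs (E z p))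
      ≡⟨ ∑-+ (λ p → ∑ vs (E x p) + ∑ vs (E y p)) (λ p → ∑ vs (E z p)) vs ⟩
    ∑ vs (λ p → ∑ vs (E x p) + ∑ vs (E y p)) + d z
      ≡⟨ cong (_+ d z) (∑-+ (λ p → ∑ vs (E x p)) (λ p → ∑ vs (E y p)) vs) ⟩
    d x + d y + d z ∎
    where open ≡-Reasoning

  -- `X` holds the vertices that exchanges must not touch: those of the absorbing edges and of edges
  -- that have to stay in the matching.
  Part : List (Tri V) → List V → List V → Set
  Part M X L = flat M ++ X ++ L ↭ vs

  length-Part : ∀ {M X L} → Part M X L → length M * 3 + (length X + length L) ≡ n
  length-Part {M} {X} {L} p = trans (sym (trans (length-++ (flat M))
    (cong₂ _+_ (length-flat M) (length-++ X)))) (↭-length p)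

  Maximal : List (Tri V) → List V → Set
  Maximal M X = ∀ M′ L′ → All Edge M′ → Part M′ X L′ → length M′ ≡ suc (length M) → ⊥

  module _ (X : List V) (M : List (Tri V)) (L : List V) (x y z : V) (M-edge : All Edge M)
    (part : Part M X (x ∷ y ∷ z ∷ L)) (max : Maximal M X) where

    private
      replace : ∀ {old out new back r L′} → M ↭ old ++ r → x ∷ y ∷ z ∷ L ↭ out ++ L′ →
        flat old ++ out ↭ flat new ++ back → All Edge new → length new ≡ suc (length old) → ⊥
      replace {old} {out} {new} {back} {r} pM pL e ne len = max (new ++ r) _
        (All.++⁺ ne (All.++⁻ʳ old (All-resp-↭ pM M-edge)))
        (exchange {X = X} {out = out} {back = back} {old = old} {new} part pM pL e)
        (trans (length-++ new) (trans (cong (_+ length r) len)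
          (cong suc (trans (sym (length-++ old)) (sym (↭-length pM))))))

      no₃ : ∀ e e′ r → M ↭ e ∷ e′ ∷ r → No₃ (x ∷ y ∷ z ∷ []) e e′
      no₃ e e′ r pM t u v te ue ve p = replace {e ∷ e′ ∷ []} {x ∷ y ∷ z ∷ []} {t ∷ u ∷ v ∷ []} {[]}
        pM ↭-refl p (te ∷ ue ∷ ve ∷ []) refl

      inner : ∀ p q r → L ↭ p ∷ q ∷ r → F₃ x y z p q ≤ 0
      inner p q r pL = +-mono-≤ (+-mono-≤ (bit-0 (E≤1 x p q) (single 0F 1F 2F))
          (bit-0 (E≤1 y p q) (single 1F 0F 2F))) (bit-0 (E≤1 z p q) (single 2F 0F 1F))
        where
        S = x ∷ y ∷ z ∷ p ∷ q ∷ []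
        single : ∀ (u k l : Fin 5) {_ : T (isPerm (u ∷ 3F ∷ 4F ∷ k ∷ l ∷ []) (allFin 5))} → E (lookup S u) p q ≡ 1 → ⊥
        single u k l {t} e = replace {[]} {S} {_ ∷ []} {_ ∷ _ ∷ []} ↭-refl
          (prep x (prep y (prep z pL))) (permBy S (u ∷ 3F ∷ 4F ∷ k ∷ l ∷ []) {t}) (e ∷ []) refl

      module _ (e : Tri V) (r : List (Tri V)) (pM : M ↭ e ∷ r) where
        S : V → V → List V
        S s t = vx e ++ x ∷ y ∷ z ∷ s ∷ t ∷ []

        two : ∀ (u₀ c₀ u₁ c₁ k₀ k₁ : Fin 8) → {T (isPerm (u₀ ∷ c₀ ∷ 6F ∷ u₁ ∷ c₁ ∷ 7F ∷ k₀ ∷ k₁ ∷ []) (allFin 8))} →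
          ∀ s t r′ → L ↭ s ∷ t ∷ r′ → E (lookup (S s t) u₀) (lookup (S s t) c₀) s ≡ 1 →
          E (lookup (S s t) u₁) (lookup (S s t) c₁) t ≡ 1 → ⊥
        two u₀ c₀ u₁ c₁ k₀ k₁ {ok} s t r′ pL a b =
          replace {e ∷ []} {x ∷ y ∷ z ∷ s ∷ t ∷ []} {_ ∷ _ ∷ []} {_ ∷ _ ∷ []} pM (prep x (prep y (prep z pL)))
            (permBy (S s t) (u₀ ∷ c₀ ∷ 6F ∷ u₁ ∷ c₁ ∷ 7F ∷ k₀ ∷ k₁ ∷ []) {ok}) (a ∷ b ∷ []) refl

        a₀ a₁ a₂ : V
        a₀ = proj₁ e
        a₁ = proj₁ (proj₂ e)
        a₂ = proj₂ (proj₂ e)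

        -- The nine pairs of one of `x`, `y`, `z` with a vertex of `e` form three diagonals. Two
        -- pairs of one diagonal are disjoint, so if they made edges with two different vertices of
        -- `L`, these edges would replace `e`. Hence each diagonal gives at most |L| + 2.
        outer : ∑ L (λ s → ∑ (vx e) (λ p → F₃ x y z p s)) ≤ 3 * length L + 6
        outer = begin
          ∑ L (λ s → ∑ (vx e) (λ p → F₃ x y z p s)) ≤⟨ ∑-mono L (λ {s} _ → regroup s) ⟩
          ∑ L (λ s → (f₀ s + f₁ s) + f₂ s)           ≡⟨ ∑-+ (λ s → f₀ s + f₁ s) f₂ L ⟩
          ∑ L (λ s → f₀ s + f₁ s) + ∑ L f₂           ≡⟨ cong (_+ ∑ L f₂) (∑-+ f₀ f₁ L) ⟩
          ∑ L f₀ + ∑ L f₁ + ∑ L f₂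
            ≤⟨ polyle (∑ L f₀ ∷ ∑ L f₁ ∷ ∑ L f₂ ∷ length L ∷ [])
                 ((var 0 , var 3 :+ con 2 , con 1) ∷ (var 1 , var 3 :+ con 2 , con 1) ∷ (var 2 , var 3 :+ con 2 , con 1) ∷ [])
                 (var 0 :+ var 1 :+ var 2) (con 3 :* var 3 :+ con 6) (l₀ , l₁ , l₂ , tt) ⟩
          3 * length L + 6 ∎
          where
          open ≤-Reasoning
          f₀ f₁ f₂ : V → ℕ
          f₀ s = E x a₀ s + E y a₁ s + E z a₂ s
          f₁ s = E x a₁ s + E y a₂ s + E z a₀ s
          f₂ s = E x a₂ s + E y a₀ s + E z a₁ s
          regroup : ∀ s → ∑ (vx e) (λ p → F₃ x y z p s) ≤ f₀ s + f₁ s + f₂ s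
          regroup s = polyle (E x a₀ s ∷ E y a₀ s ∷ E z a₀ s ∷ E x a₁ s ∷ E y a₁ s ∷ E z a₁ s ∷ E x a₂ s ∷ E y a₂ s ∷ E z a₂ s ∷ [])
            []
            (var 0 :+ var 1 :+ var 2 :+ (var 3 :+ var 4 :+ var 5 :+ (var 6 :+ var 7 :+ var 8 :+ con 0)))
            (var 0 :+ var 4 :+ var 8 :+ (var 3 :+ var 7 :+ var 2) :+ (var 6 :+ var 1 :+ var 5)) tt
          l₀ : ∑ L f₀ ≤ length L + 2
          l₀ = ∑-three-≤ (E x a₀) (E y a₁) (E z a₂) (E≤1 _ _) (E≤1 _ _) (E≤1 _ _) L
            (two 3F 0F 4F 1F 5F 2F) (two 3F 0F 5F 2F 4F 1F) (two 4F 1F 5F 2F 3F 0F)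
          l₁ : ∑ L f₁ ≤ length L + 2
          l₁ = ∑-three-≤ (E x a₁) (E y a₂) (E z a₀) (E≤1 _ _) (E≤1 _ _) (E≤1 _ _) L
            (two 3F 1F 4F 2F 5F 0F) (two 3F 1F 5F 0F 4F 2F) (two 4F 2F 5F 0F 3F 1F)
          l₂ : ∑ L f₂ ≤ length L + 2
          l₂ = ∑-three-≤ (E x a₂) (E y a₀) (E z a₁) (E≤1 _ _) (E≤1 _ _) (E≤1 _ _) L
            (two 3F 2F 4F 0F 5F 1F) (two 3F 2F 5F 1F 4F 0F) (two 4F 0F 5F 1F 3F 2F)

    -- With K = |M|, the pairs inside `M` give about 18 K² and those between `M` and `L` about 6 K
    -- |L|, together 6 K (3 K + |L|) ≤ 6 K n. The diagonal of `M`, the constant in `outer` and the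
    -- locked vertices go into the error.
    three-degrees : d x + d y + d z ≤ 6 * (length M * n) + (6 * length X + 57) * n
    three-degrees = begin
      d x + d y + d z      ≡⟨ ∑∑-F₃ x y z ⟨
      ∑∑ vs (F₃ x y z)     ≤⟨ ∑∑-split (F₃ x y z) (F₃-sym x y z) 3 (F₃≤3 x y z) M L R vs↭ ⟩
      ∑∑ M (cross (F₃ x y z)) + 2 * ∑ M (λ e → ∑ L (λ s → ∑ (vx e) (λ p → F₃ x y z p s)))
        + ∑∑ L (F₃ x y z) + 2 * (length R * n * 3)
        ≤⟨ polyle (∑∑ M (cross (F₃ x y z)) ∷ ∑ M (λ e → ∑ L (λ s → ∑ (vx e) (λ p → F₃ x y z p s))) ∷
             ∑∑ L (F₃ x y z) ∷ length M ∷ length L ∷ length X ∷ n ∷ [])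
             ((var 0 , var 3 :* var 3 :* con 18 :+ var 3 :* con 27 , con 1) ∷
              (var 1 , var 3 :* (con 3 :* var 4 :+ con 6) , con 2) ∷
              (var 2 , var 4 :* var 4 :* con 0 :+ var 4 :* con 0 , con 1) ∷
              (var 3 :* con 3 :+ (var 5 :+ (con 3 :+ var 4)) , var 6 , con 6 :* var 3 :+ con 13) ∷ [])
             (var 0 :+ con 2 :* var 1 :+ var 2 :+ con 2 :* ((con 3 :+ var 5) :* var 6 :* con 3))
             (con 6 :* (var 3 :* var 6) :+ (con 6 :* var 5 :+ con 57) :* var 6)
             (∑∑-≤ (cross (F₃ x y z)) 18 27 M (λ e e′ r p → cross-≤18 x y z e e′ (no₃ e e′ r p))
                (λ e → cross-F₃≤27 x y z e e) ,
              ∑-≤-const M _ (λ {e} i → let r , p = ∈⇒↭ i in outer e r p) ,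
              ∑∑-≤ (F₃ x y z) 0 0 L inner (λ p → ≤-reflexive (cong₂ _+_ (cong₂ _+_ (E-irr x p) (E-irr y p)) (E-irr z p))) ,
              ≤-reflexive (length-Part {M} {X} part) , tt) ⟩
      6 * (length M * n) + (6 * length X + 57) * n ∎
      where
      open ≤-Reasoning
      R = x ∷ y ∷ z ∷ X
      vs↭ : vs ↭ (flat M ++ L) ++ R
      vs↭ = ↭-trans (↭-sym part) (↭-trans (++⁺ˡ (flat M) (↭-trans (++-comm X (x ∷ y ∷ z ∷ L))
        (++⁺ˡ (x ∷ y ∷ z ∷ []) (++-comm L X)))) (↭-trans (++⁺ˡ (flat M) (++-comm (x ∷ y ∷ z ∷ X) L)) (↭-reflexive (sym (++-assoc (flat M) L R)))))

-- An uncovered low vertex and an edge without low vertices.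

module LowVertex (G : Hypergraph) (lo : Hypergraph.V G → ℕ) (lo≤1 : ∀ v → lo v ≤ 1)
  (lolo : ∀ u v w → lo v ≡ 1 → lo w ≡ 1 → Hypergraph.E G u v w ≡ 0) where

  open Hypergraph G

  open Exchange G
  open Three G

  -- The low vertex of an edge, if there is one, is written last, so that `φ` tells whether the edge
  -- has one.
  Normal : Tri V → Set
  Normal (a , b , c) = lo a ≡ 0 × lo b ≡ 0

  φ : Tri V → ℕ
  φ (a , b , c) = lo c

  ∑-φ : ∀ M → All Normal M → ∑ (flat M) lo ≡ ∑ M φ
  ∑-φ [] _ = refl
  ∑-φ ((a , b , c) ∷ M) ((p , q) ∷ h) rewrite p | q | ∑-φ M h = refl

  Optimal : List (Tri V) → List V → List V → Set
  Optimal M X L = ∀ M′ L′ → All Edge M′ → Part M′ X L′ → length M′ ≡ length M → ∑ L′ lo < ∑ L lo → ⊥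

  module _ (X : List V) (M : List (Tri V)) (w : V) (Y H : List V) (x y z : V)
    (M-edge : All Edge M) (M-normal : All Normal M) (lo-w : lo w ≡ 1) (lo-Y : All (λ v → lo v ≡ 1) Y)
    (lo-x : lo x ≡ 0) (lo-y : lo y ≡ 0) (lo-z : lo z ≡ 0)
    (part : Part ((x , y , z) ∷ M) X (w ∷ Y ++ H)) (opt : Optimal ((x , y , z) ∷ M) X (w ∷ Y ++ H)) where

    private
      F : V → V → ℕ
      F = F₃ w x y

      replace : ∀ {old out new back r L′} → M ↭ old ++ r → w ∷ Y ++ H ↭ out ++ L′ →
        flat ((x , y , z) ∷ old) ++ out ↭ flat new ++ back → All Edge new → length new ≡ suc (length old) →
        ∑ back lo < ∑ out lo → ⊥
      replace {old} {out} {new} {back} {r} {L′} pM pL e ne len lt = opt (new ++ r) (back ++ L′)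
        (All.++⁺ ne (All.++⁻ʳ old (All-resp-↭ pM M-edge)))
        (exchange {X = X} {out = out} {back = back} {old = (x , y , z) ∷ old} {new} part (prep _ pM) pL e)
        (trans (length-++ new) (trans (cong (_+ length r) len)
          (cong suc (trans (sym (length-++ old)) (sym (↭-length pM))))))
        (subst₂ _<_ (sym (∑-++ lo back L′)) (sym (trans (∑-↭ lo pL) (∑-++ lo out L′))) (+-monoˡ-< (∑ L′ lo) lt))

      -- Giving up {x , y , z} makes `x` and `y` available. Three edges on the nine vertices then
      -- restore the size of the matching, with the high vertex `z` uncovered instead of the low
      -- vertex `w`.
      no₃ : ∀ e e′ r → M ↭ e ∷ e′ ∷ r → No₃ (w ∷ x ∷ y ∷ []) e e′
      no₃ e e′ r pM t u v te ue ve p = replace {e ∷ e′ ∷ []} {w ∷ []} {t ∷ u ∷ v ∷ []} {z ∷ []} pM ↭-refl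
        (↭-trans (permBy ((x ∷ y ∷ z ∷ vx e) ++ vx e′ ++ w ∷ [])
           (3F ∷ 4F ∷ 5F ∷ 6F ∷ 7F ∷ 8F ∷ 9F ∷ 0F ∷ 1F ∷ 2F ∷ [])) (++⁺ʳ (z ∷ []) p))
        (te ∷ ue ∷ ve ∷ []) refl (subst₂ _<_ (sym (trans (+-identityʳ _) lo-z)) (sym (trans (+-identityʳ _) lo-w)) (s≤s z≤n))

      w-lo : ∀ p q → lo q ≡ 1 → E w p q ≡ 0
      w-lo p q l = trans (E₁₂ w p q) (lolo p w q lo-w l)

      -- If both edges end in a low vertex, the link of `w` avoids that row and that column, and no
      -- link contains the pair of the two low vertices. These are the zeros that `cross-≤16` asks
      -- for.
      pair : ∀ e e′ r → M ↭ e ∷ e′ ∷ r → cross F e e′ + φ e * (φ e′ * 2) ≤ 18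
      pair e@(a₀ , a₁ , a₂) e′@(b₀ , b₁ , b₂) r pM with lo a₂ in l | lo≤1 a₂ | lo b₂ in l′ | lo≤1 b₂
      ... | 0 | _ | _ | _ = ≤-trans (≤-reflexive (+-identityʳ _)) (cross-≤18 w x y e e′ (no₃ e e′ r pM))
      ... | 1 | _ | 0 | _ = ≤-trans (≤-reflexive (+-identityʳ _)) (cross-≤18 w x y e e′ (no₃ e e′ r pM))
      ... | 1 | _ | 1 | _ = cross-≤16 w x y e e′ (no₃ e e′ r pM)
        (λ q → trans (E₂₃ w a₂ q) (w-lo q a₂ l)) (λ p → w-lo p b₂ l′) (lolo x a₂ b₂ l l′) (lolo y a₂ b₂ l l′)
      ... | 1 | _ | suc (suc _) | s≤s ()
      ... | suc (suc _) | s≤s () | _ | _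

      diag : ∀ e → cross F e e + φ e * (φ e * 2) ≤ 29
      diag e@(a , b , c) = +-mono-≤ (cross-F₃≤27 w x y e e) (*-mono-≤ (lo≤1 c) (*-monoˡ-≤ 2 (lo≤1 c)))

      module _ (e : Tri V) (r : List (Tri V)) (pM : M ↭ e ∷ r) where
        S : V → V → List V
        S s t = x ∷ y ∷ z ∷ vx e ++ w ∷ s ∷ t ∷ []

        -- The two new edges replace {x , y , z} and `e`. They cover the low vertices `s` and `t`,
        -- and of the vertices set free only the one at position `k` can be low, so the number of
        -- uncovered low vertices drops.
        two : ∀ (c₀ c₁ k : Fin 9) → {T (isPerm (0F ∷ c₀ ∷ 7F ∷ 1F ∷ c₁ ∷ 8F ∷ 6F ∷ 2F ∷ k ∷ []) (allFin 9))} →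
          ∀ s t r′ → Y ↭ s ∷ t ∷ r′ → E x (lookup (S s t) c₀) s ≡ 1 → E y (lookup (S s t) c₁) t ≡ 1 → ⊥
        two c₀ c₁ k {ok} s t r′ pY a b =
          replace {e ∷ []} {w ∷ s ∷ t ∷ []} {_ ∷ _ ∷ []} {w ∷ z ∷ lookup (S s t) k ∷ []} {L′ = r′ ++ H} pM
            (prep w (++⁺ʳ H pY))
            (permBy (S s t) (0F ∷ c₀ ∷ 7F ∷ 1F ∷ c₁ ∷ 8F ∷ 6F ∷ 2F ∷ k ∷ []) {ok}) (a ∷ b ∷ []) refl
            (drops (All-resp-↭ pY lo-Y))
          where
          drops : All (λ v → lo v ≡ 1) (s ∷ t ∷ r′) → lo w + (lo z + (lo (lookup (S s t) k) + 0)) < lo w + (lo s + (lo t + 0))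
          drops (ls ∷ lt ∷ _) rewrite ls | lt | lo-z | +-identityʳ (lo (lookup (S s t) k)) =
            +-monoʳ-< (lo w) (s≤s (lo≤1 _))

        a₀ a₁ a₂ : V
        a₀ = proj₁ e
        a₁ = proj₁ (proj₂ e)
        a₂ = proj₂ (proj₂ e)

        -- No edge contains both `w` and `s`, as both are low. The links of `x` and `y` remain, in
        -- three diagonals of two pairs each.
        outer : ∑ Y (λ s → ∑ (vx e) (λ p → F p s)) ≤ 3 * length Y + 3
        outer = begin
          ∑ Y (λ s → ∑ (vx e) (λ p → F p s)) ≤⟨ ∑-mono Y (λ {s} i → regroup s (All.lookup lo-Y i)) ⟩
          ∑ Y (λ s → (f₀ s + f₁ s) + f₂ s)   ≡⟨ ∑-+ (λ s → f₀ s + f₁ s) f₂ Y ⟩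
          ∑ Y (λ s → f₀ s + f₁ s) + ∑ Y f₂   ≡⟨ cong (_+ ∑ Y f₂) (∑-+ f₀ f₁ Y) ⟩
          ∑ Y f₀ + ∑ Y f₁ + ∑ Y f₂
            ≤⟨ polyle (∑ Y f₀ ∷ ∑ Y f₁ ∷ ∑ Y f₂ ∷ length Y ∷ [])
                 ((var 0 , var 3 :+ con 1 , con 1) ∷ (var 1 , var 3 :+ con 1 , con 1) ∷ (var 2 , var 3 :+ con 1 , con 1) ∷ [])
                 (var 0 :+ var 1 :+ var 2) (con 3 :* var 3 :+ con 3)
                 (∑-two-≤ (E x a₀) (E y a₁) (E≤1 _ _) (E≤1 _ _) Y (two 3F 4F 5F) ,
                  ∑-two-≤ (E x a₁) (E y a₂) (E≤1 _ _) (E≤1 _ _) Y (two 4F 5F 3F) ,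
                  ∑-two-≤ (E x a₂) (E y a₀) (E≤1 _ _) (E≤1 _ _) Y (two 5F 3F 4F) , tt) ⟩
          3 * length Y + 3 ∎
          where
          open ≤-Reasoning
          f₀ f₁ f₂ : V → ℕ
          f₀ s = E x a₀ s + E y a₁ s
          f₁ s = E x a₁ s + E y a₂ s
          f₂ s = E x a₂ s + E y a₀ s
          regroup : ∀ s → lo s ≡ 1 → ∑ (vx e) (λ p → F p s) ≤ f₀ s + f₁ s + f₂ s
          regroup s l rewrite w-lo a₀ s l | w-lo a₁ s l | w-lo a₂ s l =
            polyle (E x a₀ s ∷ E y a₀ s ∷ E x a₁ s ∷ E y a₁ s ∷ E x a₂ s ∷ E y a₂ s ∷ [])
            []
            (var 0 :+ var 1 :+ (var 2 :+ var 3 :+ (var 4 :+ var 5 :+ con 0)))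
            (var 0 :+ var 3 :+ (var 2 :+ var 5) :+ (var 4 :+ var 1)) tt

      inner : ∑∑ Y F ≤ 0
      inner = ≤-trans (∑-≤-const Y 0 (λ i → ≤-trans (∑-≤-const Y 0 (λ j → ≤-reflexive
        (cong₂ _+_ (cong₂ _+_ (lolo w _ _ (All.lookup lo-Y i) (All.lookup lo-Y j)) (lolo x _ _ (All.lookup lo-Y i) (All.lookup lo-Y j)))
          (lolo y _ _ (All.lookup lo-Y i) (All.lookup lo-Y j))))) (≤-reflexive (*-zeroʳ (length Y)))))
        (≤-reflexive (*-zeroʳ (length Y)))

      pairs : ∑∑ M (cross F) + ∑ M φ * (∑ M φ * 2) ≤ length M * length M * 18 + length M * 29
      pairs = ≤-trans (≤-reflexive (sym (begin
        ∑∑ M (λ e e′ → cross F e e′ + φ e * (φ e′ * 2))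
          ≡⟨ ∑-cong M (λ e → trans (∑-+ (cross F e) (λ e′ → φ e * (φ e′ * 2)) M)
               (cong (∑ M (cross F e) +_) (trans (∑-*ˡ (λ e′ → φ e′ * 2) (φ e) M) (cong (φ e *_) (∑-*ʳ φ 2 M))))) ⟩
        ∑ M (λ e → ∑ M (cross F e) + φ e * (∑ M φ * 2))
          ≡⟨ ∑-+ (λ e → ∑ M (cross F e)) (λ e → φ e * (∑ M φ * 2)) M ⟩
        ∑∑ M (cross F) + ∑ M (λ e → φ e * (∑ M φ * 2))
          ≡⟨ cong (∑∑ M (cross F) +_) (∑-*ʳ φ (∑ M φ * 2) M) ⟩
        ∑∑ M (cross F) + ∑ M φ * (∑ M φ * 2) ∎)))
        (∑∑-≤ (λ e e′ → cross F e e′ + φ e * (φ e′ * 2)) 18 29 M pair diag)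
        where open ≡-Reasoning

    -- The main terms are bounded as in `three-degrees`, by 6 |M| n. The pairs of edges with a low
    -- vertex now save 2 each, and this saving is quadratic in the number `∑ M φ` of such edges.
    low-degrees : d w + d x + d y + ∑ M φ * (∑ M φ * 2) ≤ 6 * (length M * n) + (6 * (length X + length H) + 59) * n
    low-degrees = begin
      d w + d x + d y + k²   ≡⟨ cong (_+ k²) (∑∑-F₃ w x y) ⟨
      ∑∑ vs F + k²           ≤⟨ +-monoˡ-≤ k² (∑∑-split F (F₃-sym w x y) 3 (F₃≤3 w x y) M Y R vs↭) ⟩
      ∑∑ M (cross F) + 2 * ∑ M (λ e → ∑ Y (λ s → ∑ (vx e) (λ p → F p s))) + ∑∑ Y F + 2 * (length R * n * 3) + k²
        ≤⟨ polyle (∑∑ M (cross F) ∷ ∑ M (λ e → ∑ Y (λ s → ∑ (vx e) (λ p → F p s))) ∷ ∑∑ Y F ∷ k² ∷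
             length M ∷ length Y ∷ length X ∷ length H ∷ n ∷ length R ∷ [])
             ((var 0 :+ var 3 , var 4 :* var 4 :* con 18 :+ var 4 :* con 29 , con 1) ∷
              (var 1 , var 4 :* (con 3 :* var 5 :+ con 3) , con 2) ∷
              (var 2 , con 0 , con 1) ∷
              (var 9 , con 4 :+ (var 6 :+ var 7) , con 6 :* var 8) ∷
              ((con 1 :+ var 4) :* con 3 :+ (var 6 :+ (con 1 :+ (var 5 :+ var 7))) , var 8 , con 6 :* var 4 :+ con 35) ∷ [])
             (var 0 :+ con 2 :* var 1 :+ var 2 :+ con 2 :* (var 9 :* var 8 :* con 3) :+ var 3)
             (con 6 :* (var 4 :* var 8) :+ (con 6 :* (var 6 :+ var 7) :+ con 59) :* var 8)
             (pairs ,
              ∑-≤-const M _ (λ {e} i → let r , p = ∈⇒↭ i in outer e r p) ,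
              inner ,
              ≤-reflexive (cong (4 +_) (length-++ X)) ,
              ≤-reflexive (trans (cong (λ l → suc (length M) * 3 + (length X + suc l)) (sym (length-++ Y)))
                (length-Part {(x , y , z) ∷ M} {X} part)) , tt) ⟩
      6 * (length M * n) + (6 * (length X + length H) + 59) * n ∎
      where
      open ≤-Reasoning
      k² = ∑ M φ * (∑ M φ * 2)
      R = w ∷ x ∷ y ∷ z ∷ X ++ H
      vs↭ : vs ↭ (flat M ++ Y) ++ R
      vs↭ = ↭-trans (↭-sym part) (↭-trans (++⁺ˡ (x ∷ y ∷ z ∷ flat M) (shifts X (w ∷ Y)))
        (↭-trans (shifts (x ∷ y ∷ z ∷ []) (flat M))
        (↭-trans (++⁺ˡ (flat M) (↭-trans (shifts (x ∷ y ∷ z ∷ w ∷ []) Y)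
           (++⁺ˡ Y (++⁺ʳ (X ++ H) (permBy (x ∷ y ∷ z ∷ w ∷ []) (3F ∷ 0F ∷ 1F ∷ 2F ∷ []))))))
        (↭-reflexive (sym (++-assoc (flat M) Y R))))))

-- Finite checks on 3 × 3 tables of bits.

module Slices where

  -- A slice of a 3 × 3 table is a row (0–2) or a column (3–5).
  Slice : Set
  Slice = Fin 6

  off : Slice → Fin 3 → Fin 3 → Bool
  off s i j = not ((toℕ s ≡ᵇ toℕ i) ∨ (toℕ s ≡ᵇ 3 + toℕ j))

  every : ∀ k → (Vec Bool k → Bool) → Bool
  every zero f = f []
  every (suc k) f = every k (λ bs → f (true ∷ bs)) ∧ every k (λ bs → f (false ∷ bs))

  every-sound : ∀ k f → T (every k f) → ∀ bs → T (f bs)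
  every-sound zero f t [] = t
  every-sound (suc k) f t (true ∷ bs) = every-sound k _ (proj₁ (Equivalence.to T-∧ t)) bs
  every-sound (suc k) f t (false ∷ bs) =
    every-sound k _ (proj₂ (Equivalence.to (T-∧ {every k (λ bs → f (true ∷ bs))}) t)) bs

  allFin-sound : ∀ {k} (p : Fin k → Bool) → T (all p (allFin k)) → ∀ i → T (p i)
  allFin-sound {k} p t i = All.lookup (All.all⁺ p (allFin k) t) (∈-allFin i)

  bit : Bool → ℕ
  bit false = 0
  bit true = 1

  entry : Vec Bool 9 → Fin 3 → Fin 3 → Bool
  entry (a ∷ b ∷ c ∷ _) 0F j = Vec.lookup (a ∷ b ∷ c ∷ []) j
  entry (_ ∷ _ ∷ _ ∷ a ∷ b ∷ c ∷ _) 1F j = Vec.lookup (a ∷ b ∷ c ∷ []) j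
  entry (_ ∷ _ ∷ _ ∷ _ ∷ _ ∷ _ ∷ row) 2F j = Vec.lookup row j

  balanced : Vec Bool 9 → Bool
  balanced bs = tr 0F 1F 2F ∧ tr 1F 2F 0F ∧ tr 2F 0F 1F ∧ tr 0F 2F 1F ∧ tr 1F 0F 2F ∧ tr 2F 1F 0F
    where
    tr : Fin 3 → Fin 3 → Fin 3 → Bool
    tr a b c = bit (entry bs 0F a) + bit (entry bs 1F b) + bit (entry bs 2F c) ≡ᵇ 2

  fills : Vec Bool 9 → Slice → Bool
  fills bs s = all (λ i → all (λ j → not (off s i j) ∨ entry bs i j) (allFin 3)) (allFin 3)

  -- Verified by evaluation on all 512 tables. The reason: each transversal has exactly one zero, so
  -- any two zeros share a row or a column. Hence all zeros lie in one line, and they fill it, since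
  -- otherwise some transversal would miss them.
  balanced⇒slice : ∀ bs → T (balanced bs) → ∃ λ s → ∀ i j → T (off s i j) → T (entry bs i j)
  balanced⇒slice bs t with Equivalence.to (T-∨ {not (balanced bs)})
    (every-sound 9 (λ bs → not (balanced bs) ∨ any (fills bs) (allFin 6)) tt bs)
  ... | inj₁ u with balanced bs
  ...   | true = ⊥-elim u
  balanced⇒slice bs t | inj₂ u with find (Any.any⁻ (fills bs) (allFin 6) u)
  ... | s , _ , v = s , λ i j o → use i j o
          (allFin-sound (λ j → not (off s i j) ∨ entry bs i j)
            (allFin-sound (λ i → all (λ j → not (off s i j) ∨ entry bs i j) (allFin 3)) v i) j)
    where
    use : ∀ i j → T (off s i j) → T (not (off s i j) ∨ entry bs i j) → T (entry bs i j)
    use i j o v with off s i j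
    ... | true = v

  -- A cell (k , i , j) is the pair of the i-th and j-th vertices of edges 0 and 1 (k = 0), 0 and 2
  -- (k = 1), or 1 and 2 (k = 2). A pairing consists of four cells and the vertex left over.
  Cell Pairing : Set
  Cell = Fin 3 × Fin 3 × Fin 3
  Pairing = Cell × Cell × Cell × Cell × Fin 3 × Fin 3

  fst snd : Fin 3 → Fin 3
  fst 0F = 0F
  fst 1F = 0F
  fst 2F = 1F
  snd 0F = 1F
  snd 1F = 2F
  snd 2F = 2F

  idx : Fin 3 → Fin 3 → Fin 13
  idx 0F 0F = 0F
  idx 0F 1F = 1F
  idx 0F 2F = 2F
  idx 1F 0F = 3F
  idx 1F 1F = 4F
  idx 1F 2F = 5F
  idx 2F 0F = 6F
  idx 2F 1F = 7F
  idx 2F 2F = 8F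

  pattern 10F = Fin.suc 9F
  pattern 11F = Fin.suc 10F
  pattern 12F = Fin.suc 11F

  tripleIdx : Fin 13 → Cell → List (Fin 13)
  tripleIdx x (k , i , j) = x ∷ idx (fst k) i ∷ idx (snd k) j ∷ []

  indices : Pairing → List (Fin 13)
  indices (c , c′ , c″ , c‴ , k , i) =
    tripleIdx 9F c ++ tripleIdx 10F c′ ++ tripleIdx 11F c″ ++ tripleIdx 12F c‴ ++ idx k i ∷ []

  avoids : (Fin 3 → Slice) → Cell → Bool
  avoids s (k , i , j) = off (s k) i j

  avoids₄ : (Fin 3 → Slice) → Pairing → Bool
  avoids₄ s (c , c′ , c″ , c‴ , _) = avoids s c ∧ avoids s c′ ∧ avoids s c″ ∧ avoids s c‴

  -- Whichever slice is empty in each of the three tables, one of these 27 pairings avoids all three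
  -- slices. Evaluation confirms this for the 216 choices in `pairings-suffice`, and that each
  -- pairing uses the 13 vertices once in `pairings-valid`.
  pairings : List Pairing
  pairings =
    ((0F , 1F , 0F) , (1F , 2F , 0F) , (2F , 1F , 1F) , (2F , 2F , 2F) , 0F , 0F) ∷
    ((0F , 1F , 1F) , (1F , 2F , 1F) , (2F , 0F , 0F) , (2F , 2F , 2F) , 0F , 0F) ∷
    ((0F , 1F , 2F) , (1F , 2F , 2F) , (2F , 0F , 0F) , (2F , 1F , 1F) , 0F , 0F) ∷
    ((1F , 0F , 0F) , (1F , 1F , 1F) , (0F , 2F , 2F) , (2F , 1F , 2F) , 1F , 0F) ∷
    ((0F , 0F , 0F) , (1F , 1F , 2F) , (0F , 2F , 1F) , (2F , 2F , 1F) , 2F , 0F) ∷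
    ((1F , 0F , 0F) , (1F , 1F , 2F) , (0F , 2F , 2F) , (2F , 0F , 1F) , 1F , 1F) ∷
    ((0F , 0F , 2F) , (1F , 2F , 1F) , (2F , 0F , 0F) , (2F , 1F , 2F) , 0F , 1F) ∷
    ((0F , 0F , 1F) , (1F , 2F , 0F) , (2F , 0F , 1F) , (2F , 2F , 2F) , 0F , 1F) ∷
    ((1F , 0F , 1F) , (0F , 1F , 0F) , (2F , 1F , 0F) , (2F , 2F , 2F) , 0F , 2F) ∷
    ((0F , 0F , 0F) , (1F , 2F , 2F) , (2F , 1F , 0F) , (2F , 2F , 1F) , 0F , 1F) ∷
    ((0F , 0F , 1F) , (1F , 1F , 0F) , (2F , 0F , 1F) , (2F , 2F , 2F) , 0F , 2F) ∷
    ((0F , 0F , 2F) , (1F , 1F , 2F) , (2F , 0F , 0F) , (2F , 1F , 1F) , 0F , 2F) ∷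
    ((0F , 0F , 1F) , (1F , 1F , 0F) , (1F , 2F , 2F) , (2F , 2F , 1F) , 1F , 0F) ∷
    ((1F , 0F , 1F) , (0F , 1F , 1F) , (1F , 2F , 2F) , (2F , 2F , 0F) , 1F , 0F) ∷
    ((0F , 0F , 0F) , (1F , 1F , 0F) , (1F , 2F , 1F) , (2F , 2F , 2F) , 1F , 1F) ∷
    ((1F , 0F , 1F) , (0F , 1F , 0F) , (1F , 2F , 2F) , (2F , 2F , 0F) , 1F , 1F) ∷
    ((0F , 0F , 0F) , (1F , 1F , 0F) , (1F , 2F , 1F) , (2F , 1F , 2F) , 1F , 2F) ∷
    ((1F , 0F , 0F) , (0F , 1F , 0F) , (1F , 2F , 2F) , (2F , 1F , 1F) , 1F , 2F) ∷
    ((1F , 0F , 1F) , (1F , 1F , 2F) , (0F , 2F , 0F) , (2F , 1F , 0F) , 1F , 2F) ∷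
    ((0F , 0F , 0F) , (0F , 1F , 2F) , (1F , 2F , 1F) , (2F , 1F , 2F) , 2F , 0F) ∷
    ((1F , 0F , 1F) , (0F , 1F , 1F) , (0F , 2F , 2F) , (2F , 0F , 2F) , 2F , 0F) ∷
    ((0F , 0F , 0F) , (0F , 1F , 1F) , (1F , 2F , 0F) , (2F , 2F , 2F) , 2F , 1F) ∷
    ((0F , 0F , 0F) , (1F , 1F , 0F) , (0F , 2F , 2F) , (2F , 1F , 2F) , 2F , 1F) ∷
    ((1F , 0F , 0F) , (0F , 1F , 1F) , (0F , 2F , 2F) , (2F , 0F , 2F) , 2F , 1F) ∷
    ((0F , 0F , 0F) , (0F , 1F , 1F) , (1F , 2F , 0F) , (2F , 2F , 1F) , 2F , 2F) ∷
    ((0F , 0F , 0F) , (1F , 1F , 0F) , (0F , 2F , 2F) , (2F , 1F , 1F) , 2F , 2F) ∷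
    ((1F , 0F , 0F) , (0F , 1F , 1F) , (0F , 2F , 2F) , (2F , 0F , 1F) , 2F , 2F) ∷
    []

  pick : Slice → Slice → Slice → Fin 3 → Slice
  pick s t u 0F = s
  pick s t u 1F = t
  pick s t u 2F = u

  abstract
    pairings-valid : All (λ p → T (isPerm (indices p) (allFin 13))) pairings
    pairings-valid = All.all⁺ (λ p → isPerm (indices p) (allFin 13)) pairings tt

    pairings-suffice : ∀ s t u → T (any (avoids₄ (pick s t u)) pairings)
    pairings-suffice s t u = allFin-sound (λ u → any (avoids₄ (pick s t u)) pairings)
      (allFin-sound (λ t → all (λ u → any (avoids₄ (pick s t u)) pairings) (allFin 6))
        (allFin-sound (λ s → all (λ t → all (λ u → any (avoids₄ (pick s t u)) pairings) (allFin 6)) (allFin 6)) tt s) t) u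

  slices⇒pairing : ∀ s t u → ∃ λ p → T (isPerm (indices p) (allFin 13)) × T (avoids₄ (pick s t u) p)
  slices⇒pairing s t u = let p , i , v = find (Any.any⁻ (avoids₄ (pick s t u)) pairings (pairings-suffice s t u)) in
    p , All.lookup pairings-valid i , v

open Slices

-- Four links between two edges, and the case of equality.

module Constant (P Q R : Fin 4 → ℕ)
  (T≤2 : ∀ a b c d → a ∷ b ∷ c ∷ d ∷ [] ↭ allFin 4 → P a + Q b + R c ≤ 2) where

  total : Fin 4 → Fin 4 → Fin 4 → Fin 4 → ℕ
  total a b c d = P a + P b + P c + P d + (Q a + Q b + Q c + Q d) + (R a + R b + R c + R d)

  private
    vars : Fin 4 → Fin 4 → Fin 4 → Fin 4 → List ℕ
    vars a b c d = P a ∷ P b ∷ P c ∷ P d ∷ Q a ∷ Q b ∷ Q c ∷ Q d ∷ R a ∷ R b ∷ R c ∷ R d ∷ []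

    four : ℕ → Ex
    four i = var i :+ var (1 + i) :+ var (2 + i) :+ var (3 + i)

    totalEx : Ex
    totalEx = four 0 :+ four 4 :+ four 8

    tr : ℕ → ℕ → ℕ → Ex × Ex × Ex
    tr i j k = var i :+ var (4 + j) :+ var (8 + k) , con 2 , con 1

    abcd : 0F ∷ 1F ∷ 2F ∷ 3F ∷ [] ↭ allFin 4
    abcd = ↭-refl

    rot : ∀ {a b c d : Fin 4} → a ∷ b ∷ c ∷ d ∷ [] ↭ allFin 4 → b ∷ c ∷ d ∷ a ∷ [] ↭ allFin 4
    rot {a} {b} {c} {d} = ↭-trans (↭-sym (permBy (a ∷ b ∷ c ∷ d ∷ []) (1F ∷ 2F ∷ 3F ∷ 0F ∷ [])))

    -- Four of the bounds `T≤2` together contain every value of `P` and of `Q` once, but `R c` twice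
    -- and `R d` not at all. Their sum is at most 8, so a total of at least 8 forces `R c ≤ R d`.
    step : ∀ a b c d → a ∷ b ∷ c ∷ d ∷ [] ↭ allFin 4 → 8 ≤ total a b c d → R c ≤ R d
    step a b c d p t = polyle (vars a b c d)
      ((con 8 , totalEx , con 1) ∷ tr 1 2 0 ∷ tr 2 3 1 ∷ tr 3 0 2 ∷ tr 0 1 2 ∷ []) (var 10) (var 11)
      (t , T≤2 b c a d (↭-trans (permBy (b ∷ c ∷ a ∷ d ∷ []) (2F ∷ 0F ∷ 1F ∷ 3F ∷ [])) p) ,
       T≤2 c d b a (↭-trans (permBy (c ∷ d ∷ b ∷ a ∷ []) (3F ∷ 2F ∷ 0F ∷ 1F ∷ [])) p) ,
       T≤2 d a c b (↭-trans (permBy (d ∷ a ∷ c ∷ b ∷ []) (1F ∷ 3F ∷ 2F ∷ 0F ∷ [])) p) ,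
       T≤2 a b c d p , tt)

    rotate : ∀ a b c d → 8 ≤ total a b c d → 8 ≤ total b c d a
    rotate a b c d t = polyle (vars a b c d) ((con 8 , totalEx , con 1) ∷ []) (con 8)
      (var 1 :+ var 2 :+ var 3 :+ var 0 :+ (var 5 :+ var 6 :+ var 7 :+ var 4) :+ (var 9 :+ var 10 :+ var 11 :+ var 8)) (t , tt)

  -- Rotation of the four indices turns `step` into a cycle of inequalities R 0 ≤ R 1 ≤ R 2 ≤ R 3 ≤
  -- R 0.
  constant : 8 ≤ total 0F 1F 2F 3F → ∀ x → R x ≡ R 0F
  constant t = λ
    { 0F → refl
    ; 1F → ≤-antisym (≤-trans s₁₂ (≤-trans s₂₃ s₃₀)) s₀₁
    ; 2F → ≤-antisym (≤-trans s₂₃ s₃₀) (≤-trans s₀₁ s₁₂)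
    ; 3F → ≤-antisym s₃₀ (≤-trans s₀₁ (≤-trans s₁₂ s₂₃)) }
    where
    t₁ = rotate 0F 1F 2F 3F t
    t₂ = rotate 1F 2F 3F 0F t₁
    s₂₃ = step 0F 1F 2F 3F abcd t
    s₃₀ = step 1F 2F 3F 0F (rot abcd) t₁
    s₀₁ = step 2F 3F 0F 1F (rot (rot abcd)) t₂
    s₁₂ = step 3F 0F 1F 2F (rot (rot (rot abcd))) (rotate 2F 3F 0F 1F t₂)

  total≤8 : total 0F 1F 2F 3F ≤ 8
  total≤8 = polyle (vars 0F 1F 2F 3F) (tr 0 1 2 ∷ tr 1 2 3 ∷ tr 2 3 0 ∷ tr 3 0 1 ∷ []) totalEx (con 8)
    (T≤2 0F 1F 2F 3F abcd , T≤2 1F 2F 3F 0F (rot abcd) , T≤2 2F 3F 0F 1F (rot (rot abcd)) ,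
     T≤2 3F 0F 1F 2F (rot (rot (rot abcd))) , tt)

grandTotal : (P Q R : Fin 4 → ℕ) → ℕ
grandTotal P Q R = four P + four Q + four R
  where
  four : (Fin 4 → ℕ) → ℕ
  four P = P 0F + P 1F + P 2F + P 3F

-- `constant` concerns the third function only; cyclic changes of roles cover the other two. Once
-- all are constant, the total is four times P 0 + Q 0 + R 0, which is therefore at least 2.
transversal : ∀ (P Q R : Fin 4 → ℕ) → (∀ a b c d → a ∷ b ∷ c ∷ d ∷ [] ↭ allFin 4 → P a + Q b + R c ≤ 2) →
  8 ≤ grandTotal P Q R → (∀ x → P x ≡ P 0F) × (∀ x → Q x ≡ Q 0F) × (∀ x → R x ≡ R 0F) × P 0F + Q 0F + R 0F ≡ 2
transversal P Q R T≤2 t = p , q , r , ≤-antisym (subst (_≤ 2) eq (T≤2 0F 1F 2F 3F ↭-refl)) (*-cancelˡ-≤ 4 low)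
  where
  eq : P 0F + Q 1F + R 2F ≡ P 0F + Q 0F + R 0F
  vars : List ℕ
  vars = P 0F ∷ P 1F ∷ P 2F ∷ P 3F ∷ Q 0F ∷ Q 1F ∷ Q 2F ∷ Q 3F ∷ R 0F ∷ R 1F ∷ R 2F ∷ R 3F ∷ []
  four : ℕ → Ex
  four i = var i :+ var (1 + i) :+ var (2 + i) :+ var (3 + i)
  r = Constant.constant P Q R T≤2 t
  p = Constant.constant Q R P
    (λ a b c d σ → subst (_≤ 2) (trans (+-assoc (P c) (Q a) (R b)) (+-comm (P c) _))
      (T≤2 c a b d (↭-trans (permBy (c ∷ a ∷ b ∷ d ∷ []) (1F ∷ 2F ∷ 0F ∷ 3F ∷ [])) σ)))
    (polyle vars ((con 8 , four 0 :+ four 4 :+ four 8 , con 1) ∷ []) (con 8) (four 4 :+ four 8 :+ four 0) (t , tt))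
  q = Constant.constant R P Q
    (λ a b c d σ → subst (_≤ 2) (trans (+-assoc (P b) (Q c) (R a)) (trans (cong (P b +_) (+-comm (Q c) (R a)))
      (trans (sym (+-assoc (P b) (R a) (Q c))) (cong (_+ Q c) (+-comm (P b) (R a))))))
      (T≤2 b c a d (↭-trans (permBy (b ∷ c ∷ a ∷ d ∷ []) (2F ∷ 0F ∷ 1F ∷ 3F ∷ [])) σ)))
    (polyle vars ((con 8 , four 0 :+ four 4 :+ four 8 , con 1) ∷ []) (con 8) (four 8 :+ four 0 :+ four 4) (t , tt))
  eq = cong₂ _+_ (cong (P 0F +_) (q 1F)) (r 2F)
  low : 8 ≤ 4 * (P 0F + Q 0F + R 0F)
  low = polyle vars ((con 8 , four 0 :+ four 4 :+ four 8 , con 1) ∷ h 1 0 ∷ h 2 0 ∷ h 3 0 ∷ h 5 4 ∷ h 6 4 ∷ h 7 4 ∷ h 9 8 ∷ h 10 8 ∷ h 11 8 ∷ [])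
    (con 8) (con 4 :* (var 0 :+ var 4 :+ var 8))
    (t , e (p 1F) , e (p 2F) , e (p 3F) , e (q 1F) , e (q 2F) , e (q 3F) , e (r 1F) , e (r 2F) , e (r 3F) , tt)
    where
    h : ℕ → ℕ → Ex × Ex × Ex
    h i j = var i , var j , con 1
    e : ∀ {a b} → a ≡ b → a ≤ b
    e = ≤-reflexive

bit-of : ℕ → Bool
bit-of zero = false
bit-of (suc _) = true

bit-bit-of : ∀ {a} → a ≤ 1 → bit (bit-of a) ≡ a
bit-bit-of z≤n = refl
bit-bit-of (s≤s z≤n) = refl

bit-of-1 : ∀ {a} → a ≤ 1 → T (bit-of a) → a ≡ 1
bit-of-1 (s≤s z≤n) _ = refl

module Tables (link : Fin 3 → Fin 3 → Fin 4 → ℕ) (link≤1 : ∀ i j a → link i j a ≤ 1)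
  (T≤2 : ∀ i j k → i ∷ j ∷ k ∷ [] ↭ allFin 3 → ∀ a b c d → a ∷ b ∷ c ∷ d ∷ [] ↭ allFin 4 →
    link 0F i a + link 1F j b + link 2F k c ≤ 2) where

  private
    four : (Fin 4 → ℕ) → ℕ
    four f = f 0F + f 1F + f 2F + f 3F

    three : (Fin 3 → ℕ) → ℕ
    three f = f 0F + (f 1F + (f 2F + 0))

  sum : ℕ
  sum = three (λ i → three (λ j → four (link i j)))

  private
    tr : Fin 3 → Fin 3 → Fin 3 → ℕ
    tr i j k = grandTotal (link 0F i) (link 1F j) (link 2F k)

    module _ (i j k : Fin 3) (p : i ∷ j ∷ k ∷ [] ↭ allFin 3) where
      tr≤8 : tr i j k ≤ 8
      tr≤8 = Constant.total≤8 (link 0F i) (link 1F j) (link 2F k) (T≤2 i j k p)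

      tr-values : 8 ≤ tr i j k → (∀ a → link 0F i a ≡ link 0F i 0F) × (∀ a → link 1F j a ≡ link 1F j 0F) ×
        (∀ a → link 2F k a ≡ link 2F k 0F) × T (bit (bit-of (link 0F i 0F)) + bit (bit-of (link 1F j 0F)) + bit (bit-of (link 2F k 0F)) ≡ᵇ 2)
      tr-values h = let p , q , r , s = transversal (link 0F i) (link 1F j) (link 2F k) (T≤2 i j k p) h in
        p , q , r , ≡⇒≡ᵇ _ 2 (trans (cong₂ _+_ (cong₂ _+_ (bit-bit-of (link≤1 0F i 0F)) (bit-bit-of (link≤1 1F j 0F))) (bit-bit-of (link≤1 2F k 0F))) s)

    σ : ∀ (is : List (Fin 3)) {_ : T (isPerm is (allFin 3))} → is ↭ allFin 3
    σ is {t} = isPerm-↭ is (allFin 3) t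

    cells : Fin 3 → Fin 3 → ℕ
    cells i j = four (link i j)

    vars : List ℕ
    vars = cells 0F 0F ∷ cells 0F 1F ∷ cells 0F 2F ∷ cells 1F 0F ∷ cells 1F 1F ∷ cells 1F 2F ∷
      cells 2F 0F ∷ cells 2F 1F ∷ cells 2F 2F ∷ []

    trEx : ℕ → ℕ → ℕ → Ex
    trEx i j k = var i :+ var (3 + j) :+ var (6 + k)

    S₃ : (ℕ → Ex) → Ex
    S₃ f = f 0 :+ (f 1 :+ (f 2 :+ con 0))

    sumEx : Ex
    sumEx = S₃ (λ i → S₃ (λ j → var (i * 3 + j)))

    b₀ : tr 0F 1F 2F ≤ 8
    b₀ = tr≤8 0F 1F 2F (σ (0F ∷ 1F ∷ 2F ∷ []))
    b₁ : tr 1F 2F 0F ≤ 8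
    b₁ = tr≤8 1F 2F 0F (σ (1F ∷ 2F ∷ 0F ∷ []))
    b₂ : tr 2F 0F 1F ≤ 8
    b₂ = tr≤8 2F 0F 1F (σ (2F ∷ 0F ∷ 1F ∷ []))
    b₃ : tr 0F 2F 1F ≤ 8
    b₃ = tr≤8 0F 2F 1F (σ (0F ∷ 2F ∷ 1F ∷ []))
    b₄ : tr 1F 0F 2F ≤ 8
    b₄ = tr≤8 1F 0F 2F (σ (1F ∷ 0F ∷ 2F ∷ []))
    b₅ : tr 2F 1F 0F ≤ 8
    b₅ = tr≤8 2F 1F 0F (σ (2F ∷ 1F ∷ 0F ∷ []))

  sum-≤24 : sum ≤ 24
  sum-≤24 = polyle vars ((trEx 0 1 2 , con 8 , con 1) ∷ (trEx 1 2 0 , con 8 , con 1) ∷ (trEx 2 0 1 , con 8 , con 1) ∷ [])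
    sumEx (con 24) (b₀ , b₁ , b₂ , tt)

  module _ (full : 24 ≤ sum) where
    private
      -- The three even transversals partition the table, and so do the three odd ones. Each has at
      -- most 8, so a total of 24 leaves none below 8.
      v₀ = tr-values 0F 1F 2F (σ (0F ∷ 1F ∷ 2F ∷ [])) (polyle vars
        ((con 24 , sumEx , con 1) ∷ (trEx 1 2 0 , con 8 , con 1) ∷ (trEx 2 0 1 , con 8 , con 1) ∷ []) (con 8) (trEx 0 1 2) (full , b₁ , b₂ , tt))
      v₁ = tr-values 1F 2F 0F (σ (1F ∷ 2F ∷ 0F ∷ [])) (polyle vars
        ((con 24 , sumEx , con 1) ∷ (trEx 0 1 2 , con 8 , con 1) ∷ (trEx 2 0 1 , con 8 , con 1) ∷ []) (con 8) (trEx 1 2 0) (full , b₀ , b₂ , tt))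
      v₂ = tr-values 2F 0F 1F (σ (2F ∷ 0F ∷ 1F ∷ [])) (polyle vars
        ((con 24 , sumEx , con 1) ∷ (trEx 0 1 2 , con 8 , con 1) ∷ (trEx 1 2 0 , con 8 , con 1) ∷ []) (con 8) (trEx 2 0 1) (full , b₀ , b₁ , tt))
      v₃ = tr-values 0F 2F 1F (σ (0F ∷ 2F ∷ 1F ∷ [])) (polyle vars
        ((con 24 , sumEx , con 1) ∷ (trEx 1 0 2 , con 8 , con 1) ∷ (trEx 2 1 0 , con 8 , con 1) ∷ []) (con 8) (trEx 0 2 1) (full , b₄ , b₅ , tt))
      v₄ = tr-values 1F 0F 2F (σ (1F ∷ 0F ∷ 2F ∷ [])) (polyle vars
        ((con 24 , sumEx , con 1) ∷ (trEx 0 2 1 , con 8 , con 1) ∷ (trEx 2 1 0 , con 8 , con 1) ∷ []) (con 8) (trEx 1 0 2) (full , b₃ , b₅ , tt))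
      v₅ = tr-values 2F 1F 0F (σ (2F ∷ 1F ∷ 0F ∷ [])) (polyle vars
        ((con 24 , sumEx , con 1) ∷ (trEx 0 2 1 , con 8 , con 1) ∷ (trEx 1 0 2 , con 8 , con 1) ∷ []) (con 8) (trEx 2 1 0) (full , b₃ , b₄ , tt))

      same : ∀ i j a → link i j a ≡ link i j 0F
      same 0F 0F = proj₁ v₀
      same 0F 1F = proj₁ v₁
      same 0F 2F = proj₁ v₂
      same 1F 0F = proj₁ (proj₂ v₂)
      same 1F 1F = proj₁ (proj₂ v₀)
      same 1F 2F = proj₁ (proj₂ v₁)
      same 2F 0F = proj₁ (proj₂ (proj₂ v₁))
      same 2F 1F = proj₁ (proj₂ (proj₂ v₂))
      same 2F 2F = proj₁ (proj₂ (proj₂ v₀))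

      c : Fin 3 → Fin 3 → Bool
      c i j = bit-of (link i j 0F)

      bs : Vec Bool 9
      bs = c 0F 0F ∷ c 0F 1F ∷ c 0F 2F ∷ c 1F 0F ∷ c 1F 1F ∷ c 1F 2F ∷ c 2F 0F ∷ c 2F 1F ∷ c 2F 2F ∷ []

      _∧ᵀ_ : ∀ {a b} → T a → T b → T (a ∧ b)
      u ∧ᵀ v = Equivalence.from T-∧ (u , v)
      infixr 5 _∧ᵀ_

      last : ∀ {A B C D : Set} → A × B × C × D → D
      last (_ , _ , _ , z) = z

      ent : ∀ i j → T (entry bs i j) → T (c i j)
      ent 0F 0F t = t
      ent 0F 1F t = t
      ent 0F 2F t = t
      ent 1F 0F t = t
      ent 1F 1F t = t
      ent 1F 2F t = t
      ent 2F 0F t = t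
      ent 2F 1F t = t
      ent 2F 2F t = t

    -- Equality makes every cell full or empty in all four tables at once, the empty cells being a row or a column.
    slice : ∃ λ s → ∀ i j → T (off s i j) → ∀ a → link i j a ≡ 1
    slice = let s , f = balanced⇒slice bs (last v₀ ∧ᵀ last v₁ ∧ᵀ last v₂ ∧ᵀ last v₃ ∧ᵀ last v₄ ∧ᵀ last v₅) in
      s , λ i j o a → trans (same i j a) (bit-of-1 (link≤1 i j 0F) (ent i j (f i j o)))

  sum-≤23⊎slice : sum ≤ 23 ⊎ ∃ λ s → ∀ i j → T (off s i j) → ∀ a → link i j a ≡ 1
  sum-≤23⊎slice with sum ≤? 23
  ... | yes p = inj₁ p
  ... | no ¬p = inj₂ (slice (≰⇒> ¬p))

module FourLinks (G : Hypergraph) (x : Fin 4 → Hypergraph.V G) where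

  open Hypergraph G

  open Exchange G

  F₄ : V → V → ℕ
  F₄ p q = E (x 0F) p q + E (x 1F) p q + E (x 2F) p q + E (x 3F) p q

  F₄≤4 : ∀ p q → F₄ p q ≤ 4
  F₄≤4 p q = +-mono-≤ (+-mono-≤ (+-mono-≤ (E≤1 _ p q) (E≤1 _ p q)) (E≤1 _ p q)) (E≤1 _ p q)

  F₄-sym : ∀ p q → F₄ p q ≡ F₄ q p
  F₄-sym p q = cong₂ _+_ (cong₂ _+_ (cong₂ _+_ (E₂₃ _ p q) (E₂₃ _ p q)) (E₂₃ _ p q)) (E₂₃ _ p q)

  cross-F₄≤36 : ∀ e e′ → cross F₄ e e′ ≤ 36
  cross-F₄≤36 e e′ = ∑-≤-const (vx e) 12 (λ {p} _ → ∑-≤-const (vx e′) 4 (λ {q} _ → F₄≤4 p q))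

  module _ (e e′ : Tri V)
    (none : ∀ a b c d → a ∷ b ∷ c ∷ d ∷ [] ↭ allFin 4 → No₃ (x a ∷ x b ∷ x c ∷ []) e e′) where

    private
      at at′ : Fin 3 → V
      at = lookup (vx e)
      at′ = lookup (vx e′)

      link : Fin 3 → Fin 3 → Fin 4 → ℕ
      link i j a = E (x a) (at i) (at′ j)

      T≤2 : ∀ i j k → i ∷ j ∷ k ∷ [] ↭ allFin 3 → ∀ a b c d → a ∷ b ∷ c ∷ d ∷ [] ↭ allFin 4 →
        link 0F i a + link 1F j b + link 2F k c ≤ 2
      T≤2 i j k t a b c d p = bits₃ (E≤1 _ _ _) (E≤1 _ _ _) (E≤1 _ _ _) (λ u v w → none a b c d p _ _ _ u v w
        (↭-trans (permBy (vx e ++ vx e′ ++ x a ∷ x b ∷ x c ∷ []) (6F ∷ 7F ∷ 8F ∷ 0F ∷ 1F ∷ 2F ∷ 3F ∷ 4F ∷ 5F ∷ []))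
        (↭-trans (++⁺ˡ (x a ∷ x b ∷ x c ∷ at 0F ∷ at 1F ∷ at 2F ∷ []) (↭-sym (map⁺ at′ t)))
          (permBy (x a ∷ x b ∷ x c ∷ at 0F ∷ at 1F ∷ at 2F ∷ at′ i ∷ at′ j ∷ at′ k ∷ [])
            (0F ∷ 3F ∷ 6F ∷ 1F ∷ 4F ∷ 7F ∷ 2F ∷ 5F ∷ 8F ∷ [])))))

      open Tables link (λ i j a → E≤1 _ _ _) T≤2

    cross-≤24 : cross F₄ e e′ ≤ 24
    cross-≤24 = sum-≤24

    cross-≤23⊎slice : cross F₄ e e′ ≤ 23 ⊎ ∃ λ s → ∀ i j → T (off s i j) → ∀ a → E (x a) (at i) (at′ j) ≡ 1
    cross-≤23⊎slice = sum-≤23⊎slice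

-- Averaging over triples: for fixed `x`, the bound summed over `y` and `z` in the rest controls
-- about 2 L times the row of `x` plus the whole double sum, where L is the length. Summation over
-- `x` gives 3 L times the double sum, and L cancels.
∑∑-triples : ∀ {A : Set} (G : A → A → ℕ) b c xs →
  (∀ x y z r → xs ↭ x ∷ y ∷ z ∷ r → G x y + G x z + G y z ≤ b) → (∀ x y → G x y ≤ c) →
  3 * ∑∑ xs G ≤ length xs * length xs * b + length xs * (9 * c)
∑∑-triples G b c [] off G≤c = z≤n
∑∑-triples G b c xs@(_ ∷ _) off G≤c = *-cancelˡ-≤ (length xs) (begin
  L * (3 * S)              ≡⟨ ≤-antisym (polyle (L ∷ S ∷ []) [] lhs′ rhs′ tt) (polyle (L ∷ S ∷ []) [] rhs′ lhs′ tt) ⟩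
  S * (2 * L) + L * S      ≡⟨ cong₂ _+_ (∑-*ʳ (λ x → ∑ xs (G x)) (2 * L) xs) (∑-const xs S) ⟨
  ∑ xs (λ x → ∑ xs (G x) * (2 * L)) + ∑ xs (λ _ → S) ≡⟨ ∑-+ (λ x → ∑ xs (G x) * (2 * L)) (λ _ → S) xs ⟨
  ∑ xs (λ x → ∑ xs (G x) * (2 * L) + S)              ≤⟨ ∑-≤-const xs _ (λ {x} i → let r , p = ∈⇒↭ i in each x r p) ⟩
  L * (L * L * b + L * (9 * c)) ∎)
  where
  open ≤-Reasoning
  L = length xs
  S = ∑∑ xs G
  lhs′ rhs′ : Ex
  lhs′ = var 0 :* (con 3 :* var 1)
  rhs′ = var 1 :* (con 2 :* var 0) :+ var 0 :* var 1

  each : ∀ x r → xs ↭ x ∷ r → ∑ xs (G x) * (2 * L) + S ≤ L * L * b + L * (9 * c)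
  each x r p = polyle (∑ xs (G x) ∷ S ∷ L ∷ length r ∷ ∑ r (G x) ∷ ∑∑ r G ∷ b ∷ c ∷ ∑ r (λ y → G y x) ∷ G x x ∷
      ∑∑ r (λ y z → G x y + G x z + G y z) ∷ [])
      ((var 2 , con 1 :+ var 3 , con 2 :* var 0) ∷
       (con 1 :+ var 3 , var 2 , var 6 :* (var 2 :+ var 3 :+ con 1) :+ con 9 :* var 7) ∷
       (var 0 , var 9 :+ var 4 , con 2 :+ con 2 :* var 3) ∷
       (var 1 , var 9 :+ var 4 :+ (var 8 :+ var 5) , con 1) ∷
       (var 9 , var 7 , con 3 :+ con 2 :* var 3) ∷
       (var 4 , var 3 :* var 7 , con 3) ∷
       (var 8 , var 3 :* var 7 , con 1) ∷
       (var 3 :* var 4 :+ (var 3 :* var 4 :+ var 5) , var 10 , con 1) ∷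
       (var 10 , var 3 :* var 3 :* var 6 :+ var 3 :* (con 3 :* var 7) , con 1) ∷ [])
      (var 0 :* (con 2 :* var 2) :+ var 1) (var 2 :* var 2 :* var 6 :+ var 2 :* (con 9 :* var 7))
      (≤-reflexive (↭-length p) , ≤-reflexive (sym (↭-length p)) , ≤-reflexive (∑-↭ (G x) p) ,
       ≤-reflexive (trans (∑-↭ _ p) (cong₂ _+_ (∑-↭ (G x) p) (trans (∑-cong r (λ y → ∑-↭ (G y) p)) (∑-+ (λ y → G y x) (λ y → ∑ r (G y)) r)))) ,
       G≤c x x , ∑-≤-const r c (λ {y} _ → G≤c x y) , ∑-≤-const r c (λ {y} _ → G≤c y x) ,
       ≤-reflexive (sym expand) ,
       ∑∑-≤ (λ y z → G x y + G x z + G y z) b (3 * c) r (λ y z r′ q → off x y z r′ (↭-trans p (prep x q)))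
         (λ y → polyle (G x y ∷ G y y ∷ c ∷ []) ((var 0 , var 2 , con 2) ∷ (var 1 , var 2 , con 1) ∷ [])
           (var 0 :+ var 0 :+ var 1) (con 3 :* var 2) (G≤c x y , G≤c y y , tt)) , tt)
    where
    expand : ∑∑ r (λ y z → G x y + G x z + G y z) ≡ length r * ∑ r (G x) + (length r * ∑ r (G x) + ∑∑ r G)
    expand = trans (∑-cong r (λ y → trans (∑-+ (λ z → G x y + G x z) (G y) r)
        (cong (_+ ∑ r (G y)) (trans (∑-+ (λ _ → G x y) (G x) r) (cong (_+ ∑ r (G x)) (trans (∑-const r (G x y)) (*-comm (length r) _)))))))
      (trans (∑-+ (λ y → G x y * length r + ∑ r (G x)) (λ y → ∑ r (G y)) r)
        (trans (cong (_+ ∑∑ r G) (trans (∑-+ (λ y → G x y * length r) (λ _ → ∑ r (G x)) r)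
          (cong₂ _+_ (trans (∑-*ʳ (G x) (length r) r) (*-comm _ (length r))) (∑-const r (∑ r (G x))))))
          (+-assoc (length r * ∑ r (G x)) _ _)))

-- The degree sum of four uncovered vertices.

module Four (G : Hypergraph) (x : Fin 4 → Hypergraph.V G) where

  open Hypergraph G

  open Exchange G
  open Three G
  open FourLinks G x

  private
    xs : List V
    xs = x 0F ∷ x 1F ∷ x 2F ∷ x 3F ∷ []

  module _ (e₀ e₁ e₂ : Tri V)
    (n₀₁ : ∀ a b c d → a ∷ b ∷ c ∷ d ∷ [] ↭ allFin 4 → No₃ (x a ∷ x b ∷ x c ∷ []) e₀ e₁)
    (n₀₂ : ∀ a b c d → a ∷ b ∷ c ∷ d ∷ [] ↭ allFin 4 → No₃ (x a ∷ x b ∷ x c ∷ []) e₀ e₂)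
    (n₁₂ : ∀ a b c d → a ∷ b ∷ c ∷ d ∷ [] ↭ allFin 4 → No₃ (x a ∷ x b ∷ x c ∷ []) e₁ e₂)
    (no₄ : ∀ t u v w y → Edge t → Edge u → Edge v → Edge w →
      vx e₀ ++ vx e₁ ++ vx e₂ ++ xs ↭ flat (t ∷ u ∷ v ∷ w ∷ []) ++ y ∷ [] → ⊥) where

    private
      S : List V
      S = vx e₀ ++ vx e₁ ++ vx e₂ ++ xs

      block : Fin 3 → Tri V
      block 0F = e₀
      block 1F = e₁
      block 2F = e₂

      lookup-idx : ∀ k i → lookup S (idx k i) ≡ lookup (vx (block k)) i
      lookup-idx 0F 0F = refl
      lookup-idx 0F 1F = refl
      lookup-idx 0F 2F = refl
      lookup-idx 1F 0F = refl
      lookup-idx 1F 1F = refl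
      lookup-idx 1F 2F = refl
      lookup-idx 2F 0F = refl
      lookup-idx 2F 1F = refl
      lookup-idx 2F 2F = refl

    -- Here 71 is 3 · 24 - 1. If no pair stays below 24, every cell outside one slice of each table
    -- lies in all four links, so it does not matter which of the four vertices is joined to which
    -- cell. A pairing that avoids the slices then gives four disjoint edges on the 13 vertices.
    cross-≤71 : cross F₄ e₀ e₁ + cross F₄ e₀ e₂ + cross F₄ e₁ e₂ ≤ 71
    cross-≤71 with cross-≤23⊎slice e₀ e₁ n₀₁ | cross-≤23⊎slice e₀ e₂ n₀₂ | cross-≤23⊎slice e₁ e₂ n₁₂
    ... | inj₁ p | _ | _ = +-mono-≤ (+-mono-≤ p (cross-≤24 e₀ e₂ n₀₂)) (cross-≤24 e₁ e₂ n₁₂)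
    ... | inj₂ _ | inj₁ p | _ = +-mono-≤ (+-mono-≤ (cross-≤24 e₀ e₁ n₀₁) p) (cross-≤24 e₁ e₂ n₁₂)
    ... | inj₂ _ | inj₂ _ | inj₁ p = +-mono-≤ (+-mono-≤ (cross-≤24 e₀ e₁ n₀₁) (cross-≤24 e₀ e₂ n₀₂)) p
    ... | inj₂ (s , hs) | inj₂ (t , ht) | inj₂ (u , hu) with slices⇒pairing s t u
    ...   | p@(c₀ , c₁ , c₂ , c₃ , k , i) , valid , av with Equivalence.to (T-∧ {avoids (pick s t u) c₀}) av
    ...     | a₀ , av′ with Equivalence.to (T-∧ {avoids (pick s t u) c₁}) av′
    ...       | a₁ , av″ with Equivalence.to (T-∧ {avoids (pick s t u) c₂}) av″
    ...         | a₂ , a₃ = ⊥-elim (no₄ _ _ _ _ _ (edge 0F c₀ a₀) (edge 1F c₁ a₁) (edge 2F c₂ a₂) (edge 3F c₃ a₃)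
                    (permBy S (indices p) {valid}))
      where
      edge : ∀ a c → T (avoids (pick s t u) c) →
        E (x a) (lookup S (idx (fst (proj₁ c)) (proj₁ (proj₂ c)))) (lookup S (idx (snd (proj₁ c)) (proj₂ (proj₂ c)))) ≡ 1
      edge a (k , i , j) o rewrite lookup-idx (fst k) i | lookup-idx (snd k) j = on k o
        where
        on : ∀ k → T (off (pick s t u k) i j) → E (x a) (lookup (vx (block (fst k))) i) (lookup (vx (block (snd k))) j) ≡ 1
        on 0F o = hs i j o a
        on 1F o = ht i j o a
        on 2F o = hu i j o a

  module _ (X : List V) (M : List (Tri V)) (L : List V) (M-edge : All Edge M)
    (part : Part M X (xs ++ L)) (max : Maximal M X) where

    private
      replace : ∀ {old out new back r L′} → M ↭ old ++ r → xs ++ L ↭ out ++ L′ →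
        flat old ++ out ↭ flat new ++ back → All Edge new → length new ≡ suc (length old) → ⊥
      replace {old} {out} {new} {back} {r} pM pL e ne len = max (new ++ r) _
        (All.++⁺ ne (All.++⁻ʳ old (All-resp-↭ pM M-edge)))
        (exchange {X = X} {out = out} {back = back} {old = old} {new} part pM pL e)
        (trans (length-++ new) (trans (cong (_+ length r) len)
          (cong suc (trans (sym (length-++ old)) (sym (↭-length pM))))))

      no₃ : ∀ e e′ r → M ↭ e ∷ e′ ∷ r → ∀ a b c d → a ∷ b ∷ c ∷ d ∷ [] ↭ allFin 4 → No₃ (x a ∷ x b ∷ x c ∷ []) e e′
      no₃ e e′ r pM a b c d p t u v te ue ve q = replace {e ∷ e′ ∷ []} {x a ∷ x b ∷ x c ∷ []} {t ∷ u ∷ v ∷ []} {[]}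
        pM (++⁺ʳ L (map⁺ x (↭-sym p))) q (te ∷ ue ∷ ve ∷ []) refl

      triple : ∀ e e′ e″ r → M ↭ e ∷ e′ ∷ e″ ∷ r → cross F₄ e e′ + cross F₄ e e″ + cross F₄ e′ e″ ≤ 71
      triple e e′ e″ r pM = cross-≤71 e e′ e″ (no₃ e e′ (e″ ∷ r) pM)
        (no₃ e e″ (e′ ∷ r) (↭-trans pM (prep e (swap e′ e″ ↭-refl))))
        (no₃ e′ e″ (e ∷ r) (↭-trans pM (↭-trans (swap e e′ ↭-refl) (prep e′ (swap e e″ ↭-refl)))))
        (λ t u v w y te ue ve we p → replace {e ∷ e′ ∷ e″ ∷ []} {xs} {t ∷ u ∷ v ∷ w ∷ []} {y ∷ []}
          pM ↭-refl p (te ∷ ue ∷ ve ∷ we ∷ []) refl)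

      inner : ∀ p q r → L ↭ p ∷ q ∷ r → F₄ p q ≤ 0
      inner p q r pL = +-mono-≤ (+-mono-≤ (+-mono-≤ (single 0F 1F 2F 3F) (single 1F 0F 2F 3F)) (single 2F 0F 1F 3F)) (single 3F 0F 1F 2F)
        where
        S = xs ++ p ∷ q ∷ []
        single : ∀ (u k l m : Fin 6) {_ : T (isPerm (u ∷ 4F ∷ 5F ∷ k ∷ l ∷ m ∷ []) (allFin 6))} → E (lookup S u) p q ≤ 0
        single u k l m {t} = bit-0 (E≤1 _ p q) (λ e → replace {[]} {S} {_ ∷ []} {_ ∷ _ ∷ _ ∷ []} ↭-refl
          (++⁺ˡ xs pL) (permBy S (u ∷ 4F ∷ 5F ∷ k ∷ l ∷ m ∷ []) {t}) (e ∷ []) refl)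

      module _ (e : Tri V) (r : List (Tri V)) (pM : M ↭ e ∷ r) where
        S : V → V → List V
        S s t = vx e ++ xs ++ s ∷ t ∷ []

        two : ∀ (u₀ c₀ u₁ c₁ k₀ k₁ k₂ : Fin 9) →
          {T (isPerm (u₀ ∷ c₀ ∷ 7F ∷ u₁ ∷ c₁ ∷ 8F ∷ k₀ ∷ k₁ ∷ k₂ ∷ []) (allFin 9))} →
          ∀ s t r′ → L ↭ s ∷ t ∷ r′ → E (lookup (S s t) u₀) (lookup (S s t) c₀) s ≡ 1 →
          E (lookup (S s t) u₁) (lookup (S s t) c₁) t ≡ 1 → ⊥
        two u₀ c₀ u₁ c₁ k₀ k₁ k₂ {ok} s t r′ pL a b =
          replace {e ∷ []} {xs ++ s ∷ t ∷ []} {_ ∷ _ ∷ []} {_ ∷ _ ∷ _ ∷ []} pM (++⁺ˡ xs pL)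
            (permBy (S s t) (u₀ ∷ c₀ ∷ 7F ∷ u₁ ∷ c₁ ∷ 8F ∷ k₀ ∷ k₁ ∷ k₂ ∷ []) {ok}) (a ∷ b ∷ []) refl

        at : Fin 3 → V
        at = lookup (vx e)

        diagonal : Fin 4 → Fin 4 → Fin 4 → V → ℕ
        diagonal a b c s = E (x a) (at 0F) s + E (x b) (at 1F) s + E (x c) (at 2F) s

        -- The twelve pairs of a vertex `x a` and a vertex of `e` form four diagonals, cyclic shifts
        -- of each other, with at most |L| + 2 each.
        outer : ∑ L (λ s → ∑ (vx e) (λ p → F₄ p s)) ≤ 4 * length L + 8
        outer = begin
          ∑ L (λ s → ∑ (vx e) (λ p → F₄ p s)) ≤⟨ ∑-mono L (λ {s} _ → regroup s) ⟩
          ∑ L (λ s → f₀ s + f₁ s + f₂ s + f₃ s) ≡⟨ ∑-+ (λ s → f₀ s + f₁ s + f₂ s) f₃ L ⟩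
          ∑ L (λ s → f₀ s + f₁ s + f₂ s) + ∑ L f₃ ≡⟨ cong (_+ ∑ L f₃) (∑-+ (λ s → f₀ s + f₁ s) f₂ L) ⟩
          ∑ L (λ s → f₀ s + f₁ s) + ∑ L f₂ + ∑ L f₃ ≡⟨ cong (λ c → c + ∑ L f₂ + ∑ L f₃) (∑-+ f₀ f₁ L) ⟩
          ∑ L f₀ + ∑ L f₁ + ∑ L f₂ + ∑ L f₃
            ≤⟨ polyle (∑ L f₀ ∷ ∑ L f₁ ∷ ∑ L f₂ ∷ ∑ L f₃ ∷ length L ∷ [])
                 ((var 0 , var 4 :+ con 2 , con 1) ∷ (var 1 , var 4 :+ con 2 , con 1) ∷ (var 2 , var 4 :+ con 2 , con 1) ∷
                  (var 3 , var 4 :+ con 2 , con 1) ∷ [])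
                 (var 0 :+ var 1 :+ var 2 :+ var 3) (con 4 :* var 4 :+ con 8)
                 (∑-three-≤ _ _ _ (E≤1 _ _) (E≤1 _ _) (E≤1 _ _) L
                    (two 3F 0F 4F 1F 5F 6F 2F) (two 3F 0F 5F 2F 4F 6F 1F) (two 4F 1F 5F 2F 3F 6F 0F) ,
                  ∑-three-≤ _ _ _ (E≤1 _ _) (E≤1 _ _) (E≤1 _ _) L
                    (two 4F 0F 5F 1F 3F 6F 2F) (two 4F 0F 6F 2F 3F 5F 1F) (two 5F 1F 6F 2F 3F 4F 0F) ,
                  ∑-three-≤ _ _ _ (E≤1 _ _) (E≤1 _ _) (E≤1 _ _) L
                    (two 5F 0F 6F 1F 3F 4F 2F) (two 5F 0F 3F 2F 4F 6F 1F) (two 6F 1F 3F 2F 4F 5F 0F) ,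
                  ∑-three-≤ _ _ _ (E≤1 _ _) (E≤1 _ _) (E≤1 _ _) L
                    (two 6F 0F 3F 1F 4F 5F 2F) (two 6F 0F 4F 2F 3F 5F 1F) (two 3F 1F 4F 2F 5F 6F 0F) , tt) ⟩
          4 * length L + 8 ∎
          where
          open ≤-Reasoning
          f₀ f₁ f₂ f₃ : V → ℕ
          f₀ = diagonal 0F 1F 2F
          f₁ = diagonal 1F 2F 3F
          f₂ = diagonal 2F 3F 0F
          f₃ = diagonal 3F 0F 1F
          regroup : ∀ s → ∑ (vx e) (λ p → F₄ p s) ≤ f₀ s + f₁ s + f₂ s + f₃ s
          regroup s = polyle (E (x 0F) (at 0F) s ∷ E (x 1F) (at 0F) s ∷ E (x 2F) (at 0F) s ∷ E (x 3F) (at 0F) s ∷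
              E (x 0F) (at 1F) s ∷ E (x 1F) (at 1F) s ∷ E (x 2F) (at 1F) s ∷ E (x 3F) (at 1F) s ∷
              E (x 0F) (at 2F) s ∷ E (x 1F) (at 2F) s ∷ E (x 2F) (at 2F) s ∷ E (x 3F) (at 2F) s ∷ [])
            []
            (S₄ 0 :+ (S₄ 4 :+ (S₄ 8 :+ con 0)))
            (D 0 1 2 :+ D 1 2 3 :+ D 2 3 0 :+ D 3 0 1) tt
            where
            S₄ : ℕ → Ex
            S₄ i = var i :+ var (1 + i) :+ var (2 + i) :+ var (3 + i)
            D : ℕ → ℕ → ℕ → Ex
            D a b c = var a :+ var (4 + b) :+ var (8 + c)

    ∑∑-F₄ : ∑∑ vs F₄ ≡ d (x 0F) + d (x 1F) + d (x 2F) + d (x 3F)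
    ∑∑-F₄ = begin
      ∑∑ vs F₄
        ≡⟨ ∑-cong vs (λ p → ∑-+ (F₃ (x 0F) (x 1F) (x 2F) p) (E (x 3F) p) vs) ⟩
      ∑ vs (λ p → ∑ vs (F₃ (x 0F) (x 1F) (x 2F) p) + ∑ vs (E (x 3F) p))
        ≡⟨ ∑-+ (λ p → ∑ vs (F₃ (x 0F) (x 1F) (x 2F) p)) (λ p → ∑ vs (E (x 3F) p)) vs ⟩
      ∑∑ vs (F₃ (x 0F) (x 1F) (x 2F)) + d (x 3F) ≡⟨ cong (_+ d (x 3F)) (∑∑-F₃ (x 0F) (x 1F) (x 2F)) ⟩
      d (x 0F) + d (x 1F) + d (x 2F) + d (x 3F) ∎
      where open ≡-Reasoning

    -- With K = |M|, the main terms are 71 K² + 24 K |L| = 24 K (3 K + |L|) - K². The missing 1 in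
    -- 71 is the gain K² on the left, far above the error O(n) when K is of order n.
    four-degrees : 3 * (d (x 0F) + d (x 1F) + d (x 2F) + d (x 3F)) + length M * length M
      ≤ 24 * (length M * n) + (24 * length X + 220) * n
    four-degrees = begin
      3 * (d (x 0F) + d (x 1F) + d (x 2F) + d (x 3F)) + K²   ≡⟨ cong (λ c → 3 * c + K²) ∑∑-F₄ ⟨
      3 * ∑∑ vs F₄ + K²   ≤⟨ +-monoˡ-≤ K² (*-monoʳ-≤ 3 (∑∑-split F₄ F₄-sym 4 F₄≤4 M L R vs↭)) ⟩
      3 * (∑∑ M (cross F₄) + 2 * ∑ M (λ e → ∑ L (λ s → ∑ (vx e) (λ p → F₄ p s)))
        + ∑∑ L F₄ + 2 * (length R * n * 4)) + K²
        ≤⟨ polyle (∑∑ M (cross F₄) ∷ ∑ M (λ e → ∑ L (λ s → ∑ (vx e) (λ p → F₄ p s))) ∷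
             ∑∑ L F₄ ∷ length M ∷ length L ∷ length X ∷ n ∷ [])
             ((con 3 :* var 0 , var 3 :* var 3 :* con 71 :+ var 3 :* con 324 , con 1) ∷
              (var 1 , var 3 :* (con 4 :* var 4 :+ con 8) , con 6) ∷
              (var 2 , var 4 :* var 4 :* con 0 :+ var 4 :* con 0 , con 3) ∷
              (var 3 :* con 3 :+ (var 5 :+ (con 4 :+ var 4)) , var 6 , con 24 :* var 3 :+ con 124) ∷ [])
             (con 3 :* (var 0 :+ con 2 :* var 1 :+ var 2 :+ con 2 :* ((con 4 :+ var 5) :* var 6 :* con 4)) :+ var 3 :* var 3)
             (con 24 :* (var 3 :* var 6) :+ (con 24 :* var 5 :+ con 220) :* var 6)
             (∑∑-triples (cross F₄) 71 36 M triple cross-F₄≤36 ,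
              ∑-≤-const M _ (λ {e} i → let r , p = ∈⇒↭ i in outer e r p) ,
              ∑∑-≤ F₄ 0 0 L inner (λ p → ≤-reflexive (cong₂ _+_ (cong₂ _+_ (cong₂ _+_ (E-irr _ p) (E-irr _ p)) (E-irr _ p)) (E-irr _ p))) ,
              ≤-reflexive (length-Part {M} {X} part) , tt) ⟩
      24 * (length M * n) + (24 * length X + 220) * n ∎
      where
      open ≤-Reasoning
      K² = length M * length M
      R = xs ++ X
      vs↭ : vs ↭ (flat M ++ L) ++ R
      vs↭ = ↭-trans (↭-sym part) (↭-trans (++⁺ˡ (flat M) (↭-trans (++-comm X (xs ++ L))
        (++⁺ˡ xs (++-comm L X)))) (↭-trans (++⁺ˡ (flat M) (++-comm R L)) (↭-reflexive (sym (++-assoc (flat M) L R)))))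

-- Low and high vertices: their number and their degrees.

∈-tail : ∀ {x y : El} {r} → y ∈ x ∷ r → (y ≡ x → ⊥) → y ∈ r
∈-tail (here e) h = ⊥-elim (h e)
∈-tail (there i) h = i

partition : ∀ (f : El → ℕ) → (∀ x → f x ≤ 1) → ∀ L →
  ∃₂ λ Y H → L ↭ Y ++ H × All (λ x → f x ≡ 1) Y × All (λ x → f x ≡ 0) H
partition f f≤ [] = [] , [] , ↭-refl , [] , []
partition f f≤ (x ∷ L) with partition f f≤ L | f x in eq | f≤ x
... | Y , H , p , y , h | 0 | _ = Y , x ∷ H , ↭-trans (prep x p) (↭-sym (shift x Y H)) , y , eq ∷ h
... | Y , H , p , y , h | 1 | _ = x ∷ Y , H , prep x p , eq ∷ y , h
... | _ | suc (suc _) | s≤s ()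

∑-ones : ∀ (f : El → ℕ) {Y} → All (λ x → f x ≡ 1) Y → ∑ Y f ≡ length Y
∑-ones f [] = refl
∑-ones f (e ∷ h) rewrite e = cong suc (∑-ones f h)

∑-zeros : ∀ (f : El → ℕ) {Y} → All (λ x → f x ≡ 0) Y → ∑ Y f ≡ 0
∑-zeros f [] = refl
∑-zeros f (e ∷ h) rewrite e = ∑-zeros f h

two-of : ∀ (H : List El) → 2 ≤ length H → ∃₂ λ x y → ∃ λ r → H ≡ x ∷ y ∷ r
two-of (x ∷ y ∷ r) _ = x , y , r , refl
two-of (x ∷ []) (s≤s ())

indicator : ∀ {P : Set} → Dec P → ℕ
indicator (yes _) = 1
indicator (no _) = 0

indicator≤1 : ∀ {P : Set} (p : Dec P) → indicator p ≤ 1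
indicator≤1 (yes _) = ≤-refl
indicator≤1 (no _) = z≤n

indicator-1 : ∀ {P : Set} (p : Dec P) → indicator p ≡ 1 → P
indicator-1 (yes p) _ = p

indicator-0 : ∀ {P : Set} (p : Dec P) → indicator p ≡ 0 → P → ⊥
indicator-0 (no ¬p) _ = ¬p

module Setting (G : Hypergraph) (m : ℕ) where

  open Hypergraph G

  open Exchange G public
  open Three G public

  E-pos : ∀ {u v w} → 0 < E u v w → E u v w ≡ 1
  E-pos {u} {v} {w} p = ≤-antisym (E≤1 u v w) p

  E-≢ : ∀ {u v w} → E u v w ≡ 1 → w ≡ v → ⊥
  E-≢ {u} {v} e refl with trans (sym e) (E-irr u v)
  ... | ()

  E-rot : ∀ {u v w} → E u v w ≡ 1 → E v w u ≡ 1
  E-rot {u} {v} {w} e = trans (E₂₃ v w u) (trans (E₁₂ v u w) e)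

  edge-↭ : ∀ {N u v w} → u ∈ N → v ∈ N → w ∈ N → E u v w ≡ 1 → ∃ λ r → N ↭ u ∷ v ∷ w ∷ r
  edge-↭ {N} {u} {v} {w} iu iv iw e =
    let N₁ , p₁ = ∈⇒↭ iu
        N₂ , p₂ = ∈⇒↭ (∈-tail (∈-resp-↭ p₁ iv) (E-≢ (E-rot (E-rot e))))
        N₃ , p₃ = ∈⇒↭ (∈-tail (∈-resp-↭ p₂ (∈-tail (∈-resp-↭ p₁ iw) (E-≢ (trans (E₁₂ v u w) e)))) (E-≢ e))
    in N₃ , ↭-trans p₁ (prep u (↭-trans p₂ (prep v p₃)))

  matching-bound : (∀ M L → All Edge M → Part M [] L → length M ≡ suc m → ⊥) → ∀ M L → All Edge M → Part M [] L → length M ≤ m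
  matching-bound no-matching M L es p = ≮⇒≥ λ lt → no-matching (take (suc m) M) (flat (drop (suc m) M) ++ L) (All.take⁺ (suc m) es)
    (↭-trans (↭-reflexive (trans (sym (++-assoc (flat (take (suc m) M)) (flat (drop (suc m) M)) L)) (cong (_++ L)
      (trans (sym (flat-++ (take (suc m) M) (drop (suc m) M))) (cong flat (take++drop≡id (suc m) M)))))) p)
    (trans (length-take (suc m) M) (m≤n⇒m⊓n≡m lt))

  edge-inside : ∀ z L → 0 < ∑∑ L (E z) → ∃₂ λ a b → ∃ λ r → L ↭ a ∷ b ∷ r × E z a b ≡ 1
  edge-inside z L p with ∑>0⇒∃ (λ a → ∑ L (E z a)) L p
  ... | a , i , q with ∑>0⇒∃ (E z a) L q | ∈⇒↭ i
  ...   | b , j , e | r , p′ with ∈⇒↭ (∈-tail (∈-resp-↭ p′ j) (E-≢ (E-pos e)))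
  ...     | r′ , p″ = a , b , r′ , ↭-trans p′ (prep a p″) , E-pos e

  no-edge-inside : ∀ z L → (∀ a b r → L ↭ a ∷ b ∷ r → E z a b ≡ 1 → ⊥) → ∑∑ L (E z) ≡ 0
  no-edge-inside z L h with ∑∑ L (E z) in eq
  ... | zero = refl
  ... | suc _ with edge-inside z L (subst (0 <_) (sym eq) (s≤s z≤n))
  ...   | a , b , r , p , e = ⊥-elim (h a b r p e)

  -- Since d counts ordered pairs, d v is twice the degree of v: low vertices have degree at most m (n - 1) - g / 2.
  module Low (g : ℕ) (degree-sum : ∀ u v w → E u v w ≡ 1 → 4 * (m * n) + 2 ≤ d u + d v + 4 * m) where

    low? : ∀ v → Dec (d v + g + 2 * m ≤ 2 * (m * n))
    low? v = (d v + g + 2 * m) ≤? (2 * (m * n))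

    lo : V → ℕ
    lo v = indicator (low? v)

    lo≤1 : ∀ v → lo v ≤ 1
    lo≤1 v = indicator≤1 (low? v)

    lo-≤ : ∀ {v} → lo v ≡ 1 → d v + g + 2 * m ≤ 2 * (m * n)
    lo-≤ {v} = indicator-1 (low? v)

    hi-< : ∀ {v} → lo v ≡ 0 → 2 * (m * n) < d v + g + 2 * m
    hi-< {v} h = ≰⇒> (indicator-0 (low? v) h)

    degree-sum′ : ∀ {u v w} → E u v w ≡ 1 → 4 * (m * n) + 2 ≤ d v + d w + 4 * m
    degree-sum′ {u} {v} {w} e = degree-sum v w u (trans (E₂₃ v w u) (trans (E₁₂ v u w) e))

    lolo : ∀ u v w → lo v ≡ 1 → lo w ≡ 1 → E u v w ≡ 0
    lolo u v w p q with E u v w in e | E≤1 u v w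
    ... | 0 | _ = refl
    ... | 1 | _ = ⊥-elim (1+n≰n (polyle (d v ∷ d w ∷ g ∷ m ∷ m * n ∷ [])
      ((var 0 :+ var 2 :+ con 2 :* var 3 , con 2 :* var 4 , con 1) ∷ (var 1 :+ var 2 :+ con 2 :* var 3 , con 2 :* var 4 , con 1) ∷
       (con 4 :* var 4 :+ con 2 , var 0 :+ var 1 :+ con 4 :* var 3 , con 1) ∷ [])
      (con 2) (con 1) (lo-≤ p , lo-≤ q , degree-sum′ e , tt)))
    ... | suc (suc _) | s≤s ()

    lolo′ : ∀ {u v w} → lo u ≡ 1 → E u v w ≡ 1 → lo w ≡ 0
    lolo′ {u} {v} {w} p e with lo w in q | lo≤1 w
    ... | 0 | _ = refl
    ... | 1 | _ with trans (sym e) (trans (E₁₂ u v w) (lolo v u w p q))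
    ...   | ()
    lolo′ p e | suc (suc _) | s≤s ()

    lolo″ : ∀ {u v w} → lo u ≡ 1 → E u v w ≡ 1 → lo v ≡ 0
    lolo″ {u} {v} {w} p e = lolo′ p (trans (sym (E₂₃ u v w)) e)

    module Sizes (W U : List V) (WU : vs ↭ W ++ U)
      (W-lo : All (λ v → lo v ≡ 1) W) (U-hi : All (λ v → lo v ≡ 0) U) where

      in-U : ∀ {v} → lo v ≡ 0 → v ∈ U
      in-U {v} h with Any.++⁻ W (∈-resp-↭ WU (complete v))
      ... | inj₂ i = i
      ... | inj₁ i with trans (sym h) (All.lookup W-lo i)
      ...   | ()

      ∑∑-UW : ∀ x → d x ≡ ∑∑ U (E x) + 2 * ∑ U (λ p → ∑ W (E x p)) + ∑∑ W (E x)
      ∑∑-UW x = trans (trans (∑-cong vs (λ p → ∑-↭ (E x p) σ)) (∑-↭ _ σ)) (∑∑-++ (E x) (E₂₃ x) U W)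
        where
        σ : vs ↭ U ++ W
        σ = ↭-trans WU (++-comm W U)

      ∑∑-WW : ∀ x → ∑∑ W (E x) ≡ 0
      ∑∑-WW x = no-edge-inside x W (λ a b r p e → absurd (All-resp-↭ p W-lo) e)
        where
        absurd : ∀ {a b r} → All (λ v → lo v ≡ 1) (a ∷ b ∷ r) → E x a b ≡ 1 → ⊥
        absurd {a} {b} (p ∷ q ∷ _) e with trans (sym e) (lolo x a b p q)
        ... | ()

      ∑∑-UU : ∀ x → ∑∑ U (E x) + length U ≤ length U * length U
      ∑∑-UU x = polyle (∑∑ U (E x) ∷ length U ∷ [])
        ((var 0 :+ var 1 :* con 1 , var 1 :* var 1 :* con 1 :+ var 1 :* con 0 , con 1) ∷ []) (var 0 :+ var 1) (var 1 :* var 1)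
        (∑∑-≤-off (E x) 1 0 U (λ p q _ _ → E≤1 x p q) (λ p → ≤-reflexive (E-irr x p)) , tt)

      no-low-neighbour : ∀ x → (∀ u w → lo w ≡ 1 → E x u w ≡ 1 → ⊥) → d x + length U ≤ length U * length U
      no-low-neighbour x h = ≤-trans (≤-reflexive (cong (_+ length U) (trans (∑∑-UW x)
        (trans (cong₂ (λ a b → ∑∑ U (E x) + 2 * a + b) zero-sum (∑∑-WW x)) (trans (+-identityʳ _) (+-identityʳ _))))))
        (∑∑-UU x)
        where
        zero-sum : ∑ U (λ p → ∑ W (E x p)) ≡ 0
        zero-sum = n≤0⇒n≡0 (≤-trans (∑-≤-const U 0 (λ {p} _ → ≤-trans (∑-≤-const W 0
          (λ {q} i → bit-0 (E≤1 x p q) (h p q (All.lookup W-lo i)))) (≤-reflexive (*-zeroʳ (length W)))))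
          (≤-reflexive (*-zeroʳ (length U))))

      low-degree : ∀ {w} → lo w ≡ 1 → d w + length U ≤ length U * length U
      low-degree {w} h = no-low-neighbour w (λ u v p e → contra (trans (sym (lolo′ h e)) p))
        where
        contra : 0 ≡ 1 → ⊥
        contra ()

      length-WU : n ≡ length W + length U
      length-WU = trans (↭-length WU) (length-++ W)

      -- The pairs in the link of x avoid x itself and the pairs of low vertices.
      high-degree : ∀ {x} → lo x ≡ 0 →
        d x + length U * length U + length U + 2 * n ≤ 2 * (length U * n) + 2
      high-degree {x} h with ∈⇒↭ (in-U h)
      ... | U′ , p = subst₂ (λ η N → d x + η * η + η + 2 * N ≤ 2 * (η * N) + 2) (sym (↭-length p))
          (sym (trans length-WU (cong (length W +_) (↭-length p))))
          (polyle (d x ∷ length U′ ∷ length W ∷ ∑∑ U′ (E x) ∷ ∑ U′ (λ p → ∑ W (E x p)) ∷ [])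
            ((var 0 , var 3 :+ con 2 :* var 4 , con 1) ∷
             (var 3 :+ var 1 :* con 1 , var 1 :* var 1 :* con 1 :+ var 1 :* con 0 , con 1) ∷
             (var 4 , var 1 :* (var 2 :* con 1) , con 2) ∷ [])
            (var 0 :+ (con 1 :+ var 1) :* (con 1 :+ var 1) :+ (con 1 :+ var 1) :+ con 2 :* (var 2 :+ (con 1 :+ var 1)))
            (con 2 :* ((con 1 :+ var 1) :* (var 2 :+ (con 1 :+ var 1))) :+ con 2)
            (≤-reflexive (trans dx (trans (cong (∑∑ U′ (E x) + 2 * ∑ U′ (λ p → ∑ W (E x p)) +_) (∑∑-WW x)) (+-identityʳ _))) ,
             ∑∑-≤-off (E x) 1 0 U′ (λ p q _ _ → E≤1 x p q) (λ p → ≤-reflexive (E-irr x p)) ,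
             ∑-≤-const U′ _ (λ {p} _ → ∑-≤-const W 1 (λ {q} _ → E≤1 x p q)) , tt))
        where
        self : ∀ p → E x x p ≡ 0
        self p = trans (E₂₃ x x p) (trans (E₁₂ x p x) (E-irr p x))
        σ : vs ↭ x ∷ U′ ++ W
        σ = ↭-trans WU (↭-trans (++-comm W U) (++⁺ʳ W p))
        dx : d x ≡ ∑∑ U′ (E x) + 2 * ∑ U′ (λ p → ∑ W (E x p)) + ∑∑ W (E x)
        dx = trans (trans (∑-cong vs (λ p → ∑-↭ (E x p) σ)) (∑-↭ _ σ))
          (trans (cong₂ _+_ (cong₂ _+_ (self x) (trans (∑-cong (U′ ++ W) self) (∑-zero (U′ ++ W))))
            (∑-cong (U′ ++ W) (λ p → cong (_+ ∑ (U′ ++ W) (E x p)) (trans (E₂₃ x p x) (self p)))))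
            (∑∑-++ (E x) (E₂₃ x) U′ W))

      -- A low `w` and its high neighbour `u` have degrees at most η (η - 1) and 2 (η - 1) (n - 1) -
      -- η (η - 1), where η is the number of high vertices. The sum is 2 (η - 1) (n - 1), so the
      -- hypothesis 4 m (n - 1) + 2 gives η - 1 > 2 m. No error term may enter here.
      many-high : ∀ {w} → lo w ≡ 1 → 2 * m + 2 ≤ length U
      many-high {w} w-lo = ≮⇒≥ λ lt → 1+n≰n (polyle (d w ∷ d u ∷ length U ∷ length r ∷ m ∷ [])
          ((var 0 :+ var 2 , var 2 :* var 2 , con 1) ∷
           (var 1 :+ var 2 :* var 2 :+ var 2 :+ con 2 :* (con 1 :+ var 3) , con 2 :* (var 2 :* (con 1 :+ var 3)) :+ con 2 , con 1) ∷
           (con 4 :* (var 4 :* (con 1 :+ var 3)) :+ con 2 , var 0 :+ var 1 :+ con 4 :* var 4 , con 1) ∷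
           (con 1 :+ var 2 , con 2 :* var 4 :+ con 2 , con 2 :* var 3) ∷ [])
          (con 1) (con 0)
          (low-degree w-lo ,
           subst (λ N → d u + length U * length U + length U + 2 * N ≤ 2 * (length U * N) + 2) n≡ (high-degree u-hi) ,
           subst (λ N → 4 * (m * N) + 2 ≤ d w + d u + 4 * m) n≡ (degree-sum w u b e) , lt , tt))
        where
        u = proj₁ (covered w)
        b = proj₁ (proj₂ (covered w))
        e = proj₂ (proj₂ (covered w))
        u-hi : lo u ≡ 0
        u-hi = lolo″ w-lo e
        r = proj₁ (∈⇒↭ (complete w))
        n≡ : n ≡ suc (length r)
        n≡ = ↭-length (proj₂ (∈⇒↭ (complete w)))

-- Large n: there are only O(m) high vertices.

module SmallMatching (G : Hypergraph) (m : ℕ) where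

  open Hypergraph G

  open Setting G m

  module _ (degree-sum : ∀ u v w → E u v w ≡ 1 → 4 * (m * n) + 2 ≤ d u + d v + 4 * m)
    (no-matching : ∀ M L → All Edge M → Part M [] L → length M ≡ suc m → ⊥)
    (m-pos : 1 ≤ m) (n-large : m * 20000 + 20000 ≤ n) where

    open Low 0 degree-sum

    n-pos : 1 ≤ n
    n-pos = ≤-trans (polyle (m ∷ []) [] (con 1) (var 0 :* con 20000 :+ con 20000) tt) n-large

    D : ℕ
    D = suc m * n * 6

    -- A vertex of degree at least D / 2 has an edge avoiding any 3 m + 2 other vertices.
    greedy : ∀ zs P L → All Edge P → flat P ++ zs ++ L ↭ vs → All (λ z → D ≤ d z) zs →
      length P + length zs ≡ suc m → ⊥
    greedy [] P L P-edge part [] len = no-matching P L P-edge part (trans (sym (+-identityʳ _)) len)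
    greedy (z ∷ zs) P L P-edge part (Dz ∷ Dzs) len =
      let a , b , r , pL , e = edge-inside z L pos in greedy zs ((z , a , b) ∷ P) r (e ∷ P-edge)
        (↭-trans (↭-trans (shifts (z ∷ a ∷ b ∷ []) (flat P)) (++⁺ˡ (flat P)
          (↭-trans (prep z (shifts (a ∷ b ∷ []) zs)) (++⁺ˡ (z ∷ zs) (↭-sym pL))))) part)
        Dzs (trans (sym (+-suc (length P) (length zs))) len)
      where
      R = flat P ++ z ∷ zs
      pos : 0 < ∑∑ L (E z)
      pos = polyle (∑∑ L (E z) ∷ d z ∷ n ∷ m ∷ length P ∷ length zs ∷ length R ∷ [])
        ((var 1 , con 0 :+ con 2 :* con 0 :+ var 0 :+ con 2 :* (var 6 :* var 2 :* con 1) , con 1) ∷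
         ((con 1 :+ var 3) :* var 2 :* con 6 , var 1 , con 1) ∷
         (var 6 , var 4 :* con 3 :+ (con 1 :+ var 5) , con 2 :* var 2) ∷
         (var 4 :+ (con 1 :+ var 5) , con 1 :+ var 3 , con 6 :* var 2) ∷
         (con 1 , var 2 , con 1) ∷ [])
        (con 1) (var 0)
        (∑∑-split (E z) (E₂₃ z) 1 (E≤1 z) [] L R (↭-trans (↭-sym part)
          (↭-trans (↭-reflexive (sym (++-assoc (flat P) (z ∷ zs) L))) (++-comm R L))) , Dz ,
         ≤-reflexive (trans (length-++ (flat P)) (cong (_+ suc (length zs)) (length-flat P))) , ≤-reflexive len , n-pos , tt)

    module _ (Z N : List V) (ZN : vs ↭ Z ++ N) (Z-large : All (λ z → D ≤ d z) Z) (N-small : All (λ z → d z ≤ D) N)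
      (W U : List V) (WU : vs ↭ W ++ U) (W-lo : All (λ v → lo v ≡ 1) W) (U-hi : All (λ v → lo v ≡ 0) U) where

      open Sizes W U WU W-lo U-hi

      few-large : length Z ≤ m
      few-large = ≮⇒≥ λ m<Z → greedy (take (suc m) Z) [] (drop (suc m) Z ++ N) []
        (↭-trans (↭-reflexive (trans (sym (++-assoc (take (suc m) Z) _ N)) (cong (_++ N) (take++drop≡id (suc m) Z)))) (↭-sym ZN))
        (All.take⁺ (suc m) Z-large) (trans (length-take (suc m) Z) (m≤n⇒m⊓n≡m m<Z))

      -- An edge inside N has a vertex of Q in one of three positions.
      meets : ∀ Q L → N ↭ Q ++ L → (∀ x → x ∈ L → ∑∑ L (E x) ≡ 0) → ∑ N (λ u → ∑∑ N (E u)) ≤ 3 * ∑ Q (λ u → ∑∑ N (E u))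
      meets Q L p h = begin
        ∑ N (λ u → ∑∑ N (E u))                          ≡⟨ trans (∑-↭ _ p) (∑-++ _ Q L) ⟩
        q + ∑ L (λ u → ∑∑ N (E u))                      ≡⟨ cong (q +_) (∑-cong L (λ u → splitN (λ a → ∑ N (E u a)))) ⟩
        q + ∑ L (λ u → ∑ Q (λ a → ∑ N (E u a)) + ∑ L (λ a → ∑ N (E u a))) ≡⟨ cong (q +_) (∑-+ _ _ L) ⟩
        q + (∑ L (λ u → ∑ Q (λ a → ∑ N (E u a))) + ∑ L (λ u → ∑ L (λ a → ∑ N (E u a))))
          ≤⟨ +-monoʳ-≤ q (+-mono-≤ first (≤-trans (≤-reflexive second) third)) ⟩
        q + (q + q)                                     ≡⟨ cong (λ c → q + (q + c)) (+-identityʳ q) ⟨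
        3 * q ∎
        where
        open ≤-Reasoning
        q = ∑ Q (λ u → ∑∑ N (E u))
        splitN : ∀ (f : V → ℕ) → ∑ N f ≡ ∑ Q f + ∑ L f
        splitN f = trans (∑-↭ f p) (∑-++ f Q L)
        L≤N : ∀ (f : V → ℕ) → ∑ L f ≤ ∑ N f
        L≤N f = ≤-trans (m≤n+m _ _) (≤-reflexive (sym (splitN f)))
        first : ∑ L (λ u → ∑ Q (λ a → ∑ N (E u a))) ≤ q
        first = ≤-trans (≤-reflexive (trans (∑-swap (λ u a → ∑ N (E u a)) L Q)
            (∑-cong Q (λ a → ∑-cong L (λ u → ∑-cong N (E₁₂ u a))))))
          (∑-mono Q (λ {a} _ → L≤N (λ u → ∑ N (E a u))))
        second : ∑ L (λ u → ∑ L (λ a → ∑ N (E u a))) ≡ ∑ L (λ u → ∑ L (λ a → ∑ Q (E u a)))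
        second = ∑-cong′ L (λ u i → trans (∑-cong L (λ a → splitN (E u a))) (trans (∑-+ _ _ L)
            (trans (cong (∑ L (λ a → ∑ Q (E u a)) +_) (h u i)) (+-identityʳ _))))
          where
          ∑-cong′ : ∀ {f g : V → ℕ} xs → (∀ x → x ∈ xs → f x ≡ g x) → ∑ xs f ≡ ∑ xs g
          ∑-cong′ [] _ = refl
          ∑-cong′ (x ∷ xs) k = cong₂ _+_ (k x (here refl)) (∑-cong′ xs (λ y i → k y (there i)))
        third : ∑ L (λ u → ∑ L (λ a → ∑ Q (E u a))) ≤ q
        third = ≤-trans (≤-reflexive (trans (∑-cong L (λ u → ∑-swap (E u) L Q)) (∑-swap (λ u c → ∑ L (λ a → E u a c)) L Q)))
          (∑-mono Q (λ {c} _ → ≤-trans (∑-mono L (λ {u} _ → ≤-trans (≤-reflexive (∑-cong L (λ a → trans (E₂₃ u a c) (E₁₂ u c a)))) (L≤N (E c u))))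
            (L≤N (λ u → ∑ N (E c u)))))

      -- At most 2 |Z| (n - 1) ordered pairs of the link meet `Z`, as `u` itself is not in the link.
      -- A high vertex has at least 2 m (n - 1) + 1 pairs, and m - |Z| is at least `p`.
      inside-degree : ∀ u → lo u ≡ 0 → u ∈ N → ∀ p n′ → n ≡ suc n′ → p + length Z ≤ m → 2 * (p * n′) + 1 ≤ ∑∑ N (E u)
      inside-degree u hi i p n′ n≡ pz with ∈⇒↭ i
      ... | N′ , σ = polyle (d u ∷ ∑∑ N (E u) ∷ ∑ N (λ a → ∑ Z (E u a)) ∷ ∑∑ Z (E u) ∷ length N′ ∷ length Z ∷ p ∷ n′ ∷ m ∷ [])
          ((var 0 , var 1 :+ con 2 :* var 2 :+ var 3 , con 1) ∷
           (var 2 , var 4 :* (var 5 :* con 1) , con 2) ∷ (var 3 , var 5 :* (var 5 :* con 1) , con 1) ∷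
           (con 1 :+ con 2 :* (var 8 :* (con 1 :+ var 7)) , var 0 :+ con 0 :+ con 2 :* var 8 , con 1) ∷
           (var 6 :+ var 5 , var 8 , con 2 :* var 7) ∷
           (var 5 :+ var 4 , var 7 , con 2 :* var 5) ∷ [])
          (con 2 :* (var 6 :* var 7) :+ con 1) (var 1)
          (≤-reflexive (trans (trans (∑-cong vs (λ a → ∑-↭ (E u a) NZ)) (∑-↭ _ NZ)) (∑∑-++ (E u) (E₂₃ u) N Z)) ,
           ≤-trans (≤-reflexive (trans (∑-↭ _ σ) (cong (_+ ∑ N′ (λ a → ∑ Z (E u a)))
             (trans (∑-cong Z (λ a → trans (E₂₃ u u a) (trans (E₁₂ u a u) (E-irr a u)))) (∑-zero Z)))))
             (∑-≤-const N′ _ (λ {a} _ → ∑-≤-const Z 1 (λ {b} _ → E≤1 u a b))) ,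
           ∑-≤-const Z _ (λ {a} _ → ∑-≤-const Z 1 (λ {b} _ → E≤1 u a b)) ,
           subst (λ c → 2 * (m * c) < d u + 0 + 2 * m) n≡ (hi-< hi) , pz ,
           ≤-reflexive (suc-injective (trans (sym (trans (↭-length ZN) (trans (length-++ Z) (trans (cong (length Z +_) (↭-length σ)) (+-suc _ _))))) n≡)) ,
           tt)
        where
        NZ : vs ↭ N ++ Z
        NZ = ↭-trans ZN (++-comm Z N)

      -- Edges inside `N` are added to `P` until |P| + |Z| = m + 1, when `greedy` takes care of `Z`.
      -- If this stops early with p edges, every edge inside `N` meets `P`, which bounds the total
      -- degree inside `N`, while each high vertex of `N` keeps a degree above 2 p (n - 1).
      few-high : length U ≤ m * 55 + 55
      few-high = ≮⇒≥ λ lt → grow lt (suc m ∸ length Z) [] N [] (↭-sym ZN)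
        (trans (cong (_+ length Z) (+-identityʳ (suc m ∸ length Z))) (m∸n+n≡m (≤-trans few-large (n≤1+n m))))
        where
        grow : m * 55 + 55 < length U → ∀ k P L → All Edge P → flat P ++ Z ++ L ↭ vs → k + length P + length Z ≡ suc m → ⊥
        grow lt zero P L P-edge part len = greedy Z P L P-edge part Z-large len
        grow lt (suc k) P L P-edge part len = 1+n≰n (polyle
            (length H ∷ p ∷ n′ ∷ m ∷ length U ∷ length Z ∷ k ∷ length W ∷ length Y ∷ [])
            -- Three positions, 3 p vertices of `P` and doubled degrees of at most 6 (m + 1) n give
            -- 54 p (m + 1) n, whence the 55 in the bound. The summand 1 on the left decides the
            -- case p = 0.
            ((var 0 :* (con 2 :* (var 1 :* var 2) :+ con 1) , con 3 :* (var 1 :* con 3 :* ((con 1 :+ var 3) :* (con 1 :+ var 2) :* con 6)) , con 1) ∷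
             (var 3 :* con 54 :+ con 55 , var 0 , con 2 :* (var 1 :* var 2) :+ con 1) ∷
             (con 1 , var 2 , con 54 :* (var 1 :* (con 1 :+ var 3))) ∷ [])
            (con 1) (con 0) (total , H-large , n′-pos , tt))
          where
          p = length P
          n′ = pred n
          n≡ : n ≡ suc n′
          n≡ = sym (suc-pred n ⦃ >-nonZero n-pos ⦄)
          n′-pos : 1 ≤ n′
          n′-pos = s≤s⁻¹ (subst (2 ≤_) n≡ (≤-trans (polyle (m ∷ []) [] (con 2) (var 0 :* con 20000 :+ con 20000) tt) n-large))
          pz : p + length Z ≤ m
          pz = polyle (p ∷ length Z ∷ k ∷ m ∷ []) ((con 1 :+ var 2 :+ var 0 :+ var 1 , con 1 :+ var 3 , con 1) ∷ [])
            (var 0 :+ var 1) (var 3) (≤-reflexive len , tt)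
          N↭ : N ↭ flat P ++ L
          N↭ = drop-++ Z (↭-trans (↭-sym ZN) (↭-trans (↭-sym part) (shifts (flat P) Z)))
            where
            drop-++ : ∀ (xs : List V) {ys zs} → xs ++ ys ↭ xs ++ zs → ys ↭ zs
            drop-++ [] σ = σ
            drop-++ (x ∷ xs) σ = drop-++ xs (drop-∷ σ)
          L-empty : ∀ x → x ∈ L → ∑∑ L (E x) ≡ 0
          L-empty x i = no-edge-inside x L (λ a b r σ e → absurd a b r σ e (∈-resp-↭ σ i))
            where
            add : ∀ a b r → L ↭ x ∷ a ∷ b ∷ r → E x a b ≡ 1 → ⊥
            add a b r σ e = grow lt k ((x , a , b) ∷ P) r (e ∷ P-edge)
              (↭-trans (↭-trans (shifts (x ∷ a ∷ b ∷ []) (flat P)) (++⁺ˡ (flat P) (↭-trans (shifts (x ∷ a ∷ b ∷ []) Z) (++⁺ˡ Z (↭-sym σ))))) part)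
              (trans (cong (_+ length Z) (+-suc k p)) len)
            absurd : ∀ a b r → L ↭ a ∷ b ∷ r → E x a b ≡ 1 → x ∈ a ∷ b ∷ r → ⊥
            absurd a b r σ e (here refl) with trans (sym e) (trans (E₂₃ x x b) (trans (E₁₂ x b x) (E-irr b x)))
            ... | ()
            absurd a b r σ e (there (here refl)) with trans (sym e) (trans (E₁₂ x a x) (E-irr a x))
            ... | ()
            absurd a b r σ e (there (there j)) = let r′ , τ = ∈⇒↭ j in
              add a b r′ (↭-trans σ (↭-trans (++⁺ˡ (a ∷ b ∷ []) τ) (shift x (a ∷ b ∷ []) r′))) e
          split = partition lo lo≤1 N
          Y = proj₁ split
          H = proj₁ (proj₂ split)
          YH : N ↭ Y ++ H
          YH = proj₁ (proj₂ (proj₂ split))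
          Y-lo = proj₁ (proj₂ (proj₂ (proj₂ split)))
          H-hi = proj₂ (proj₂ (proj₂ (proj₂ split)))
          W≥Y : length Y ≤ length W
          W≥Y = begin
            length Y                ≡⟨ ∑-ones lo Y-lo ⟨
            ∑ Y lo                  ≤⟨ m≤m+n _ _ ⟩
            ∑ Y lo + ∑ H lo         ≡⟨ trans (∑-↭ lo YH) (∑-++ lo Y H) ⟨
            ∑ N lo                  ≤⟨ m≤n+m _ _ ⟩
            ∑ Z lo + ∑ N lo         ≡⟨ trans (∑-↭ lo ZN) (∑-++ lo Z N) ⟨
            ∑ vs lo                 ≡⟨ trans (∑-↭ lo WU) (∑-++ lo W U) ⟩
            ∑ W lo + ∑ U lo         ≡⟨ cong₂ _+_ (∑-ones lo W-lo) (∑-zeros lo U-hi) ⟩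
            length W + 0            ≡⟨ +-identityʳ _ ⟩
            length W                ∎
            where open ≤-Reasoning
          H-large : m * 54 + 55 ≤ length H
          H-large = polyle (length H ∷ m ∷ length U ∷ length Z ∷ length W ∷ length Y ∷ n ∷ p ∷ [])
            ((con 1 :+ (var 1 :* con 55 :+ con 55) , var 2 , con 1) ∷ (var 4 :+ var 2 , var 6 , con 1) ∷
             (var 6 , var 3 :+ (var 5 :+ var 0) , con 1) ∷ (var 5 , var 4 , con 1) ∷ (var 7 :+ var 3 , var 1 , con 1) ∷ [])
            (var 1 :* con 54 :+ con 55) (var 0)
            (lt , ≤-reflexive (sym length-WU) ,
             ≤-reflexive (trans (↭-length ZN) (trans (length-++ Z) (cong (length Z +_) (trans (↭-length YH) (length-++ Y))))) , W≥Y , pz , tt)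
          total : length H * (2 * (p * n′) + 1) ≤ 3 * (p * 3 * (suc m * suc n′ * 6))
          total = begin
            length H * (2 * (p * n′) + 1)   ≡⟨ ∑-const H _ ⟨
            ∑ H (λ _ → 2 * (p * n′) + 1)
              ≤⟨ ∑-mono H (λ {u} i → inside-degree u (All.lookup H-hi i) (∈-resp-↭ (↭-sym YH) (Any.++⁺ʳ Y i)) p n′ n≡ pz) ⟩
            ∑ H (λ u → ∑∑ N (E u))          ≤⟨ m≤n+m _ _ ⟩
            ∑ Y (λ u → ∑∑ N (E u)) + ∑ H (λ u → ∑∑ N (E u)) ≡⟨ trans (∑-↭ _ YH) (∑-++ _ Y H) ⟨
            ∑ N (λ u → ∑∑ N (E u))          ≤⟨ meets (flat P) L N↭ L-empty ⟩
            3 * ∑ (flat P) (λ u → ∑∑ N (E u))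
              ≤⟨ *-monoʳ-≤ 3 (∑-≤-const (flat P) _ (λ {u} i → ≤-trans (N≤vs u)
                   (All.lookup N-small (∈-resp-↭ (↭-sym N↭) (Any.++⁺ˡ i))))) ⟩
            3 * (length (flat P) * D)       ≡⟨ cong₂ (λ a b → 3 * (a * (suc m * b * 6))) (length-flat P) n≡ ⟩
            3 * (p * 3 * (suc m * suc n′ * 6)) ∎
            where
            open ≤-Reasoning
            N≤vs : ∀ u → ∑∑ N (E u) ≤ d u
            N≤vs u = ≤-trans (∑-mono N (λ {a} _ → sub (E u a))) (sub (λ a → ∑ vs (E u a)))
              where
              sub : ∀ (f : V → ℕ) → ∑ N f ≤ ∑ vs f
              sub f = ≤-trans (m≤n+m _ (∑ Z f)) (≤-reflexive (sym (trans (∑-↭ f ZN) (∑-++ f Z N))))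

-- Large n: a matching of edges with a low vertex.

module FewHigh (G : Hypergraph) (m : ℕ) where

  open Hypergraph G

  open Setting G m

  module _ (degree-sum : ∀ u v w → E u v w ≡ 1 → 4 * (m * n) + 2 ≤ d u + d v + 4 * m)
    (no-matching : ∀ M L → All Edge M → Part M [] L → length M ≡ suc m → ⊥)
    (m-pos : 1 ≤ m) (n-large : m * 20000 + 20000 ≤ n) where

    open Low 0 degree-sum

    module _ (W U : List V) (WU : vs ↭ W ++ U) (W-lo : All (λ v → lo v ≡ 1) W) (U-hi : All (λ v → lo v ≡ 0) U)
      (few-high : length U ≤ m * 55 + 55) where

      open Sizes W U WU W-lo U-hi

      private
        η = length U

      η≤110m : η ≤ m * 110
      η≤110m = polyle (η ∷ m ∷ []) ((var 0 , var 1 :* con 55 :+ con 55 , con 1) ∷ (con 1 , var 1 , con 55) ∷ [])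
        (var 0) (var 1 :* con 110) (few-high , m-pos , tt)

      -- Without a low neighbour the degree of `u` would be at most η², of order m², which is too
      -- small for a high vertex. A low neighbour has degree at most η² and leaves nearly 4 m n to
      -- `u`.
      high-near-low : ∀ u → lo u ≡ 0 → 4 * (m * n) + 2 ≤ d u + η * η + 4 * m
      high-near-low u hi = ≮⇒≥ λ lt → 1+n≰n (polyle (d u ∷ η ∷ m ∷ n ∷ [])
          ((var 0 :+ var 1 , var 1 :* var 1 , con 1) ∷
           (con 1 :+ con 2 :* (var 2 :* var 3) , var 0 :+ con 0 :+ con 2 :* var 2 , con 1) ∷
           (var 1 , var 2 :* con 110 , var 1 :+ var 2 :* con 110) ∷
           (var 2 :* con 20000 :+ con 20000 , var 3 , con 2 :* var 2) ∷ [])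
          (con 1) (con 0)
          (no-low-neighbour u (λ v w w-lo e → 1+n≰n (polyle (d u ∷ d w ∷ η ∷ m ∷ m * n ∷ [])
             ((con 1 :+ (var 0 :+ var 2 :* var 2 :+ con 4 :* var 3) , con 4 :* var 4 :+ con 2 , con 1) ∷
              (con 4 :* var 4 :+ con 2 , var 0 :+ var 1 :+ con 4 :* var 3 , con 1) ∷
              (var 1 :+ var 2 , var 2 :* var 2 , con 1) ∷ [])
             (con 1) (con 0) (lt , degree-sum u w v (trans (E₂₃ u w v) e) , low-degree w-lo , tt))) ,
           hi-< hi , η≤110m , n-large , tt))

      private
        Tail-lo : Tri V → Set
        Tail-lo (a , b , c) = lo c ≡ 1

        third-low : ∀ P → All Edge P → All Tail-lo P → ∑ (flat P) lo ≡ length P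
        third-low [] _ _ = refl
        third-low ((a , b , c) ∷ P) (e ∷ es) (l ∷ ls) rewrite l | lolo″ l (trans (sym (trans (E₂₃ a b c) (trans (E₁₂ a c b) (E₂₃ c a b)))) e)
          | lolo′ l (trans (sym (trans (E₂₃ a b c) (trans (E₁₂ a c b) (E₂₃ c a b)))) e) = cong suc (third-low P es ls)

      -- When the matching `P` cannot be extended, two uncovered high vertices have links mainly
      -- between `P` and the uncovered low vertices, and exchanges limit their degree sum to about 4
      -- m n. By `high-near-low` it is about 8 m n.
      small-impossible : ⊥
      small-impossible = grow (suc m) [] vs [] [] ↭-refl (+-identityʳ _)
        where
        grow : ∀ k P L → All Edge P → All Tail-lo P → flat P ++ L ↭ vs → k + length P ≡ suc m → ⊥
        augment : ∀ k P L → All Edge P → All Tail-lo P → flat P ++ L ↭ vs → suc k + length P ≡ suc m →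
          ∀ Y H → L ↭ Y ++ H → All (λ v → lo v ≡ 1) Y → All (λ v → lo v ≡ 0) H →
          (∃₂ λ x y → ∃ λ r → H ≡ x ∷ y ∷ r) → ⊥
        grow zero P L P-edge P-lo part len = no-matching P L P-edge part len
        grow (suc k) P L P-edge P-lo part len with partition lo lo≤1 L
        ... | Y , H , YH , Y-lo , H-hi = augment k P L P-edge P-lo part len Y H YH Y-lo H-hi (two-of H two)
          where
          -- Each of the at most m edges of `P` has two high vertices, and `many-high` provides 2 m
          -- + 2.
          two : 2 ≤ length H
          two = polyle (length H ∷ length Y ∷ length P ∷ length W ∷ η ∷ m ∷ n ∷ k ∷ [])
              ((con 2 :* var 5 :+ con 2 , var 4 , con 1) ∷ (var 3 :+ var 4 , var 6 , con 1) ∷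
               (var 6 , var 2 :* con 3 :+ (var 1 :+ var 0) , con 1) ∷ (var 2 :+ var 1 , var 3 , con 1) ∷
               (con 1 :+ var 7 :+ var 2 , con 1 :+ var 5 , con 2) ∷ [])
              (con 2) (var 0)
              (many-high (proj₂ low-vertex) , ≤-reflexive (sym length-WU) ,
               ≤-reflexive (trans (sym (↭-length part)) (trans (length-++ (flat P)) (cong₂ _+_ (length-flat P) (trans (↭-length YH) (length-++ Y))))) ,
               ≤-reflexive lows , ≤-reflexive len , tt)
            where
            low-vertex : ∃ λ w → lo w ≡ 1
            low-vertex with ∑>0⇒∃ lo W (≤-trans W-pos (≤-reflexive (sym (∑-ones lo W-lo))))
              where
              W-pos : 1 ≤ length W
              W-pos = polyle (length W ∷ η ∷ n ∷ m ∷ []) ((var 2 , var 0 :+ var 1 , con 1) ∷ (var 1 , var 3 :* con 55 :+ con 55 , con 1) ∷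
                (var 3 :* con 20000 :+ con 20000 , var 2 , con 1) ∷ []) (con 1) (var 0) (≤-reflexive length-WU , few-high , n-large , tt)
            ... | w , i , _ = w , All.lookup W-lo i
            lows : length P + length Y ≡ length W
            lows = begin
              length P + length Y     ≡⟨ cong₂ _+_ (third-low P P-edge P-lo) (trans (+-identityʳ _) (∑-ones lo Y-lo)) ⟨
              ∑ (flat P) lo + (∑ Y lo + 0) ≡⟨ cong (λ c → ∑ (flat P) lo + (∑ Y lo + c)) (∑-zeros lo H-hi) ⟨
              ∑ (flat P) lo + (∑ Y lo + ∑ H lo) ≡⟨ cong (∑ (flat P) lo +_) (trans (∑-↭ lo YH) (∑-++ lo Y H)) ⟨
              ∑ (flat P) lo + ∑ L lo  ≡⟨ ∑-++ lo (flat P) L ⟨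
              ∑ (flat P ++ L) lo      ≡⟨ ∑-↭ lo part ⟩
              ∑ vs lo                 ≡⟨ trans (∑-↭ lo WU) (∑-++ lo W U) ⟩
              ∑ W lo + ∑ U lo         ≡⟨ cong₂ _+_ (∑-ones lo W-lo) (∑-zeros lo U-hi) ⟩
              length W + 0            ≡⟨ +-identityʳ _ ⟩
              length W                ∎
              where open ≡-Reasoning

        augment k P L P-edge P-lo part len Y H YH Y-lo H-hi (r , r′ , H′ , refl) = 1+n≰n (polyle (d r ∷ d r′ ∷ η ∷ m ∷ n ∷ length P ∷ length H′ ∷ length Y ∷ k ∷ length W ∷ [])
            ((var 0 :+ var 1 , (var 5 :* con 3 :+ (con 2 :+ var 6)) :* ((var 5 :* con 3 :+ (con 2 :+ var 6)) :* con 2) :+ con 2 :* (var 5 :* (con 2 :* var 7 :+ con 2)) , con 1) ∷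
             (con 4 :* (var 3 :* var 4) :+ con 2 , var 0 :+ var 2 :* var 2 :+ con 4 :* var 3 , con 1) ∷
             (con 4 :* (var 3 :* var 4) :+ con 2 , var 1 :+ var 2 :* var 2 :+ con 4 :* var 3 , con 1) ∷
             (var 5 :* con 3 :+ (con 2 :+ var 6) , var 3 :* con 111 , con 2 :* (var 5 :* con 3 :+ (con 2 :+ var 6)) :+ var 3 :* con 222) ∷
             (var 2 , var 3 :* con 110 , con 2 :* var 2 :+ var 3 :* con 220) ∷
             (var 7 , var 4 , con 4 :* var 5) ∷
             (var 5 , var 3 , con 4 :* var 4 :+ con 4) ∷
             (var 3 :* con 20000 :+ con 20000 , var 4 , con 4 :* var 3) ∷ [])
            (con 1) (con 0)
            (sum , high-near-low r (All.head H-hi) , high-near-low r′ (All.head (All.tail H-hi)) , core , η≤110m , Y≤n , P≤m , n-large , tt))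
          where
          part′ : flat P ++ Y ++ r ∷ r′ ∷ H′ ↭ vs
          part′ = ↭-trans (++⁺ˡ (flat P) (↭-sym YH)) part
          σ : vs ↭ (flat P ++ r ∷ r′ ∷ H′) ++ Y
          σ = ↭-trans (↭-sym part′) (↭-trans (++⁺ˡ (flat P) (++-comm Y _)) (↭-reflexive (sym (++-assoc (flat P) _ Y))))
          P≤m : length P ≤ m
          P≤m = s≤s⁻¹ (≤-trans (s≤s (m≤n+m _ k)) (≤-reflexive len))
          Y≤n : length Y ≤ n
          Y≤n = ≤-trans (m≤n+m _ (length (flat P ++ r ∷ r′ ∷ H′))) (≤-reflexive (sym (trans (↭-length σ) (length-++ (flat P ++ r ∷ r′ ∷ H′)))))
          F : V → V → ℕ
          F p q = E r p q + E r′ p q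
          max : ∀ P′ L′ → All Edge P′ → All Tail-lo P′ → flat P′ ++ L′ ↭ vs → length P′ ≡ suc (length P) → ⊥
          max P′ L′ e l pt len′ = grow k P′ L′ e l pt (trans (cong (k +_) len′) (trans (+-suc k _) len))
          HH = r ∷ r′ ∷ H′
          noHY : ∀ {u h y} → u ∈ HH → h ∈ HH → y ∈ Y → E u h y ≡ 0
          noHY {u} {h} {y} iu ih iy with E u h y in eq | E≤1 u h y
          ... | 0 | _ = refl
          ... | suc (suc _) | s≤s ()
          ... | 1 | _ with ∈⇒↭ iu | ∈⇒↭ iy
          ...   | U′ , pu | Y′ , py with ∈⇒↭ (∈-tail (∈-resp-↭ pu ih) (E-≢ (trans (sym (E₁₂y u h y)) eq)))
            where
            E₁₂y : ∀ a b c → E a b c ≡ E c a b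
            E₁₂y a b c = trans (E₂₃ a b c) (E₁₂ a c b)
          ...     | U″ , pu′ = ⊥-elim (max ((u , h , y) ∷ P) (Y′ ++ U″) (eq ∷ P-edge) (All.lookup Y-lo iy ∷ P-lo)
                (↭-trans (↭-trans (shifts (u ∷ h ∷ y ∷ []) (flat P)) (++⁺ˡ (flat P) τ)) part′) refl)
            where
            τ : u ∷ h ∷ y ∷ Y′ ++ U″ ↭ Y ++ HH
            τ = ↭-trans (++⁺ˡ (u ∷ h ∷ []) (++⁺ʳ U″ (↭-sym py))) (↭-trans (shifts (u ∷ h ∷ []) Y)
              (++⁺ˡ Y (↭-trans (prep u (↭-sym pu′)) (↭-sym pu))))
          HY : ∑ HH (λ p → ∑ Y (F p)) ≡ 0
          HY = n≤0⇒n≡0 (≤-trans (∑-≤-const HH 0 (λ {h} ih → ≤-trans (∑-≤-const Y 0 (λ {y} iy → ≤-reflexive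
            (cong₂ _+_ (noHY (here refl) ih iy) (noHY (there (here refl)) ih iy)))) (≤-reflexive (*-zeroʳ (length Y))))) (≤-reflexive (*-zeroʳ (length HH))))
          YY : ∑∑ Y F ≡ 0
          YY = n≤0⇒n≡0 (≤-trans (∑-≤-const Y 0 (λ {p} i → ≤-trans (∑-≤-const Y 0 (λ {q} j → ≤-reflexive
            (cong₂ _+_ (lolo r p q (All.lookup Y-lo i) (All.lookup Y-lo j)) (lolo r′ p q (All.lookup Y-lo i) (All.lookup Y-lo j)))))
            (≤-reflexive (*-zeroʳ (length Y))))) (≤-reflexive (*-zeroʳ (length Y))))
          module _ (e : Tri V) (P′ : List (Tri V)) (pP : P ↭ e ∷ P′) where
            a b c : V
            a = proj₁ e
            b = proj₁ (proj₂ e)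
            c = proj₂ (proj₂ e)
            S : V → V → List V
            S s t = vx e ++ s ∷ t ∷ r ∷ r′ ∷ []
            two : ∀ (i j : Fin 7) {_ : T (isPerm (5F ∷ i ∷ 3F ∷ 6F ∷ j ∷ 4F ∷ 2F ∷ []) (allFin 7))} →
              ∀ s t q → Y ↭ s ∷ t ∷ q → E r (lookup (S s t) i) s ≡ 1 → E r′ (lookup (S s t) j) t ≡ 1 → ⊥
            two i j {ok} s t q pY u v = max ((r , lookup (S s t) i , s) ∷ (r′ , lookup (S s t) j , t) ∷ P′) (c ∷ (q ++ H′))
              (u ∷ v ∷ All.tail (All-resp-↭ pP P-edge))
              (All.head lows ∷ All.head (All.tail lows) ∷ All.tail (All-resp-↭ pP P-lo))
              (↭-trans (exchange {X = []} {out = s ∷ t ∷ r ∷ r′ ∷ []} {back = c ∷ []} {old = e ∷ []}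
                 {(r , lookup (S s t) i , s) ∷ (r′ , lookup (S s t) j , t) ∷ []} ↭-refl pP τ
                 (permBy (S s t) (5F ∷ i ∷ 3F ∷ 6F ∷ j ∷ 4F ∷ 2F ∷ []) {ok})) part′)
              (cong suc (sym (↭-length pP)))
              where
              lows : All (λ x → lo x ≡ 1) (s ∷ t ∷ q)
              lows = All-resp-↭ pY Y-lo
              τ : Y ++ r ∷ r′ ∷ H′ ↭ (s ∷ t ∷ r ∷ r′ ∷ []) ++ (q ++ H′)
              τ = ↭-trans (++⁺ʳ (r ∷ r′ ∷ H′) pY) (++⁺ˡ (s ∷ t ∷ []) (shifts q (r ∷ r′ ∷ [])))
            -- The low vertex `c` of `e` forms no edge with a vertex of `Y`. For the high vertices
            -- `a` and `b`, edges {r , a , s} and {r′ , b , t} with s and t different would replace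
            -- `e`; so would those with `a` and `b` interchanged.
            eY : ∑ (vx e) (λ p → ∑ Y (F p)) ≤ 2 * length Y + 2
            eY = begin
              ∑ Y (F a) + (∑ Y (F b) + (∑ Y (F c) + 0))
                ≡⟨ cong (λ z → ∑ Y (F a) + (∑ Y (F b) + (z + 0))) zero-c ⟩
              ∑ Y (F a) + (∑ Y (F b) + 0) ≡⟨ cong (∑ Y (F a) +_) (+-identityʳ _) ⟩
              ∑ Y (F a) + ∑ Y (F b) ≡⟨ ∑-+ (F a) (F b) Y ⟨
              ∑ Y (λ s → F a s + F b s) ≤⟨ ∑-mono Y (λ {s} _ → polyle (E r a s ∷ E r′ a s ∷ E r b s ∷ E r′ b s ∷ []) []
                  (var 0 :+ var 1 :+ (var 2 :+ var 3)) (var 0 :+ var 3 :+ (var 2 :+ var 1)) tt) ⟩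
              ∑ Y (λ s → E r a s + E r′ b s + (E r b s + E r′ a s)) ≡⟨ ∑-+ (λ s → E r a s + E r′ b s) (λ s → E r b s + E r′ a s) Y ⟩
              ∑ Y (λ s → E r a s + E r′ b s) + ∑ Y (λ s → E r b s + E r′ a s)
                ≤⟨ +-mono-≤ (∑-two-≤ (E r a) (E r′ b) (E≤1 _ _) (E≤1 _ _) Y (two 0F 1F)) (∑-two-≤ (E r b) (E r′ a) (E≤1 _ _) (E≤1 _ _) Y (two 1F 0F)) ⟩
              length Y + 1 + (length Y + 1) ≤⟨ polyle (length Y ∷ []) [] (var 0 :+ con 1 :+ (var 0 :+ con 1)) (con 2 :* var 0 :+ con 2) tt ⟩
              2 * length Y + 2 ∎
              where
              open ≤-Reasoning
              c-lo : lo c ≡ 1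
              c-lo = All.head (All-resp-↭ pP P-lo)
              zero-c : ∑ Y (F c) ≡ 0
              zero-c = n≤0⇒n≡0 (≤-trans (∑-≤-const Y 0 (λ {q} j → ≤-reflexive
                (cong₂ _+_ (lolo r c q c-lo (All.lookup Y-lo j)) (lolo r′ c q c-lo (All.lookup Y-lo j))))) (≤-reflexive (*-zeroʳ (length Y))))
          -- There are at most 110 m high vertices, and the low vertices of `P` add at most m.
          core : length P * 3 + suc (suc (length H′)) ≤ m * 111
          core = polyle (length P ∷ length H′ ∷ m ∷ η ∷ length W ∷ length Y ∷ n ∷ [])
            ((var 4 , var 0 :+ var 5 , con 1) ∷ (var 6 , var 4 :+ var 3 , con 1) ∷
             (var 0 :* con 3 :+ (var 5 :+ (con 2 :+ var 1)) , var 6 , con 1) ∷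
             (var 3 , var 2 :* con 110 , con 1) ∷ (var 0 , var 2 , con 1) ∷ [])
            (var 0 :* con 3 :+ (con 2 :+ var 1)) (var 2 :* con 111)
            (W≤ , ≤-reflexive length-WU , ≤-reflexive (trans (sym (trans (length-++ (flat P)) (cong₂ _+_ (length-flat P) (length-++ Y)))) (↭-length part′)) , η≤110m , P≤m , tt)
            where
            W≤ : length W ≤ length P + length Y
            W≤ = begin
              length W                ≡⟨ trans (∑-↭ lo WU) (trans (∑-++ lo W U) (trans (cong₂ _+_ (∑-ones lo W-lo) (∑-zeros lo U-hi)) (+-identityʳ _))) ⟨
              ∑ vs lo                 ≡⟨ ∑-↭ lo part′ ⟨
              ∑ (flat P ++ Y ++ HH) lo ≡⟨ trans (∑-++ lo (flat P) (Y ++ HH)) (cong (∑ (flat P) lo +_) (∑-++ lo Y HH)) ⟩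
              ∑ (flat P) lo + (∑ Y lo + ∑ HH lo) ≡⟨ cong₂ _+_ (third-low P P-edge P-lo) (trans (cong₂ _+_ (∑-ones lo Y-lo) (∑-zeros lo H-hi)) (+-identityʳ _)) ⟩
              length P + length Y     ∎
              where open ≤-Reasoning
          sum : d r + d r′ ≤ (length P * 3 + suc (suc (length H′))) * ((length P * 3 + suc (suc (length H′))) * 2) + 2 * (length P * (2 * length Y + 2))
          sum = begin
            d r + d r′     ≡⟨ trans (∑-cong vs (λ p → ∑-+ (E r p) (E r′ p) vs)) (∑-+ (λ p → ∑ vs (E r p)) (λ p → ∑ vs (E r′ p)) vs) ⟨
            ∑∑ vs F        ≡⟨ trans (∑-cong vs (λ p → ∑-↭ (F p) σ)) (∑-↭ _ σ) ⟩
            ∑∑ (Q ++ Y) F  ≡⟨ ∑∑-++ F (λ p q → cong₂ _+_ (E₂₃ r p q) (E₂₃ r′ p q)) Q Y ⟩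
            ∑∑ Q F + 2 * ∑ Q (λ p → ∑ Y (F p)) + ∑∑ Y F ≡⟨ trans (cong (∑∑ Q F + 2 * ∑ Q (λ p → ∑ Y (F p)) +_) YY) (+-identityʳ _) ⟩
            ∑∑ Q F + 2 * ∑ Q (λ p → ∑ Y (F p))
              ≡⟨ cong (λ z → ∑∑ Q F + 2 * z) (trans (∑-++ _ (flat P) HH) (trans (cong (∑ (flat P) (λ p → ∑ Y (F p)) +_) HY) (+-identityʳ _))) ⟩
            ∑∑ Q F + 2 * ∑ (flat P) (λ p → ∑ Y (F p))
              ≤⟨ +-mono-≤ (≤-trans (∑-≤-const Q _ (λ {p} _ → ∑-≤-const Q 2 (λ {q} _ → +-mono-≤ (E≤1 r p q) (E≤1 r′ p q))))
                   (≤-reflexive (cong (λ z → z * (z * 2)) (trans (length-++ (flat P)) (cong (_+ suc (suc (length H′))) (length-flat P))))))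
                 (*-monoʳ-≤ 2 (≤-trans (≤-reflexive (∑-flat _ P)) (∑-≤-const P _ (λ {e} i → let P′ , pP = ∈⇒↭ i in eY e P′ pP)))) ⟩
            (length P * 3 + suc (suc (length H′))) * ((length P * 3 + suc (suc (length H′))) * 2) + 2 * (length P * (2 * length Y + 2)) ∎
            where
            open ≤-Reasoning
            Q = flat P ++ HH

∑<⇒zero : ∀ {A : Set} (f : A → ℕ) xs → ∑ xs f < length xs → ∃ λ x → x ∈ xs × f x ≡ 0
∑<⇒zero f (x ∷ xs) lt with f x in eq
... | zero = x , here refl , eq
... | suc k with ∑<⇒zero f xs (≤-trans (s≤s (m≤n+m _ k)) (s≤s⁻¹ lt))
...   | y , i , e = y , there i , e

-- Descent on the number of triples still missing, then on the measure of the remainder.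
optimum : ∀ {A B : Set} (Good : List A → B → Set) (μ : B → ℕ) m → (∀ M L → Good M L → length M ≤ m) →
  (∀ M L → Good M L → (∀ M′ L′ → Good M′ L′ → length M′ ≡ suc (length M) → ⊥) →
    (∀ M′ L′ → Good M′ L′ → length M′ ≡ length M → μ L′ < μ L → ⊥) → ⊥) → ∀ M L → Good M L → ⊥
optimum Good μ m bound step M L good = go (suc m ∸ length M) M L good refl (suc (μ L)) ≤-refl
  where
  go : ∀ k M L → Good M L → suc m ∸ length M ≡ k → ∀ j → μ L < j → ⊥
  go zero M L g eq j lt = 1+n≰n (≤-trans (m∸n≡0⇒m≤n eq) (bound M L g))
  go (suc k) M L g eq (suc j) lt = step M L g
    (λ M′ L′ g′ len → go k M′ L′ g′
      (trans (cong (suc m ∸_) len) (trans (sym (pred[m∸n]≡m∸[1+n] (suc m) (length M))) (cong pred eq))) (suc (μ L′)) ≤-refl)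
    (λ M′ L′ g′ len lt′ → go (suc k) M′ L′ g′ (trans (cong (suc m ∸_) len) eq) j (≤-trans lt′ (s≤s⁻¹ lt)))

-- At most 2 m + τ high vertices.

module Near (G : Hypergraph) (m : ℕ) where

  open Hypergraph G

  open Setting G m

  module Normalize (g : ℕ) (degree-sum : ∀ u v w → E u v w ≡ 1 → 4 * (m * n) + 2 ≤ d u + d v + 4 * m) where

    open Low g degree-sum
    open LowVertex G lo lo≤1 lolo

    normalize : ∀ M → All Edge M → ∃ λ M′ → flat M ↭ flat M′ × length M ≡ length M′ × All Edge M′ × All Normal M′
    normalize [] [] = [] , ↭-refl , refl , [] , []
    normalize ((a , b , c) ∷ M) (e ∷ es) with normalize M es
    ... | M′ , p , l , es′ , ns with lo a in la | lo≤1 a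
    ...   | 1 | _ = (b , c , a) ∷ M′ ,
              ↭-trans (++⁺ˡ (a ∷ b ∷ c ∷ []) p) (++⁺ʳ (flat M′) (permBy (a ∷ b ∷ c ∷ []) (1F ∷ 2F ∷ 0F ∷ []))) , cong suc l ,
              trans (E₂₃ b c a) (trans (E₁₂ b a c) e) ∷ es′ , (lolo″ la e , lolo′ la e) ∷ ns
    ...   | suc (suc _) | s≤s ()
    ...   | 0 | _ with lo b in lb | lo≤1 b
    ...     | 0 | _ = (a , b , c) ∷ M′ , ++⁺ˡ (a ∷ b ∷ c ∷ []) p , cong suc l , e ∷ es′ , (la , lb) ∷ ns
    ...     | suc (suc _) | s≤s ()
    ...     | 1 | _ = (a , c , b) ∷ M′ , ↭-trans (++⁺ˡ (a ∷ b ∷ c ∷ []) p) (prep a (swap b c ↭-refl)) , cong suc l ,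
                trans (E₂₃ a c b) e ∷ es′ , (la , lolo′ lb (trans (E₁₂ b a c) e)) ∷ ns

  module _ (degree-sum : ∀ u v w → E u v w ≡ 1 → 4 * (m * n) + 2 ≤ d u + d v + 4 * m)
    (no-matching : ∀ M L → All Edge M → Part M [] L → length M ≡ suc m → ⊥)
    (τ : ℕ) (τ-small : τ * 100 ≤ m) (m-large : 1000 ≤ m) (n-large : 3 * m + 3 ≤ n) where

    open Low 0 degree-sum
    open LowVertex G lo lo≤1 lolo
    open Normalize 0 degree-sum

    module _ (W U : List V) (WU : vs ↭ W ++ U) (W-lo : All (λ v → lo v ≡ 1) W) (U-hi : All (λ v → lo v ≡ 0) U)
      (few-high : length U ≤ 2 * m + τ) where

      open Sizes W U WU W-lo U-hi

      private
        η = length U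

      -- A high vertex without low neighbours would have degree at most η², about 4 m², whereas high
      -- degrees start near 2 m n ≥ 6 m². A low neighbour takes at most η² of the degree sum.
      high-bound : ∀ u → lo u ≡ 0 → 4 * (m * n) + 2 ≤ d u + η * η + 4 * m
      high-bound u hi = ≮⇒≥ λ lt → 1+n≰n (polyle (d u ∷ η ∷ m ∷ n ∷ τ ∷ [])
          ((var 0 :+ var 1 , var 1 :* var 1 , con 100) ∷
           (con 1 :+ con 2 :* (var 2 :* var 3) , var 0 :+ con 0 :+ con 2 :* var 2 , con 100) ∷
           (var 1 , con 2 :* var 2 :+ var 4 , con 100 :* (var 1 :+ con 2 :* var 2 :+ var 4)) ∷
           (var 4 :* con 100 , var 2 , con 4 :* var 2 :+ var 4) ∷
           (var 4 :* con 100 , var 2 , var 2) ∷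
           (con 3 :* var 2 :+ con 3 , var 3 , con 200 :* var 2) ∷ [])
          (con 1) (con 0)
          (no-low-neighbour u (λ v w w-lo e → 1+n≰n (polyle (d u ∷ d w ∷ η ∷ m ∷ m * n ∷ [])
             ((con 1 :+ (var 0 :+ var 2 :* var 2 :+ con 4 :* var 3) , con 4 :* var 4 :+ con 2 , con 1) ∷
              (con 4 :* var 4 :+ con 2 , var 0 :+ var 1 :+ con 4 :* var 3 , con 1) ∷
              (var 1 :+ var 2 , var 2 :* var 2 , con 1) ∷ [])
             (con 1) (con 0) (lt , degree-sum u w v (trans (E₂₃ u w v) e) , low-degree w-lo , tt))) ,
           hi-< hi , few-high , τ-small , τ-small , n-large , tt))

      low-bound : ∀ w → lo w ≡ 1 → 4 * (m * n) + η * η ≤ d w + 2 * (η * n) + 4 * m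
      low-bound w w-lo = polyle (d w ∷ d u ∷ η ∷ m ∷ n ∷ [])
          ((var 1 :+ var 2 :* var 2 :+ var 2 :+ con 2 :* var 4 , con 2 :* (var 2 :* var 4) :+ con 2 , con 1) ∷
           (con 4 :* (var 3 :* var 4) :+ con 2 , var 0 :+ var 1 :+ con 4 :* var 3 , con 1) ∷ [])
          (con 4 :* (var 3 :* var 4) :+ var 2 :* var 2) (var 0 :+ con 2 :* (var 2 :* var 4) :+ con 4 :* var 3)
          (high-degree (lolo″ w-lo e) , degree-sum w u b e , tt)
        where
        u = proj₁ (covered w)
        b = proj₁ (proj₂ (covered w))
        e = proj₂ (proj₂ (covered w))

      -- With η close to 2 m, high degrees are at least about 4 m n - 4 m², low ones at least about
      -- 4 m². Even with a low `s` the sum exceeds 6 m n by about 2 m (n - 2 m) ≥ 2 m n / 3, which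
      -- beats 65 n. The 65 is 59 + 6, for `low-degrees` with one uncovered high vertex.
      too-large : ∀ s r r′ → lo r ≡ 0 → lo r′ ≡ 0 → d s + d r + d r′ ≤ 6 * (m * n) + 65 * n → ⊥
      too-large s r r′ hr hr′ le with lo s in ls | lo≤1 s
      ... | 0 | _ = 1+n≰n (polyle (d s ∷ d r ∷ d r′ ∷ η ∷ m ∷ n ∷ τ ∷ [])
            ((var 0 :+ var 1 :+ var 2 , con 6 :* (var 4 :* var 5) :+ con 65 :* var 5 , con 100) ∷
             (con 4 :* (var 4 :* var 5) :+ con 2 , var 0 :+ var 3 :* var 3 :+ con 4 :* var 4 , con 100) ∷
             (con 4 :* (var 4 :* var 5) :+ con 2 , var 1 :+ var 3 :* var 3 :+ con 4 :* var 4 , con 100) ∷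
             (con 4 :* (var 4 :* var 5) :+ con 2 , var 2 :+ var 3 :* var 3 :+ con 4 :* var 4 , con 100) ∷
             (var 3 , con 2 :* var 4 :+ var 6 , con 300 :* (var 3 :+ con 2 :* var 4 :+ var 6)) ∷
             (var 6 :* con 100 , var 4 , con 12 :* var 4 :+ con 3 :* var 6) ∷
             (var 6 :* con 100 , var 4 , var 4) ∷
             (con 3 :* var 4 :+ con 3 , var 5 , con 500 :* var 4) ∷
             (con 1000 , var 4 , con 90 :* var 5) ∷ [])
            (con 1) (con 0) (le , high-bound s ls , high-bound r hr , high-bound r′ hr′ , few-high , τ-small , τ-small , n-large , m-large , tt))
      ... | suc (suc _) | s≤s ()
      ... | 1 | _ = 1+n≰n (polyle (d s ∷ d r ∷ d r′ ∷ η ∷ m ∷ n ∷ τ ∷ [])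
            ((var 0 :+ var 1 :+ var 2 , con 6 :* (var 4 :* var 5) :+ con 65 :* var 5 , con 100) ∷
             (con 4 :* (var 4 :* var 5) :+ var 3 :* var 3 , var 0 :+ con 2 :* (var 3 :* var 5) :+ con 4 :* var 4 , con 100) ∷
             (con 4 :* (var 4 :* var 5) :+ con 2 , var 1 :+ var 3 :* var 3 :+ con 4 :* var 4 , con 100) ∷
             (con 4 :* (var 4 :* var 5) :+ con 2 , var 2 :+ var 3 :* var 3 :+ con 4 :* var 4 , con 100) ∷
             (var 3 , con 2 :* var 4 :+ var 6 , con 100 :* (var 3 :+ con 2 :* var 4 :+ var 6) :+ con 200 :* var 5) ∷
             (var 6 :* con 100 , var 4 , con 4 :* var 4 :+ var 6 :+ con 2 :* var 5) ∷
             (var 6 :* con 100 , var 4 , var 4) ∷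
             (con 3 :* var 4 :+ con 3 , var 5 , con 190 :* var 4) ∷
             (con 1000 , var 4 , con 7 :* var 5 :+ var 4) ∷ [])
            (con 1) (con 0) (le , low-bound s ls , high-bound r hr , high-bound r′ hr′ , few-high , τ-small , τ-small , n-large , m-large , tt))

      private
        Good : List (Tri V) → List V → Set
        Good M L = All Edge M × Part M [] L

        length-≤ : ∀ M L → Good M L → length M ≤ m
        length-≤ M L (e , p) = matching-bound no-matching M L e p

      near-impossible : ⊥
      near-impossible = optimum Good (λ L → ∑ L lo) m length-≤ step [] vs ([] , ↭-refl)
        where
        low : ∀ M L → All Edge M → Part M [] L →
          (∀ M′ L′ → Good M′ L′ → length M′ ≡ length M → ∑ L′ lo < ∑ L lo → ⊥) →
          ∀ Y H → L ↭ Y ++ H → All (λ v → lo v ≡ 1) Y → All (λ v → lo v ≡ 0) H → length H ≤ 1 → ⊥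
        low M L M-edge part better [] H YH _ _ few = 1+n≰n (polyle (length M ∷ length H ∷ m ∷ n ∷ [])
          ((var 3 , var 0 :* con 3 :+ var 1 , con 1) ∷ (var 1 , con 1 , con 1) ∷ (var 0 , var 2 , con 3) ∷
           (con 3 :* var 2 :+ con 3 , var 3 , con 1) ∷ [])
          (con 1) (con 0)
          (≤-reflexive (sym (trans (cong (length M * 3 +_) (sym (↭-length YH))) (length-Part {M} {[]} {L} part))) , few ,
           length-≤ M L (M-edge , part) , n-large , tt))
        low M L M-edge part better (w ∷ Y) H YH (lw ∷ Y-lo) H-hi few with normalize M M-edge
        ... | M′ , M↭ , M≡ , M′-edge , M′-normal with ∑<⇒zero φ M′ φ-few
          where
          -- If all edges had a low vertex, the matching would cover at most 2 m high vertices; with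
          -- at most one uncovered there would be fewer than the 2 m + 2 of `many-high`.
          φ-few : ∑ M′ φ < length M′
          φ-few = polyle (∑ M′ φ ∷ length M′ ∷ length W ∷ length Y ∷ length H ∷ η ∷ m ∷ n ∷ [])
            ((var 2 , var 0 :+ (con 1 :+ var 3) , con 1) ∷ (con 2 :* var 6 :+ con 2 , var 5 , con 1) ∷ (var 2 :+ var 5 , var 7 , con 1) ∷
             (var 7 , var 1 :* con 3 :+ (con 1 :+ var 3 :+ var 4) , con 1) ∷ (var 4 , con 1 , con 1) ∷ (var 1 , var 6 , con 2) ∷
             (var 0 :+ (con 1 :+ var 3) , var 2 , con 2) ∷ [])
            (con 1 :+ var 0) (var 1)
            (≤-reflexive (sym lows) , many-high lw , ≤-reflexive (sym length-WU) ,
             ≤-reflexive (sym (trans (cong₂ _+_ (cong (_* 3) (sym M≡)) (sym (trans (↭-length YH) (cong suc (length-++ Y))))) (length-Part {M} {[]} {L} part))) ,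
             few , subst (_≤ m) M≡ (length-≤ M L (M-edge , part)) , ≤-reflexive lows , tt)
            where
            lows : ∑ M′ φ + length (w ∷ Y) ≡ length W
            lows = begin
              ∑ M′ φ + length (w ∷ Y)
                ≡⟨ cong₂ _+_ (sym (∑-φ M′ M′-normal)) (sym (trans (trans (∑-↭ lo YH) (∑-++ lo (w ∷ Y) H))
                     (trans (cong₂ _+_ (∑-ones lo (lw ∷ Y-lo)) (∑-zeros lo H-hi)) (+-identityʳ _)))) ⟩
              ∑ (flat M′) lo + ∑ L lo ≡⟨ cong (_+ ∑ L lo) (∑-↭ lo M↭) ⟨
              ∑ (flat M) lo + ∑ L lo  ≡⟨ ∑-++ lo (flat M) L ⟨
              ∑ (flat M ++ L) lo      ≡⟨ ∑-↭ lo part ⟩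
              ∑ vs lo                 ≡⟨ trans (∑-↭ lo WU) (∑-++ lo W U) ⟩
              ∑ W lo + ∑ U lo         ≡⟨ cong₂ _+_ (∑-ones lo W-lo) (∑-zeros lo U-hi) ⟩
              length W + 0            ≡⟨ +-identityʳ _ ⟩
              length W                ∎
              where open ≡-Reasoning
        ...   | (x , y , z) , i , φ0 with ∈⇒↭ i
        ...     | M₂ , p with All-resp-↭ p M′-edge | All-resp-↭ p M′-normal
        ...       | _ ∷ M₂-edge | (lx , ly) ∷ M₂-normal = too-large w x y lx ly (begin
            d w + d x + d y ≤⟨ m≤m+n _ _ ⟩
            d w + d x + d y + ∑ M₂ φ * (∑ M₂ φ * 2)
              ≤⟨ low-degrees [] M₂ w Y H x y z M₂-edge M₂-normal lw Y-lo lx ly φ0 σ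
                 (λ M″ L″ e p len lt → better M″ L″ (e , p) (trans len (sym M₂-len)) (<-≤-trans lt (≤-reflexive (sym (∑-↭ lo YH))))) ⟩
            6 * (length M₂ * n) + (6 * (0 + length H) + 59) * n
              ≤⟨ polyle (length M₂ ∷ m ∷ n ∷ length H ∷ [])
                   ((con 1 :+ var 0 , var 1 , con 6 :* var 2) ∷ (var 3 , con 1 , con 6 :* var 2) ∷ [])
                   (con 6 :* (var 0 :* var 2) :+ (con 6 :* (con 0 :+ var 3) :+ con 59) :* var 2) (con 6 :* (var 1 :* var 2) :+ con 65 :* var 2)
                   (subst (_≤ m) M₂-len (length-≤ M L (M-edge , part)) , few , tt) ⟩
            6 * (m * n) + 65 * n ∎)
          where
          open ≤-Reasoning
          M₂-len : length M ≡ suc (length M₂)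
          M₂-len = trans M≡ (↭-length p)
          σ : Part ((x , y , z) ∷ M₂) [] (w ∷ Y ++ H)
          σ = ↭-trans (++⁺ (↭-trans (flat-↭ (↭-sym p)) (↭-sym M↭)) (↭-sym YH)) part
        step : ∀ M L → Good M L → (∀ M′ L′ → Good M′ L′ → length M′ ≡ suc (length M) → ⊥) →
          (∀ M′ L′ → Good M′ L′ → length M′ ≡ length M → ∑ L′ lo < ∑ L lo → ⊥) → ⊥
        step M L (M-edge , part) bigger better with partition lo lo≤1 L
        ... | Y , r ∷ r′ ∷ H , YH , Y-lo , hr ∷ hr′ ∷ H-hi = third (Y ++ H) refl
          where
          L↭ : L ↭ r ∷ r′ ∷ Y ++ H
          L↭ = ↭-trans YH (shifts Y (r ∷ r′ ∷ []))
          third : ∀ L′ → L′ ≡ Y ++ H → ⊥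
          third [] eq = 1+n≰n (polyle (length M ∷ m ∷ n ∷ [])
            ((var 0 :* con 3 :+ con 2 , var 2 , con 0) ∷ (var 2 , var 0 :* con 3 :+ con 2 , con 1) ∷ (var 0 , var 1 , con 3) ∷
             (con 3 :* var 1 :+ con 3 , var 2 , con 1) ∷ []) (con 1) (con 0)
            (≤-reflexive size , ≤-reflexive (sym size) , length-≤ M L (M-edge , part) , n-large , tt))
            where
            size : length M * 3 + 2 ≡ n
            size = trans (cong (length M * 3 +_) (sym (trans (↭-length L↭) (cong (λ z → suc (suc (length z))) (sym eq)))))
              (length-Part {M} {[]} {L} part)
          third (s ∷ L′) eq = too-large s r r′ hr hr′ (begin
            d s + d r + d r′ ≤⟨ three-degrees [] M L′ s r r′ M-edge (↭-trans (++⁺ˡ (flat M) (↭-sym σ)) part) (λ M′ L′ e p → bigger M′ L′ (e , p)) ⟩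
            6 * (length M * n) + (6 * 0 + 57) * n
              ≤⟨ polyle (length M ∷ m ∷ n ∷ []) ((var 0 , var 1 , con 6 :* var 2) ∷ [])
                 (con 6 :* (var 0 :* var 2) :+ (con 6 :* con 0 :+ con 57) :* var 2) (con 6 :* (var 1 :* var 2) :+ con 65 :* var 2)
                 (length-≤ M L (M-edge , part) , tt) ⟩
            6 * (m * n) + 65 * n ∎)
            where
            open ≤-Reasoning
            σ : L ↭ s ∷ r ∷ r′ ∷ L′
            σ = ↭-trans L↭ (↭-trans (↭-reflexive (cong (λ z → r ∷ r′ ∷ z) (sym eq))) (shift s (r ∷ r′ ∷ []) L′))
        ... | Y , [] , YH , Y-lo , H-hi = low M L M-edge part better Y [] YH Y-lo H-hi z≤n
        ... | Y , h ∷ [] , YH , Y-lo , H-hi = low M L M-edge part better Y (h ∷ []) YH Y-lo H-hi ≤-refl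

-- More than 2 m + τ high vertices.

module Far (G : Hypergraph) (m : ℕ) where

  open Hypergraph G

  open Setting G m
  open Near G m using (module Normalize)

  module _ (g : ℕ) (degree-sum : ∀ u v w → E u v w ≡ 1 → 4 * (m * n) + 2 ≤ d u + d v + 4 * m)
    (no-matching : ∀ M L → All Edge M → Part M [] L → length M ≡ suc m → ⊥)
    (n-large : 3 * m + 3 ≤ n) where

    open Low g degree-sum
    open LowVertex G lo lo≤1 lolo
    open Normalize g degree-sum

    Tail-lo : Tri V → Set
    Tail-lo t = φ t ≡ 1

    -- The numerical conditions belong to one step each: `c₁` to four uncovered high vertices
    -- (`three-high`), `c₂` and `c₃` to an uncovered low vertex adjacent to an edge without low
    -- vertices (`adjacent-large`, `adjacent-small`), `c₄` to `many-unlow` and `c₅` to the final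
    -- count in `low-left`.
    record Setup : Set where
      field
        A : List (Tri V)
        A-edge : All Edge A
        absorb : ∀ M x y z → All Edge M → lo x ≡ 0 → lo y ≡ 0 → lo z ≡ 0 → Part M (flat A) (x ∷ y ∷ z ∷ []) → ⊥
        W U : List V
        WU : vs ↭ W ++ U
        W-lo : All (λ v → lo v ≡ 1) W
        U-hi : All (λ v → lo v ≡ 0) U
        κ τ : ℕ
        many-high : 2 * m + τ < length U
        c₁ : 12 * g + 24 * m + (72 * (κ + length A) + 220) * n < m * m
        c₂ : g + 6 * m + (18 * length A + 77) * n < 2 * (κ * κ)
        c₃ : (12 * (κ + length A) + 22) * n ≤ m * n
        c₄ : 2 * (length A + 3) ≤ τ
        c₅ : (12 * length A + 16) * n * 4 ≤ 3 * (τ * τ)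

    module _ (S : Setup) where

      open Setup S

      private
        X = flat A
        a = length A

        X-length : length X ≡ a * 3
        X-length = length-flat A

        lo-count : ∀ M L → Part M X L → ∑ (flat M) lo + (∑ X lo + ∑ L lo) ≡ ∑ vs lo
        lo-count M L p = trans (sym (trans (∑-++ lo (flat M) (X ++ L)) (cong (∑ (flat M) lo +_) (∑-++ lo X L)))) (∑-↭ lo p)

        ∑-flat-low : ∀ M → All Normal M → All Tail-lo M → ∑ (flat M) lo ≡ length M
        ∑-flat-low M ns ls = trans (∑-φ M ns) (∑-ones φ ls)

        lows-normal : ∀ P → All Edge P → All Tail-lo P → All Normal P
        lows-normal [] _ _ = []
        lows-normal ((u , v , w) ∷ P) (e ∷ es) (l ∷ ls) =
          (lolo″ l e′ , lolo′ l e′) ∷ lows-normal P es ls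
          where
          e′ : E w u v ≡ 1
          e′ = trans (E₁₂ w u v) (trans (E₂₃ u w v) e)

        size-bound : ∀ M L → All Edge M → Part M X L → length M + a ≤ m
        size-bound M L es p = ≤-trans (≤-reflexive (sym (length-++ M))) (matching-bound no-matching (M ++ A) L (All.++⁺ es A-edge)
          (↭-trans (↭-reflexive (trans (cong (_++ L) (flat-++ M A)) (++-assoc (flat M) X L))) p))

      -- Either `P` is large enough for a gain of 2 κ², or no family of edges with low vertices has
      -- one edge more. Both alternatives prevent low uncovered vertices from being adjacent to
      -- edges without low vertices.
      record Start : Set where
        field
          P : List (Tri V)
          L₀ : List V
          P-edge : All Edge P
          P-lo : All Tail-lo P
          P-part : Part P X L₀
          P≤κ : length P ≤ κ
          alt : κ ≤ length P ⊎ (∀ P′ L′ → All Edge P′ → All Tail-lo P′ → Part P′ X L′ → length P′ ≡ suc (length P) → ⊥)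

      module Core (start : Start) where

        open Start start

        -- The last condition says that at least |P| low vertices are covered. As an edge has at
        -- most one of them, the matching keeps at least |P| edges with a low vertex (`P≤k`).
        Good : List (Tri V) → List V → Set
        Good M L = All Edge M × Part M X L × ∑ L lo ≤ ∑ L₀ lo

        private
          P-count : ∑ (flat P) lo ≡ length P
          P-count = ∑-flat-low P (lows-normal P P-edge P-lo) P-lo

          allowed : ∀ M L → Part M X L → length P ≤ ∑ (flat M) lo → ∑ L lo ≤ ∑ L₀ lo
          allowed M L p le = polyle (length P ∷ ∑ (flat M) lo ∷ ∑ X lo ∷ ∑ L lo ∷ ∑ L₀ lo ∷ [])
            ((var 0 , var 1 , con 1) ∷ (var 1 :+ (var 2 :+ var 3) , var 0 :+ (var 2 :+ var 4) , con 1) ∷ []) (var 3) (var 4)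
            (le , ≤-reflexive (trans (lo-count M L p) (sym (trans (cong (_+ (∑ X lo + ∑ L₀ lo)) (sym P-count)) (lo-count P L₀ P-part)))) , tt)

        record Optimum : Set where
          field
            M₁ M₀ : List (Tri V)
            Y H : List V
            M₁-edge : All Edge M₁
            M₀-edge : All Edge M₀
            M₁-normal : All Normal M₁
            M₀-normal : All Normal M₀
            M₁-lo : All Tail-lo M₁
            M₀-hi : All (λ t → φ t ≡ 0) M₀
            Y-lo : All (λ v → lo v ≡ 1) Y
            H-hi : All (λ v → lo v ≡ 0) H
            part : Part (M₁ ++ M₀) X (Y ++ H)
            allow : ∑ (Y ++ H) lo ≤ ∑ L₀ lo
            bigger : ∀ M′ L′ → Good M′ L′ → length M′ ≡ suc (length (M₁ ++ M₀)) → ⊥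
            better : ∀ M′ L′ → Good M′ L′ → length M′ ≡ length (M₁ ++ M₀) → ∑ L′ lo < ∑ (Y ++ H) lo → ⊥

        module Step (optimal : Optimum) where

          open Optimum optimal

          private
            M = M₁ ++ M₀
            k = length M₁
            t = length M₀

            M-edge : All Edge M
            M-edge = All.++⁺ M₁-edge M₀-edge

            M-normal : All Normal M
            M-normal = All.++⁺ M₁-normal M₀-normal

            ∑φ : ∑ M φ ≡ k
            ∑φ = trans (∑-++ φ M₁ M₀) (trans (cong₂ _+_ (∑-ones φ M₁-lo) (∑-zeros φ M₀-hi)) (+-identityʳ _))

            M-count : ∑ (flat M) lo ≡ k
            M-count = trans (∑-φ M M-normal) ∑φ

            M-size : k + t + a ≤ m
            M-size = ≤-trans (≤-reflexive (cong (_+ a) (sym (length-++ M₁)))) (size-bound M (Y ++ H) M-edge part)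

            total-size : (k + t) * 3 + (a * 3 + (length Y + length H)) ≡ n
            total-size = trans (cong₂ _+_ (cong (_* 3) (sym (length-++ M₁))) (cong₂ _+_ (sym X-length) (sym (length-++ Y)))) (length-Part {M} {X} part)

            P≤k : length P ≤ k
            P≤k = polyle (length P ∷ k ∷ ∑ X lo ∷ ∑ (Y ++ H) lo ∷ ∑ L₀ lo ∷ [])
              ((var 3 , var 4 , con 1) ∷ (var 0 :+ (var 2 :+ var 4) , var 1 :+ (var 2 :+ var 3) , con 1) ∷ []) (var 0) (var 1)
              (allow , ≤-reflexive (trans (trans (cong (_+ (∑ X lo + ∑ L₀ lo)) (sym P-count)) (lo-count P L₀ P-part))
                (sym (trans (cong (_+ (∑ X lo + ∑ (Y ++ H) lo)) (sym M-count)) (lo-count M (Y ++ H) part)))) , tt)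

            -- The first low edges are locked, so that the constraint on the low vertices stays satisfied.
            N₀ M₂ : List (Tri V)
            N₀ = take (length P) M₁
            M₂ = drop (length P) M₁ ++ M₀

            N₀-length : length N₀ ≡ length P
            N₀-length = trans (length-take (length P) M₁) (m≤n⇒m⊓n≡m P≤k)

            M-split : M ≡ N₀ ++ M₂
            M-split = trans (cong (_++ M₀) (sym (take++drop≡id (length P) M₁))) (++-assoc N₀ _ M₀)

            M-length : length M ≡ length P + length M₂
            M-length = trans (cong length M-split) (trans (length-++ N₀) (cong (_+ length M₂) N₀-length))

            relock : ∀ M′ L′ → flat M′ ++ (flat N₀ ++ X) ++ L′ ≡ flat M′ ++ flat N₀ ++ X ++ L′
            relock M′ L′ = cong (flat M′ ++_) (++-assoc (flat N₀) X L′)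

            locked-part : ∀ M′ L′ → Part M′ (flat N₀ ++ X) L′ → Part (N₀ ++ M′) X L′
            locked-part M′ L′ p = ↭-trans (↭-trans (↭-reflexive (trans (cong (_++ X ++ L′) (flat-++ N₀ M′)) (++-assoc (flat N₀) (flat M′) _)))
              (↭-trans (shifts (flat N₀) (flat M′)) (↭-reflexive (sym (relock M′ L′))))) p

          -- `four-degrees` is applied to the edges outside the locked `N₀`, so that enlarged
          -- matchings still satisfy the constraint. If there are m - j such edges, the term 24 j n
          -- saved in the main term makes up for the smaller square, and `c₁` compares m² with the
          -- errors.
          three-high : length H ≤ 3
          three-high = ≮⇒≥ (λ lt → go H refl lt)
            where
            go : ∀ H′ → H ≡ H′ → 3 < length H′ → ⊥
            go (x₀ ∷ x₁ ∷ x₂ ∷ x₃ ∷ H′) eq _ = 1+n≰n (polyle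
                (d x₀ + d x₁ + d x₂ + d x₃ ∷ length M₂ ∷ length (flat N₀ ++ X) ∷ n ∷ m ∷ g ∷ length P ∷ a ∷ j ∷ d x₀ ∷ d x₁ ∷ d x₂ ∷ d x₃ ∷ κ ∷ [])
                ((con 3 :* var 0 :+ var 1 :* var 1 , con 24 :* (var 1 :* var 3) :+ (con 24 :* var 2 :+ con 220) :* var 3 , con 1) ∷
                 (con 1 :+ (con 12 :* var 5 :+ con 24 :* var 4 :+ (con 72 :* (var 13 :+ var 7) :+ con 220) :* var 3) , var 4 :* var 4 , con 1) ∷
                 (con 1 :+ con 2 :* (var 4 :* var 3) , var 9 :+ var 5 :+ con 2 :* var 4 , con 3) ∷
                 (con 1 :+ con 2 :* (var 4 :* var 3) , var 10 :+ var 5 :+ con 2 :* var 4 , con 3) ∷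
                 (con 1 :+ con 2 :* (var 4 :* var 3) , var 11 :+ var 5 :+ con 2 :* var 4 , con 3) ∷
                 (con 1 :+ con 2 :* (var 4 :* var 3) , var 12 :+ var 5 :+ con 2 :* var 4 , con 3) ∷
                 (var 9 :+ var 10 :+ var 11 :+ var 12 , var 0 , con 3) ∷
                 (var 2 , var 6 :* con 3 :+ var 7 :* con 3 , con 24 :* var 3) ∷
                 (var 6 , var 13 , con 72 :* var 3) ∷
                 (var 4 , var 1 :+ var 8 , var 4 :+ var 1 :+ var 8) ∷
                 (var 1 :+ var 8 , var 4 , con 24 :* var 3) ∷
                 (con 3 :* var 4 :+ con 3 , var 3 , con 2 :* var 8) ∷
                 (var 1 :+ var 8 , var 4 , con 6 :* var 8) ∷ [])
                (con 1) (con 0)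
                (Four.four-degrees G x (flat N₀ ++ X) M₂ (Y ++ H′) M₂-edge part′ max , c₁ ,
                 hi-< h₀ , hi-< h₁ , hi-< h₂ , hi-< h₃ , ≤-refl ,
                 ≤-reflexive (trans (length-++ (flat N₀)) (cong₂ _+_ (trans (length-flat N₀) (cong (_* 3) N₀-length)) X-length)) ,
                 P≤κ , ≤-reflexive (sym M₂j) , ≤-reflexive M₂j , n-large , ≤-reflexive M₂j , tt))
              where
              x : Fin 4 → V
              x = lookup (x₀ ∷ x₁ ∷ x₂ ∷ x₃ ∷ [])
              hs : All (λ v → lo v ≡ 0) (x₀ ∷ x₁ ∷ x₂ ∷ x₃ ∷ H′)
              hs = subst (All (λ v → lo v ≡ 0)) eq H-hi
              h₀ = All.head hs
              h₁ = All.head (All.tail hs)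
              h₂ = All.head (All.tail (All.tail hs))
              h₃ = All.head (All.tail (All.tail (All.tail hs)))
              j = m ∸ length M₂
              M₂j : length M₂ + j ≡ m
              M₂j = m+[n∸m]≡n (≤-trans (≤-trans (m≤n+m _ (length P)) (≤-reflexive (trans (sym M-length) (length-++ M₁)))) (≤-trans (m≤m+n _ a) M-size))
              M₂-edge : All Edge M₂
              M₂-edge = All.++⁺ (All.drop⁺ (length P) M₁-edge) M₀-edge
              part′ : Part M₂ (flat N₀ ++ X) (x₀ ∷ x₁ ∷ x₂ ∷ x₃ ∷ Y ++ H′)
              part′ = ↭-trans (↭-reflexive (relock M₂ _)) (↭-trans (shifts (flat M₂) (flat N₀)) (↭-trans
                (↭-trans (↭-reflexive (trans (sym (++-assoc (flat N₀) (flat M₂) _)) (cong (_++ X ++ x₀ ∷ x₁ ∷ x₂ ∷ x₃ ∷ Y ++ H′)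
                  (trans (sym (flat-++ N₀ M₂)) (cong flat (sym M-split))))))
                  (++⁺ˡ (flat M) (++⁺ˡ X (↭-trans (shifts (x₀ ∷ x₁ ∷ x₂ ∷ x₃ ∷ []) Y) (↭-reflexive (cong (Y ++_) (sym eq))))))) part))
              max : Maximal M₂ (flat N₀ ++ X)
              max M′ L′ es p len = bigger (N₀ ++ M′) L′ (All.++⁺ (All.take⁺ (length P) M₁-edge) es , p′ ,
                  allowed (N₀ ++ M′) L′ p′ (≤-trans (≤-reflexive (sym (trans (∑-flat-low N₀ (All.take⁺ (length P) M₁-normal) (All.take⁺ (length P) M₁-lo)) N₀-length)))
                    (≤-trans (m≤m+n _ _) (≤-reflexive (sym (trans (cong (λ z → ∑ z lo) (flat-++ N₀ M′)) (∑-++ lo (flat N₀) (flat M′))))))))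
                (trans (length-++ N₀) (trans (cong₂ _+_ N₀-length len) (trans (+-suc _ _) (cong suc (sym M-length)))))
                where
                p′ = locked-part M′ L′ p
            go (_ ∷ _ ∷ _ ∷ []) _ (s≤s (s≤s (s≤s ())))
            go (_ ∷ _ ∷ []) _ (s≤s (s≤s ()))
            go (_ ∷ []) _ (s≤s ())

          few-left : length H ≤ 2 → Y ≡ [] → ⊥
          few-left le Y≡ = 1+n≰n (polyle (k ∷ t ∷ a ∷ length Y ∷ length H ∷ m ∷ n ∷ [])
            ((var 6 , (var 0 :+ var 1) :* con 3 :+ (var 2 :* con 3 :+ (var 3 :+ var 4)) , con 1) ∷ (var 0 :+ var 1 :+ var 2 , var 5 , con 3) ∷
             (con 3 :* var 5 :+ con 3 , var 6 , con 1) ∷ (var 4 , con 2 , con 1) ∷ (var 3 , con 0 , con 1) ∷ [])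
            (con 1) (con 0) (≤-reflexive (sym total-size) , M-size , n-large , le , ≤-reflexive (cong length Y≡) , tt))

          no-low-left : ∀ H′ → H ≡ H′ → Y ≡ [] → ⊥
          no-low-left (x ∷ y ∷ z ∷ []) eq Y≡ = absorb M x y z M-edge (All.head hs) (All.head (All.tail hs)) (All.head (All.tail (All.tail hs)))
            (↭-trans (↭-reflexive (cong (λ w → flat M ++ X ++ w) (sym (trans (cong (_++ H) Y≡) eq)))) part)
            where
            hs : All (λ v → lo v ≡ 0) (x ∷ y ∷ z ∷ [])
            hs = subst (All (λ v → lo v ≡ 0)) eq H-hi
          no-low-left (x ∷ y ∷ z ∷ w ∷ H′) eq Y≡ = 1+n≰n (polyle (length H′ ∷ []) ((con 4 :+ var 0 , con 3 , con 1) ∷ []) (con 1) (con 0)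
            (≤-trans (≤-reflexive (cong length (sym eq))) three-high , tt))
          no-low-left [] eq Y≡ = few-left (≤-trans (≤-reflexive (cong length eq)) z≤n) Y≡
          no-low-left (x ∷ []) eq Y≡ = few-left (≤-trans (≤-reflexive (cong length eq)) (s≤s z≤n)) Y≡
          no-low-left (x ∷ y ∷ []) eq Y≡ = few-left (≤-reflexive (cong length eq)) Y≡

          private
            M₀-vertices : ∀ {e} → e ∈ M₀ → All (λ v → lo v ≡ 0) (vx e)
            M₀-vertices {e} i = let p , q = All.lookup M₀-normal i in p ∷ q ∷ All.lookup M₀-hi i ∷ []

            ∈-flat : ∀ (ts : List (Tri V)) {v} → v ∈ flat ts → ∃ λ t → t ∈ ts × v ∈ vx t
            ∈-flat (t ∷ ts) i with Any.++⁻ (vx t) i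
            ... | inj₁ j = t , here refl , j
            ... | inj₂ j = let u , p , q = ∈-flat ts j in u , there p , q

            zero-of : ∀ {u v w} → (E u v w ≡ 1 → ⊥) → E u v w ≡ 0
            zero-of {u} {v} {w} h = n≤0⇒n≡0 (bit-0 (E≤1 u v w) h)

          -- The edge w r v bounds d w + d r from below by about 4 m n, and the high vertex `y` adds
          -- nearly 2 m n. So the left side of `low-degrees` reaches 6 m n + 2 κ² up to the errors
          -- compared in `c₂`, where 77 = 59 + 6 · 3.
          adjacent-large : ∀ {w r v} → κ ≤ length P → w ∈ Y → r ∈ flat M₀ → E w r v ≡ 1 → ⊥
          adjacent-large {w} {r} {v} κ≤P iw ir e = go (∈-flat M₀ ir) (∈⇒↭ iw)
            where
            go : (∃ λ t → t ∈ M₀ × r ∈ vx t) → (∃ λ Y′ → Y ↭ w ∷ Y′) → ⊥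
            go (e₀ , i₀ , ir₀) (Y′ , pY) = go′ (∈⇒↭ i₀) (∈⇒↭ ir₀)
              where
              go′ : (∃ λ M₀′ → M₀ ↭ e₀ ∷ M₀′) → (∃ λ q → vx e₀ ↭ r ∷ q) → ⊥
              go′ (M₀′ , pM) (y ∷ z ∷ [] , pr) = 1+n≰n (polyle
                  (d w ∷ d r ∷ d y ∷ k ∷ length M′ ∷ length X ∷ length H ∷ n ∷ m ∷ g ∷ a ∷ κ ∷ ∑ M′ φ ∷ [])
                  ((var 0 :+ var 1 :+ var 2 :+ var 12 :* (var 12 :* con 2) , con 6 :* (var 4 :* var 7) :+ (con 6 :* (var 5 :+ var 6) :+ con 59) :* var 7 , con 1) ∷
                   (con 4 :* (var 8 :* var 7) :+ con 2 , var 0 :+ var 1 :+ con 4 :* var 8 , con 1) ∷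
                   (con 1 :+ con 2 :* (var 8 :* var 7) , var 2 :+ var 9 :+ con 2 :* var 8 , con 1) ∷
                   (var 5 , var 10 :* con 3 , con 6 :* var 7) ∷ (var 6 , con 3 , con 6 :* var 7) ∷ (var 4 , var 8 , con 6 :* var 7) ∷
                   (var 11 , var 12 , con 2 :* var 11 :+ con 2 :* var 12) ∷
                   (con 1 :+ (var 9 :+ con 6 :* var 8 :+ (con 18 :* var 10 :+ con 77) :* var 7) , con 2 :* (var 11 :* var 11) , con 1) ∷ [])
                  (con 1) (con 0)
                  (low-degrees X M′ w Y′ H r y z M′-edge M′-normal (All.head Y′-lo) (All.tail Y′-lo)
                     (All.head hs) (All.head (All.tail hs)) (All.head (All.tail (All.tail hs))) part′ opt ,
                   degree-sum w r v e , hi-< (All.head (All.tail hs)) , ≤-reflexive X-length , three-high , M′≤m ,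
                   ≤-trans κ≤P (≤-trans P≤k (≤-reflexive (sym ∑φ′))) , c₂ , tt))
                where
                M′ = M₁ ++ M₀′
                M′-edge = All.++⁺ M₁-edge (All.tail (All-resp-↭ pM M₀-edge))
                M′-normal = All.++⁺ M₁-normal (All.tail (All-resp-↭ pM M₀-normal))
                Y′-lo = All-resp-↭ pY Y-lo
                hs : All (λ v → lo v ≡ 0) (r ∷ y ∷ z ∷ [])
                hs = All-resp-↭ pr (M₀-vertices i₀)
                ∑φ′ : ∑ M′ φ ≡ k
                ∑φ′ = trans (∑-++ φ M₁ M₀′) (trans (cong₂ _+_ (∑-ones φ M₁-lo) (∑-zeros φ (All.tail (All-resp-↭ pM M₀-hi)))) (+-identityʳ _))
                M-perm : M ↭ e₀ ∷ M′
                M-perm = ↭-trans (++⁺ˡ M₁ pM) (shift e₀ M₁ M₀′)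
                M-len : length M ≡ suc (length M′)
                M-len = ↭-length M-perm
                M′≤m : length M′ ≤ m
                M′≤m = ≤-trans (n≤1+n _) (≤-trans (≤-reflexive (trans (sym M-len) (length-++ M₁))) (≤-trans (m≤m+n _ a) M-size))
                part′ : Part ((r , y , z) ∷ M′) X (w ∷ Y′ ++ H)
                part′ = ↭-trans (++⁺ (↭-trans (++⁺ʳ (flat M′) (↭-sym pr)) (flat-↭ (↭-sym M-perm))) (++⁺ˡ X (++⁺ʳ H (↭-sym pY)))) part
                opt : Optimal ((r , y , z) ∷ M′) X (w ∷ Y′ ++ H)
                opt M″ L″ es p len lt = better M″ L″ (es , p , ≤-trans (<⇒≤ lt′) allow) (trans len (sym M-len)) lt′
                  where
                  lt′ : ∑ L″ lo < ∑ (Y ++ H) lo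
                  lt′ = <-≤-trans lt (≤-reflexive (sym (∑-↭ lo (++⁺ʳ H pY))))
              go′ _ ([] , pr) with ↭-length pr
              ... | ()
              go′ _ (_ ∷ [] , pr) with ↭-length pr
              ... | ()
              go′ _ (_ ∷ _ ∷ _ ∷ _ , pr) with ↭-length pr
              ... | ()

          module _ (no-larger : ∀ P′ L′ → All Edge P′ → All Tail-lo P′ → Part P′ X L′ → length P′ ≡ suc (length P) → ⊥) where

            private
              N Z : List V
              N = flat M₂ ++ Y ++ H
              Z = flat N₀ ++ X

              σ : vs ↭ N ++ Z
              σ = ↭-trans (↭-sym part) (↭-trans (↭-reflexive (trans (cong (_++ X ++ Y ++ H) (trans (cong flat M-split) (flat-++ N₀ M₂)))
                (++-assoc (flat N₀) (flat M₂) _))) (↭-trans (++⁺ˡ (flat N₀) (shifts (flat M₂) X))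
                (↭-trans (↭-reflexive (sym (++-assoc (flat N₀) X N))) (++-comm Z N))))

              -- Together with the |P| edges of `N₀`, such an edge would form a family of |P| + 1
              -- disjoint edges with a low vertex.
              no-low-edge : ∀ {u v c} → u ∈ N → v ∈ N → c ∈ N → lo c ≡ 1 → E u v c ≡ 1 → ⊥
              no-low-edge {u} {v} {c} iu iv ic l e =
                let N′ , p = edge-↭ iu iv ic e in
                no-larger ((u , v , c) ∷ N₀) N′ (e ∷ All.take⁺ (length P) M₁-edge) (l ∷ All.take⁺ (length P) M₁-lo)
                  (↭-trans (↭-trans (++⁺ˡ (u ∷ v ∷ c ∷ []) (↭-reflexive (sym (++-assoc (flat N₀) X N′))))
                    (↭-trans (shifts (u ∷ v ∷ c ∷ []) Z) (↭-trans (++⁺ˡ Z (↭-sym p)) (++-comm Z N)))) (↭-sym σ))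
                  (cong suc N₀-length)

              Z-length : length Z ≤ κ * 3 + a * 3
              Z-length = ≤-trans (≤-reflexive (trans (length-++ (flat N₀)) (cong₂ _+_ (trans (length-flat N₀) (cong (_* 3) N₀-length)) X-length)))
                (+-monoˡ-≤ (a * 3) (*-monoˡ-≤ 3 P≤κ))

              split : ∀ x → d x ≤ ∑∑ N (E x) + 2 * (length Z * n * 1)
              split x = ≤-trans (∑∑-split (E x) (E₂₃ x) 1 (E≤1 x) [] N Z σ) ≤-refl

              low-in-N : ∀ w → w ∈ N → lo w ≡ 1 → ∑∑ N (E w) ≡ 0
              low-in-N w iw l = no-edge-inside w N (λ x y r p e →
                no-low-edge (∈-resp-↭ (↭-sym p) (here refl)) (∈-resp-↭ (↭-sym p) (there (here refl))) iw l (E-rot e))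

              parts = partition lo lo≤1 N
              YN = proj₁ parts
              HN = proj₁ (proj₂ parts)
              pN : N ↭ YN ++ HN
              pN = proj₁ (proj₂ (proj₂ parts))
              YN-lo = proj₁ (proj₂ (proj₂ (proj₂ parts)))

              inside : ∀ r → r ∈ N → ∑∑ N (E r) ≤ length HN * (length HN * 1)
              inside r ir = begin
                ∑∑ N (E r) ≡⟨ trans (trans (∑-cong N (λ p → ∑-↭ (E r p) q)) (∑-↭ _ q)) (∑∑-++ (E r) (E₂₃ r) HN YN) ⟩
                ∑∑ HN (E r) + 2 * ∑ HN (λ p → ∑ YN (E r p)) + ∑∑ YN (E r)
                  ≡⟨ cong₂ (λ x y → ∑∑ HN (E r) + 2 * x + y) (z HN (λ i → ∈-resp-↭ (↭-sym q) (Any.++⁺ˡ i))) (z YN inYN) ⟩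
                ∑∑ HN (E r) + 2 * 0 + 0 ≡⟨ trans (+-identityʳ _) (+-identityʳ _) ⟩
                ∑∑ HN (E r) ≤⟨ ∑-≤-const HN _ (λ {p} _ → ∑-≤-const HN 1 (λ {s} _ → E≤1 r p s)) ⟩
                length HN * (length HN * 1) ∎
                where
                open ≤-Reasoning
                q : N ↭ HN ++ YN
                q = ↭-trans pN (++-comm YN HN)
                inYN : ∀ {v} → v ∈ YN → v ∈ N
                inYN i = ∈-resp-↭ (↭-sym pN) (Any.++⁺ˡ i)
                z : ∀ S → (∀ {v} → v ∈ S → v ∈ N) → ∑ S (λ p → ∑ YN (E r p)) ≡ 0
                z S inN = n≤0⇒n≡0 (≤-trans (∑-≤-const S 0 (λ {p} i → ≤-trans (∑-≤-const YN 0 (λ {s} j →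
                  bit-0 (E≤1 r p s) (no-low-edge ir (inN i) (inYN j) (All.lookup YN-lo j)))) (≤-reflexive (*-zeroʳ (length YN)))))
                  (≤-reflexive (*-zeroʳ (length S))))

              HN-length : length HN ≤ 3 * m + 3
              HN-length = polyle (length HN ∷ length YN ∷ length M₂ ∷ length Y ∷ length H ∷ m ∷ ∑ (flat M₂) lo ∷ length P ∷ a ∷ length M ∷ length N ∷ [])
                ((var 0 :+ var 1 , var 10 , con 1) ∷ (var 10 , var 2 :* con 3 :+ (var 3 :+ var 4) , con 1) ∷ (var 6 :+ var 3 , var 1 , con 1) ∷
                 (var 4 , con 3 , con 1) ∷ (var 7 :+ var 2 , var 9 , con 3) ∷ (var 9 :+ var 8 , var 5 , con 3) ∷ [])
                (var 0) (con 3 :* var 5 :+ con 3)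
                (≤-reflexive (trans (+-comm (length HN) (length YN)) (sym (trans (↭-length pN) (length-++ YN)))) ,
                 ≤-reflexive (trans (length-++ (flat M₂)) (cong₂ _+_ (length-flat M₂) (length-++ Y))) ,
                 ≤-reflexive lows , three-high , ≤-reflexive (sym M-length) , size-bound M (Y ++ H) M-edge part , tt)
                where
                lows : ∑ (flat M₂) lo + length Y ≡ length YN
                lows = begin
                  ∑ (flat M₂) lo + length Y ≡⟨ cong (∑ (flat M₂) lo +_) (trans (cong₂ _+_ (∑-ones lo Y-lo) (∑-zeros lo H-hi)) (+-identityʳ _)) ⟨
                  ∑ (flat M₂) lo + (∑ Y lo + ∑ H lo) ≡⟨ trans (∑-++ lo (flat M₂) (Y ++ H)) (cong (∑ (flat M₂) lo +_) (∑-++ lo Y H)) ⟨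
                  ∑ N lo ≡⟨ trans (∑-↭ lo pN) (∑-++ lo YN HN) ⟩
                  ∑ YN lo + ∑ HN lo ≡⟨ trans (cong₂ _+_ (∑-ones lo YN-lo) (∑-zeros lo (proj₂ (proj₂ (proj₂ (proj₂ parts)))))) (+-identityʳ _) ⟩
                  length YN ∎
                  where open ≡-Reasoning

            -- Outside the small set `Z` no edge has a low vertex. So the link of `w` lives on pairs
            -- meeting `Z`, and up to such pairs the link of `r` lives on at most 3 m + 3 high
            -- vertices. The degree sum is at most about (3 m)² ≤ 3 m n, short of 4 m n.
            adjacent-small : ∀ {w r v} → w ∈ Y → r ∈ flat M₀ → E w r v ≡ 1 → ⊥
            adjacent-small {w} {r} {v} iw ir e = 1+n≰n (polyle (d w ∷ d r ∷ m ∷ n ∷ length Z ∷ length HN ∷ κ ∷ a ∷ ∑∑ N (E w) ∷ ∑∑ N (E r) ∷ [])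
              ((con 4 :* (var 2 :* var 3) :+ con 2 , var 0 :+ var 1 :+ con 4 :* var 2 , con 1) ∷
               (var 0 , var 8 :+ con 2 :* (var 4 :* var 3 :* con 1) , con 1) ∷ (var 8 , con 0 , con 1) ∷
               (var 1 , var 9 :+ con 2 :* (var 4 :* var 3 :* con 1) , con 1) ∷ (var 9 , var 5 :* (var 5 :* con 1) , con 1) ∷
               (var 4 , var 6 :* con 3 :+ var 7 :* con 3 , con 4 :* var 3) ∷
               (var 5 , con 3 :* var 2 :+ con 3 , var 5 :+ con 3 :* var 2 :+ con 3) ∷
               ((con 12 :* (var 6 :+ var 7) :+ con 22) :* var 3 , var 2 :* var 3 , con 1) ∷
               (con 3 :* var 2 :+ con 3 , var 3 , con 3 :* var 2 :+ con 22) ∷ [])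
              (con 1) (con 0)
              (degree-sum w r v e , split w , ≤-reflexive (low-in-N w iw′ (All.lookup Y-lo iw)) , split r , inside r ir′ ,
               Z-length , HN-length , c₃ , n-large , tt))
              where
              iw′ : w ∈ N
              iw′ = Any.++⁺ʳ (flat M₂) (Any.++⁺ˡ iw)
              ir′ : r ∈ N
              ir′ = Any.++⁺ˡ (subst (r ∈_) (sym (flat-++ (drop (length P) M₁) M₀)) (Any.++⁺ʳ (flat (drop (length P) M₁)) ir))

          adjacent : ∀ {w r v} → w ∈ Y → r ∈ flat M₀ → E w r v ≡ 1 → ⊥
          adjacent = go alt
            where
            go : (κ ≤ length P ⊎ (∀ P′ L′ → All Edge P′ → All Tail-lo P′ → Part P′ X L′ → length P′ ≡ suc (length P) → ⊥)) →
              ∀ {w r v} → w ∈ Y → r ∈ flat M₀ → E w r v ≡ 1 → ⊥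
            go (inj₁ h) = adjacent-large h
            go (inj₂ h) = adjacent-small h

          private
            fronts thirds : List (Tri V) → List V
            fronts [] = []
            fronts ((u , v , w) ∷ ts) = u ∷ v ∷ fronts ts
            thirds [] = []
            thirds ((u , v , w) ∷ ts) = w ∷ thirds ts

            flat-fronts : ∀ ts → flat ts ↭ fronts ts ++ thirds ts
            flat-fronts [] = ↭-refl
            flat-fronts ((u , v , w) ∷ ts) = prep u (prep v (↭-trans (prep w (flat-fronts ts)) (↭-sym (shift w (fronts ts) (thirds ts)))))

            length-fronts : ∀ ts → length (fronts ts) ≡ length ts * 2
            length-fronts [] = refl
            length-fronts (_ ∷ ts) = cong (λ z → suc (suc z)) (length-fronts ts)

            length-thirds : ∀ ts → length (thirds ts) ≡ length ts
            length-thirds [] = refl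
            length-thirds (_ ∷ ts) = cong suc (length-thirds ts)

            thirds-lo : ∀ ts → All Tail-lo ts → All (λ v → lo v ≡ 1) (thirds ts)
            thirds-lo [] [] = []
            thirds-lo (_ ∷ ts) (l ∷ ls) = l ∷ thirds-lo ts ls

            B C Th : List V
            B = fronts M₁ ++ X ++ H
            C = B ++ flat M₀
            Th = thirds M₁

            Th-lo : All (λ v → lo v ≡ 1) Th
            Th-lo = thirds-lo M₁ M₁-lo

            regroup : vs ↭ (C ++ Th) ++ Y
            regroup = ↭-trans (↭-sym part) (↭-trans (↭-reflexive (trans (cong (_++ X ++ Y ++ H) (flat-++ M₁ M₀)) (++-assoc (flat M₁) (flat M₀) _)))
              (↭-trans (++⁺ʳ (flat M₀ ++ X ++ Y ++ H) (flat-fronts M₁))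
              (↭-trans (↭-reflexive (++-assoc (fronts M₁) Th _))
              (↭-trans (++⁺ˡ (fronts M₁) (↭-trans (++⁺ˡ Th (↭-trans (++⁺ˡ (flat M₀) (↭-trans (++⁺ˡ X (++-comm Y H)) (↭-reflexive (sym (++-assoc X H Y)))))
                 (shifts (flat M₀) (X ++ H)))) (shifts Th (X ++ H))))
              (↭-trans (↭-reflexive (sym (++-assoc (fronts M₁) (X ++ H) _)))
              (↭-trans (++⁺ˡ B (shifts Th (flat M₀))) (↭-reflexive (trans (sym (++-assoc B (flat M₀) (Th ++ Y))) (sym (++-assoc C Th Y))))))))))

            zero-sum : ∀ x S S′ → (∀ {p q} → p ∈ S → q ∈ S′ → E x p q ≡ 1 → ⊥) → ∑ S (λ p → ∑ S′ (E x p)) ≡ 0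
            zero-sum x S S′ h = n≤0⇒n≡0 (≤-trans (∑-≤-const S 0 (λ {p} i → ≤-trans (∑-≤-const S′ 0 (λ {q} j → bit-0 (E≤1 x p q) (h i j)))
              (≤-reflexive (*-zeroʳ (length S′))))) (≤-reflexive (*-zeroʳ (length S))))

            ∑∑-≤-square : ∀ x S → ∑∑ S (E x) ≤ length S * (length S * 1)
            ∑∑-≤-square x S = ∑-≤-const S _ (λ {p} _ → ∑-≤-const S 1 (λ {q} _ → E≤1 x p q))

            low-pair : ∀ x {p q} → lo p ≡ 1 → lo q ≡ 1 → E x p q ≡ 1 → ⊥
            low-pair x {p} {q} lp lq e with trans (sym e) (lolo x p q lp lq)
            ... | ()

            -- By `adjacent`, the neighbours of `w` avoid the edges of `M₀`; being high, they also
            -- avoid `Th` and `Y`. What is left is `B`: the high vertices of `M₁`, the locked and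
            -- the uncovered high ones.
            low-link : ∀ w → w ∈ Y → d w ≤ length B * (length B * 1)
            low-link w iw = begin
              d w ≡⟨ trans (trans (∑-cong vs (λ p → ∑-↭ (E w p) σ)) (∑-↭ _ σ)) (∑∑-++ (E w) (E₂₃ w) B R) ⟩
              ∑∑ B (E w) + 2 * ∑ B (λ p → ∑ R (E w p)) + ∑∑ R (E w)
                ≡⟨ cong₂ (λ u v → ∑∑ B (E w) + 2 * u + v) (zero-sum w B R (λ _ → none)) (zero-sum w R R (λ _ → none)) ⟩
              ∑∑ B (E w) + 2 * 0 + 0 ≡⟨ trans (+-identityʳ _) (+-identityʳ _) ⟩
              ∑∑ B (E w) ≤⟨ ∑∑-≤-square w B ⟩
              length B * (length B * 1) ∎
              where
              open ≤-Reasoning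
              R = flat M₀ ++ Th ++ Y
              σ : vs ↭ B ++ R
              σ = ↭-trans regroup (↭-reflexive (trans (++-assoc C Th Y) (++-assoc B (flat M₀) (Th ++ Y))))
              lw = All.lookup Y-lo iw
              none : ∀ {p q} → q ∈ R → E w p q ≡ 1 → ⊥
              none {p} {q} iq e with Any.++⁻ (flat M₀) iq
              ... | inj₁ j = adjacent iw j (trans (E₂₃ w q p) e)
              ... | inj₂ j with trans (sym (lolo′ lw e)) (All.lookup (All.++⁺ Th-lo Y-lo) j)
              ...   | ()

            -- Pairs of two low vertices are excluded, and so are pairs between `Y` and `M₀` by
            -- `adjacent`, applied with the low vertex first.
            link : ∀ v → d v ≤ length C * (length C * 1) + 2 * (length C * (k * 1)) + 2 * (length B * (length Y * 1))
            link v = begin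
              d v ≡⟨ trans (trans (∑-cong vs (λ p → ∑-↭ (E v p) regroup)) (∑-↭ _ regroup)) (∑∑-++ (E v) (E₂₃ v) (C ++ Th) Y) ⟩
              ∑∑ (C ++ Th) (E v) + 2 * ∑ (C ++ Th) (λ p → ∑ Y (E v p)) + ∑∑ Y (E v)
                ≡⟨ trans (cong (∑∑ (C ++ Th) (E v) + 2 * ∑ (C ++ Th) (λ p → ∑ Y (E v p)) +_)
                     (zero-sum v Y Y (λ i j → low-pair v (All.lookup Y-lo i) (All.lookup Y-lo j)))) (+-identityʳ _) ⟩
              ∑∑ (C ++ Th) (E v) + 2 * ∑ (C ++ Th) (λ p → ∑ Y (E v p))
                ≤⟨ +-mono-≤ inner (*-monoʳ-≤ 2 outer) ⟩
              length C * (length C * 1) + 2 * (length C * (k * 1)) + 2 * (length B * (length Y * 1)) ∎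
              where
              open ≤-Reasoning
              inner : ∑∑ (C ++ Th) (E v) ≤ length C * (length C * 1) + 2 * (length C * (k * 1))
              inner = ≤-trans (≤-reflexive (trans (∑∑-++ (E v) (E₂₃ v) C Th)
                  (trans (cong (∑∑ C (E v) + 2 * ∑ C (λ p → ∑ Th (E v p)) +_)
                    (zero-sum v Th Th (λ i j → low-pair v (All.lookup Th-lo i) (All.lookup Th-lo j)))) (+-identityʳ _))))
                (+-mono-≤ (∑∑-≤-square v C) (*-monoʳ-≤ 2 (∑-≤-const C _ (λ {p} _ →
                  ≤-trans (∑-≤-const Th 1 (λ {q} _ → E≤1 v p q)) (≤-reflexive (cong (_* 1) (length-thirds M₁)))))))
              outer : ∑ (C ++ Th) (λ p → ∑ Y (E v p)) ≤ length B * (length Y * 1)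
              outer = ≤-trans (≤-reflexive (trans (∑-++ _ C Th) (trans (cong₂ _+_ (trans (∑-++ _ B (flat M₀))
                    (trans (cong (∑ B (λ p → ∑ Y (E v p)) +_) (zero-sum v (flat M₀) Y (λ i j e → adjacent j i (trans (E₂₃ _ _ _) (E-rot (E-rot e)))))) (+-identityʳ _)))
                  (zero-sum v Th Y (λ i j → low-pair v (All.lookup Th-lo i) (All.lookup Y-lo j)))) (+-identityʳ _))))
                (∑-≤-const B _ (λ {p} _ → ∑-≤-const Y 1 (λ {q} _ → E≤1 v p q)))

            B-length : length B ≡ k * 2 + (a * 3 + length H)
            B-length = trans (length-++ (fronts M₁)) (cong₂ _+_ (length-fronts M₁) (trans (length-++ X) (cong (_+ length H) X-length)))

            C-length : length C ≡ k * 2 + (a * 3 + length H) + t * 3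
            C-length = trans (length-++ B) (cong₂ _+_ B-length (length-flat M₀))

            -- Edges with a low vertex cover 2 high vertices, the others 3. To account for more than
            -- 2 m + τ high vertices, t + a + 3 must exceed τ, and by `c₄` half of τ is left for t.
            many-unlow : τ ≤ 2 * t
            many-unlow = polyle (k ∷ t ∷ a ∷ length Y ∷ length H ∷ m ∷ n ∷ τ ∷ length U ∷ length W ∷ ∑ X lo ∷ [])
              ((con 1 :+ (con 2 :* var 5 :+ var 7) , var 8 , con 2) ∷ (var 9 :+ var 8 , var 6 , con 2) ∷
               (var 6 , (var 0 :+ var 1) :* con 3 :+ (var 2 :* con 3 :+ (var 3 :+ var 4)) , con 2) ∷
               (var 0 :+ (var 10 :+ var 3) , var 9 , con 2) ∷ (var 0 :+ var 1 :+ var 2 , var 5 , con 4) ∷ (var 4 , con 3 , con 2) ∷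
               (con 2 :* (var 2 :+ con 3) , var 7 , con 1) ∷ [])
              (var 7) (con 2 :* var 1)
              (many-high , ≤-reflexive (sym (trans (↭-length WU) (length-++ W))) , ≤-reflexive (sym total-size) , ≤-reflexive lows , M-size , three-high , c₄ , tt)
              where
              lows : k + (∑ X lo + length Y) ≡ length W
              lows = begin
                k + (∑ X lo + length Y) ≡⟨ cong₂ (λ u v → u + (∑ X lo + v)) (sym M-count)
                  (sym (trans (∑-++ lo Y H) (trans (cong₂ _+_ (∑-ones lo Y-lo) (∑-zeros lo H-hi)) (+-identityʳ _)))) ⟩
                ∑ (flat M) lo + (∑ X lo + ∑ (Y ++ H) lo) ≡⟨ lo-count M (Y ++ H) part ⟩
                ∑ vs lo ≡⟨ trans (∑-↭ lo WU) (∑-++ lo W U) ⟩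
                ∑ W lo + ∑ U lo ≡⟨ trans (cong₂ _+_ (∑-ones lo W-lo) (∑-zeros lo U-hi)) (+-identityʳ _) ⟩
                length W ∎
                where open ≡-Reasoning

          -- Up to errors, |B| = 2 k, |C| = 2 k + 3 t and |Y| = n - 3 k - 3 t, so `low-link` and
          -- `link` bound the degree sum by 4 k n + 6 k t + 9 t². The hypothesis demands 4 (k + t) n
          -- ≥ 4 k n + 12 k t + 12 t². The difference is at least 3 t² ≥ 3 τ² / 4, and `c₅` makes it
          -- exceed the errors.
          low-left : ∀ w → w ∈ Y → ⊥
          low-left w iw = 1+n≰n (polyle (d w ∷ d v ∷ k ∷ t ∷ a ∷ length Y ∷ length H ∷ m ∷ n ∷ τ ∷ length B ∷ length C ∷ [])
              ((con 4 :* (var 7 :* var 8) :+ con 2 , var 0 :+ var 1 :+ con 4 :* var 7 , con 4) ∷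
               (var 0 , var 10 :* (var 10 :* con 1) , con 4) ∷
               (var 1 , var 11 :* (var 11 :* con 1) :+ con 2 :* (var 11 :* (var 2 :* con 1)) :+ con 2 :* (var 10 :* (var 5 :* con 1)) , con 4) ∷
               (var 10 , b , con 4 :* (var 10 :+ b) :+ con 8 :* var 5) ∷
               (var 11 , c , con 4 :* (var 11 :+ c) :+ con 8 :* var 2) ∷
               (var 2 :+ var 3 :+ var 4 , var 7 , con 16 :* var 8) ∷
               ((var 2 :+ var 3) :* con 3 :+ (var 4 :* con 3 :+ (var 5 :+ var 6)) , var 8 , con 16 :* (var 2 :+ var 3 :+ var 4) :+ con 8 :* (var 4 :* con 3 :+ var 6)) ∷
               (var 6 , con 3 , con 8 :* var 8) ∷
               (con 3 :* var 7 :+ con 3 , var 8 , con 16) ∷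
               (var 9 , con 2 :* var 3 , con 3 :* var 9 :+ con 6 :* var 3) ∷
               ((con 12 :* var 4 :+ con 16) :* var 8 :* con 4 , con 3 :* (var 9 :* var 9) , con 1) ∷ [])
              (con 1) (con 0)
              (degree-sum w v x e , low-link w iw , link v , ≤-reflexive B-length , ≤-reflexive C-length , M-size , ≤-reflexive total-size ,
               three-high , n-large , many-unlow , c₅ , tt))
            where
            b c : Ex
            b = var 2 :* con 2 :+ (var 4 :* con 3 :+ var 6)
            c = b :+ var 3 :* con 3
            v = proj₁ (covered w)
            x = proj₁ (proj₂ (covered w))
            e = proj₂ (proj₂ (covered w))

          step-impossible : ⊥
          step-impossible = go Y refl
            where
            go : ∀ Y′ → Y ≡ Y′ → ⊥
            go [] eq = no-low-left H refl eq
            go (w ∷ Y′) eq = low-left w (subst (w ∈_) (sym eq) (here refl))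

        core-impossible : ⊥
        core-impossible = optimum Good (λ L → ∑ L lo) m (λ M L (es , p , _) → ≤-trans (m≤m+n _ a) (size-bound M L es p)) step P L₀ (P-edge , P-part , ≤-refl)
          where
          step : ∀ M L → Good M L → (∀ M′ L′ → Good M′ L′ → length M′ ≡ suc (length M) → ⊥) →
            (∀ M′ L′ → Good M′ L′ → length M′ ≡ length M → ∑ L′ lo < ∑ L lo → ⊥) → ⊥
          step M L (es , p , al) bigger better =
            let M′ , M↭ , M≡ , es′ , ns = normalize M es
                M₁ , M₀ , pM , lows , highs = partition φ (λ t → lo≤1 (proj₂ (proj₂ t))) M′
                Y , H , pL , Y-lo , H-hi = partition lo lo≤1 L
                es″ = All-resp-↭ pM es′
                ns″ = All-resp-↭ pM ns
                len : length M ≡ length (M₁ ++ M₀)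
                len = trans M≡ (↭-length pM)
                low : ∑ L lo ≡ ∑ (Y ++ H) lo
                low = ∑-↭ lo pL
            in Step.step-impossible (record
                 { M₁ = M₁ ; M₀ = M₀ ; Y = Y ; H = H
                 ; M₁-edge = All.++⁻ˡ M₁ es″ ; M₀-edge = All.++⁻ʳ M₁ es″ ; M₁-normal = All.++⁻ˡ M₁ ns″ ; M₀-normal = All.++⁻ʳ M₁ ns″
                 ; M₁-lo = lows ; M₀-hi = highs ; Y-lo = Y-lo ; H-hi = H-hi
                 ; part = ↭-trans (++⁺ (↭-trans (flat-↭ (↭-sym pM)) (↭-sym M↭)) (++⁺ˡ X (↭-sym pL))) p
                 ; allow = ≤-trans (≤-reflexive (sym low)) al
                 ; bigger = λ M′ L′ g′ l → bigger M′ L′ g′ (trans l (cong suc (sym len)))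
                 ; better = λ M′ L′ g′ l lt → better M′ L′ g′ (trans l (sym len)) (<-≤-trans lt (≤-reflexive (sym low))) })

      -- The second alternative of `Start` comes from the recursion itself: any family with one more
      -- edge is refuted with a smaller counter.
      far-impossible : ∀ L → Part [] X L → ⊥
      far-impossible L p = grow κ [] L [] [] p (+-identityʳ κ)
        where
        grow : ∀ j P L → All Edge P → All Tail-lo P → Part P X L → j + length P ≡ κ → ⊥
        grow zero P L es ls p len = Core.core-impossible (record { P = P ; L₀ = L ; P-edge = es ; P-lo = ls ; P-part = p
          ; P≤κ = ≤-reflexive len ; alt = inj₁ (≤-reflexive (sym len)) })
        grow (suc j) P L es ls p len = Core.core-impossible (record { P = P ; L₀ = L ; P-edge = es ; P-lo = ls ; P-part = p
          ; P≤κ = ≤-trans (m≤n+m _ (suc j)) (≤-reflexive len)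
          ; alt = inj₂ (λ P′ L′ es′ ls′ p′ len′ → grow j P′ L′ es′ ls′ p′ (trans (cong (j +_) len′) (trans (+-suc j _) len))) })

-- The absorbing family.

length-cartesianProduct : ∀ {A B : Set} (xs : List A) (ys : List B) → length (cartesianProduct xs ys) ≡ length xs * length ys
length-cartesianProduct [] ys = refl
length-cartesianProduct (x ∷ xs) ys = trans (length-++ (map (x ,_) ys)) (cong₂ _+_ (length-map (x ,_) ys) (length-cartesianProduct xs ys))

average : ∀ {A : Set} (f : A → ℕ) c x xs → length (x ∷ xs) * c ≤ ∑ (x ∷ xs) f → ∃ λ y → y ∈ x ∷ xs × c ≤ f y
average f c x xs h with c ≤? f x
... | yes p = x , here refl , p
average f c x [] h | no ¬p = ⊥-elim (¬p (subst₂ _≤_ (+-identityʳ c) (+-identityʳ (f x)) h))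
average f c x (y ∷ xs) h | no ¬p with average f c y xs (+-cancelˡ-≤ c _ _ (≤-trans h (+-monoˡ-≤ _ (<⇒≤ (≰⇒> ¬p)))))
... | z , i , p = z , there i , p

4ab≤ : ∀ a b → 4 * (a * b) ≤ (a + b) * (a + b)
4ab≤ a b with ≤-total a b
... | inj₁ a≤b = subst (λ b → 4 * (a * b) ≤ (a + b) * (a + b)) (m+[n∸m]≡n a≤b)
  (polyle (a ∷ b ∸ a ∷ []) [] (con 4 :* (var 0 :* (var 0 :+ var 1))) ((var 0 :+ (var 0 :+ var 1)) :* (var 0 :+ (var 0 :+ var 1))) tt)
... | inj₂ b≤a = subst (λ a → 4 * (a * b) ≤ (a + b) * (a + b)) (m+[n∸m]≡n b≤a)
  (polyle (b ∷ a ∸ b ∷ []) [] (con 4 :* ((var 0 :+ var 1) :* var 0)) ((var 0 :+ var 1 :+ var 0) :* (var 0 :+ var 1 :+ var 0)) tt)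

module Absorption (G : Hypergraph) (m : ℕ) where

  open Hypergraph G
  open Setting G m

  module _ (g : ℕ) (degree-sum : ∀ u v w → E u v w ≡ 1 → 4 * (m * n) + 2 ≤ d u + d v + 4 * m)
    (n≡ : n ≡ 3 * m + 3) (n-large : 1000 ≤ n) (g-small : g * 100 ≤ n * n) where

    open Low g degree-sum

    module _ (W U : List V) (WU : vs ↭ W ++ U) (W-lo : All (λ v → lo v ≡ 1) W) (U-hi : All (λ v → lo v ≡ 0) U) where

      open Sizes W U WU W-lo U-hi

      private
        T₃ : Set
        T₃ = Tri V

        zero≢one : 0 ≡ 1 → ⊥
        zero≢one ()

      module _ (Ts : List T₃) (w : T₃ → ℕ) (f : T₃ → V → V → ℕ) (f-irr : ∀ t a → f t a a ≡ 0)
        (L : List V) (L≤n : length L ≤ n) (w-pos : 0 < ∑ Ts w)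
        (dense : ∀ {t} → t ∈ Ts → w t * (n * n) ≤ w t * ∑∑ L (f t) * 10) where

        -- Double counting: some pair lies in `f t` for a tenth of the weight of the triples, by
        -- averaging over its first entry and then over the second. The entries differ, because
        -- equal ones have value 0 for all triples.
        popular-pair : ∃₂ λ a b → ∃ λ r → L ↭ a ∷ b ∷ r × ∑ Ts w ≤ ∑ Ts (λ t → w t * f t a b) * 10
        popular-pair = first L refl
          where
          g₂ : V → V → ℕ
          g₂ a b = ∑ Ts (λ t → w t * f t a b) * 10
          total : ∑ Ts w * (n * n) ≤ ∑ L (λ a → ∑ L (g₂ a))
          total = begin
            ∑ Ts w * (n * n) ≡⟨ ∑-*ʳ w (n * n) Ts ⟨
            ∑ Ts (λ t → w t * (n * n)) ≤⟨ ∑-mono Ts dense ⟩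
            ∑ Ts (λ t → w t * ∑∑ L (f t) * 10) ≡⟨ ∑-*ʳ (λ t → w t * ∑∑ L (f t)) 10 Ts ⟩
            ∑ Ts (λ t → w t * ∑∑ L (f t)) * 10
              ≡⟨ cong (_* 10) (∑-cong Ts (λ t → trans (sym (∑-*ˡ (λ a → ∑ L (f t a)) (w t) L)) (∑-cong L (λ a → sym (∑-*ˡ (f t a) (w t) L))))) ⟩
            ∑ Ts (λ t → ∑ L (λ a → ∑ L (λ b → w t * f t a b))) * 10
              ≡⟨ cong (_* 10) (trans (∑-swap (λ t a → ∑ L (λ b → w t * f t a b)) Ts L) (∑-cong L (λ a → ∑-swap (λ t b → w t * f t a b) Ts L))) ⟩
            ∑ L (λ a → ∑ L (λ b → ∑ Ts (λ t → w t * f t a b))) * 10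
              ≡⟨ trans (∑-cong L (λ a → ∑-*ʳ (λ b → ∑ Ts (λ t → w t * f t a b)) 10 L)) (∑-*ʳ (λ a → ∑ L (λ b → ∑ Ts (λ t → w t * f t a b))) 10 L) ⟨
            ∑ L (λ a → ∑ L (g₂ a)) ∎
            where open ≤-Reasoning
          first : ∀ L′ → L ≡ L′ → ∃₂ λ a b → ∃ λ r → L ↭ a ∷ b ∷ r × ∑ Ts w ≤ ∑ Ts (λ t → w t * f t a b) * 10
          first [] refl = ⊥-elim (1+n≰n (polyle (∑ Ts w ∷ n ∷ []) ((con 1 , var 0 , var 1 :* var 1) ∷ (con 1000 , var 1 , var 1 :+ con 1) ∷
            (var 0 :* (var 1 :* var 1) , con 0 , con 1) ∷ []) (con 1) (con 0) (w-pos , n-large , total , tt)))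
          first (l ∷ L′) refl = second (average (λ a → ∑ L (g₂ a)) (length L * ∑ Ts w) l L′ (≤-trans
              (polyle (length L ∷ ∑ Ts w ∷ n ∷ []) ((var 0 , var 2 , var 1 :* (var 0 :+ var 2)) ∷ [])
                (var 0 :* (var 0 :* var 1)) (var 1 :* (var 2 :* var 2)) (L≤n , tt)) total))
            where
            second : (∃ λ a → a ∈ L × length L * ∑ Ts w ≤ ∑ L (g₂ a)) →
              ∃₂ λ a b → ∃ λ r → L ↭ a ∷ b ∷ r × ∑ Ts w ≤ ∑ Ts (λ t → w t * f t a b) * 10
            second (a , ia , ha) with average (g₂ a) (∑ Ts w) l L′ ha
            ... | b , ib , hb = third (∈⇒↭ ia)
              where
              distinct : b ≡ a → ⊥
              distinct refl = 1+n≰n (≤-trans w-pos (≤-trans hb (≤-reflexive (cong (_* 10)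
                (trans (∑-cong Ts (λ t → trans (cong (w t *_) (f-irr t a)) (*-zeroʳ (w t)))) (∑-zero Ts))))))
              third : (∃ λ r → L ↭ a ∷ r) → ∃₂ λ a b → ∃ λ r → L ↭ a ∷ b ∷ r × ∑ Ts w ≤ ∑ Ts (λ t → w t * f t a b) * 10
              third (r , p) = let r′ , q = ∈⇒↭ (∈-tail (∈-resp-↭ p ib) distinct) in a , b , r′ , ↭-trans p (prep a q) , hb

      private
        outside : ∀ x L R → vs ↭ L ++ R → d x ≤ ∑∑ L (E x) + 2 * (length R * n * 1)
        outside x L R σ = ∑∑-split (E x) (E₂₃ x) 1 (E≤1 x) [] L R σ

        -- As n = 3 m + 3, a high link has about 2 n² / 3 ordered pairs. At most 2 |H| |Y| ≤ n² / 2
        -- of them contain a low vertex, so about n² / 6 are left, and a tenth remains after the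
        -- errors.
        high-pairs : ∀ x Y H R → lo x ≡ 0 → All (λ v → lo v ≡ 1) Y → vs ↭ (H ++ Y) ++ R → length R * 100 ≤ n → n * n ≤ ∑∑ H (E x) * 10
        high-pairs x Y H R hx Y-lo σ small = *-cancelˡ-≤ 100 (polyle
            (d x ∷ ∑∑ (H ++ Y) (E x) ∷ ∑∑ H (E x) ∷ length H ∷ length Y ∷ length R ∷ m ∷ n ∷ g ∷ ∑ H (λ p → ∑ Y (E x p)) ∷ [])
            ((con 1 :+ con 2 :* (var 6 :* var 7) , var 0 :+ var 8 :+ con 2 :* var 6 , con 1000) ∷
             (var 0 , var 1 :+ con 2 :* (var 5 :* var 7 :* con 1) , con 1000) ∷
             (var 1 , var 2 :+ con 2 :* var 9 :+ con 0 , con 1000) ∷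
             (var 9 , var 3 :* (var 4 :* con 1) , con 2000) ∷
             (con 4 :* (var 3 :* var 4) , (var 3 :+ var 4) :* (var 3 :+ var 4) , con 500) ∷
             (var 3 :+ var 4 :+ var 5 , var 7 , con 500 :* (var 3 :+ var 4 :+ var 7)) ∷
             (var 5 :* con 100 , var 7 , con 20 :* var 7) ∷
             (var 8 :* con 100 , var 7 :* var 7 , con 10) ∷
             (var 7 , con 3 :* var 6 :+ con 3 , con 666 :* var 7) ∷
             (con 3 :* var 6 :+ con 3 , var 7 , con 667) ∷
             (con 1000 , var 7 , con 3 :* var 7) ∷ [])
            (con 100 :* (var 7 :* var 7)) (con 100 :* (var 2 :* con 10))
            (hi-< hx , outside x (H ++ Y) R σ , ≤-reflexive (trans (∑∑-++ (E x) (E₂₃ x) H Y)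
               (cong (∑∑ H (E x) + 2 * ∑ H (λ p → ∑ Y (E x p)) +_) (no-edge-inside x Y low-pair))) ,
             ∑-≤-const H _ (λ {p} _ → ∑-≤-const Y 1 (λ {q} _ → E≤1 x p q)) , 4ab≤ (length H) (length Y) ,
             ≤-reflexive (sym (trans (↭-length σ) (trans (length-++ (H ++ Y)) (cong (_+ length R) (length-++ H))))) ,
             small , g-small , ≤-reflexive n≡ , ≤-reflexive (sym n≡) , n-large , tt))
          where
          low-pair : ∀ p q r → Y ↭ p ∷ q ∷ r → E x p q ≡ 1 → ⊥
          low-pair p q r σ e with All-resp-↭ σ Y-lo
          ... | lp ∷ lq ∷ _ = zero≢one (trans (sym (lolo x p q lp lq)) e)

        common : ∀ {a b} → a ≤ 1 → b ≤ 1 → a + b ≤ 1 + a * b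
        common {0} _ q = ≤-trans q (m≤m+n 1 _)
        common {1} {b} _ q = ≤-reflexive (cong suc (sym (+-identityʳ b)))
        common {suc (suc _)} (s≤s ()) _

        -- Two sets of about 2 n² / 3 among n² ordered pairs share about a third of them.
        common-pairs : ∀ x y L R → lo x ≡ 0 → lo y ≡ 0 → vs ↭ L ++ R → length R * 100 ≤ n →
          n * n ≤ ∑∑ L (λ a b → E x a b * E y a b) * 10
        common-pairs x y L R hx hy σ small = *-cancelˡ-≤ 100 (polyle
            (d x ∷ d y ∷ ∑∑ L (E x) ∷ ∑∑ L (E y) ∷ ∑∑ L (λ a b → E x a b * E y a b) ∷ length L ∷ length R ∷ m ∷ n ∷ g ∷ [])
            ((con 1 :+ con 2 :* (var 7 :* var 8) , var 0 :+ var 9 :+ con 2 :* var 7 , con 1000) ∷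
             (con 1 :+ con 2 :* (var 7 :* var 8) , var 1 :+ var 9 :+ con 2 :* var 7 , con 1000) ∷
             (var 0 , var 2 :+ con 2 :* (var 6 :* var 8 :* con 1) , con 1000) ∷
             (var 1 , var 3 :+ con 2 :* (var 6 :* var 8 :* con 1) , con 1000) ∷
             (var 2 :+ var 3 , var 5 :* (var 5 :* con 1) :+ var 4 , con 1000) ∷
             (var 5 :+ var 6 , var 8 , con 1000 :* (var 5 :+ var 8)) ∷
             (var 6 :* con 100 , var 8 , con 40 :* var 8) ∷
             (var 9 :* con 100 , var 8 :* var 8 , con 20) ∷
             (var 8 , con 3 :* var 7 :+ con 3 , con 1333 :* var 8) ∷
             (con 3 :* var 7 :+ con 3 , var 8 , con 1334) ∷
             (con 1000 , var 8 , con 6 :* var 8) ∷ [])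
            (con 100 :* (var 8 :* var 8)) (con 100 :* (var 4 :* con 10))
            (hi-< hx , hi-< hy , outside x L R σ , outside y L R σ , both ,
             ≤-reflexive (sym (trans (↭-length σ) (length-++ L))) , small , g-small , ≤-reflexive n≡ , ≤-reflexive (sym n≡) , n-large , tt))
          where
          both : ∑∑ L (E x) + ∑∑ L (E y) ≤ length L * (length L * 1) + ∑∑ L (λ a b → E x a b * E y a b)
          both = begin
            ∑∑ L (E x) + ∑∑ L (E y) ≡⟨ trans (∑-cong L (λ a → ∑-+ (E x a) (E y a) L)) (∑-+ (λ a → ∑ L (E x a)) (λ a → ∑ L (E y a)) L) ⟨
            ∑∑ L (λ a b → E x a b + E y a b) ≤⟨ ∑-mono L (λ {a} _ → ∑-mono L (λ {b} _ → common (E≤1 x a b) (E≤1 y a b))) ⟩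
            ∑∑ L (λ a b → 1 + E x a b * E y a b)
              ≡⟨ trans (∑-cong L (λ a → trans (∑-+ (λ _ → 1) (λ b → E x a b * E y a b) L) (cong (_+ ∑ L (λ b → E x a b * E y a b)) (∑-const L 1))))
                   (trans (∑-+ (λ _ → length L * 1) (λ a → ∑ L (λ b → E x a b * E y a b)) L)
                     (cong (_+ ∑∑ L (λ a b → E x a b * E y a b)) (∑-const L (length L * 1)))) ⟩
            length L * (length L * 1) + ∑∑ L (λ a b → E x a b * E y a b) ∎
            where open ≤-Reasoning

        E·E≤1 : ∀ x y a b → E x a b * E y a b ≤ 1
        E·E≤1 x y a b = *-mono-≤ (E≤1 x a b) (E≤1 y a b)

        E·E-irr : ∀ x y a → E x a a * E y a a ≡ 0
        E·E-irr x y a = cong (_* E y a a) (E-irr x a)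

      High : T₃ → Set
      High (x , y , z) = lo x ≡ 0 × lo y ≡ 0 × lo z ≡ 0

      Absorbed : List T₃ → T₃ → Set
      Absorbed A (x , y , z) = ∃₂ λ (s t : T₃) → ∃ λ A′ → A ↭ s ∷ t ∷ A′ × E x (proj₁ s) (proj₁ t) ≡ 1 ×
        E y (proj₁ (proj₂ s)) (proj₂ (proj₂ s)) ≡ 1 × E z (proj₁ (proj₂ t)) (proj₂ (proj₂ t)) ≡ 1

      -- The edges chosen so far absorb every triple of high vertices outside Ts.
      record State (k N : ℕ) : Set where
        field
          A Ts : List T₃
          L : List V
          A-edge : All Edge A
          A-part : flat A ++ L ↭ vs
          A-length : length A ≤ k
          Ts-length : length Ts ≤ N
          Ts-high : All High Ts
          covers : ∀ t → High t → t ∈ Ts ⊎ Absorbed A t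

      private
        weigh : ∀ w {a b} → a ≤ b * 10 → w * a ≤ w * b * 10
        weigh w {a} {b} h = ≤-trans (*-monoʳ-≤ w h) (≤-reflexive (sym (*-assoc w b 10)))

        *≡1ˡ : ∀ {a} b → a * b ≡ 1 → a ≡ 1
        *≡1ˡ {a} b = m*n≡1⇒m≡1 a b

        *≡1ʳ : ∀ a {b} → a * b ≡ 1 → b ≡ 1
        *≡1ʳ a {b} = m*n≡1⇒n≡1 a b

      -- Three popular pairs are chosen in turn: u v for the first vertices of the triples, then a b
      -- in the links of `u` and the second vertices, then c e in the links of `v` and the third
      -- ones. Each keeps a tenth, so a thousandth of the triples is absorbed. `u` and `v` have to
      -- be high for their links to be dense; at most 3 k + 4 vertices are in use before the last
      -- choice.
      step : ∀ k N → (k * 3 + 4) * 100 ≤ n → State k N → ∃ λ N′ → State (k + 2) N′ × N′ * 1000 ≤ N * 999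
      step k N room st = start Ts refl
        where
        open State st
        X = flat A
        start : ∀ Ts′ → Ts ≡ Ts′ → ∃ λ N′ → State (k + 2) N′ × N′ * 1000 ≤ N * 999
        start [] eq = 0 , record { A = A ; Ts = Ts ; L = L ; A-edge = A-edge ; A-part = A-part ; A-length = ≤-trans A-length (m≤m+n k 2)
          ; Ts-length = ≤-reflexive (cong length eq) ; Ts-high = Ts-high ; covers = covers } , z≤n
        start (t₀ ∷ Ts′) eq = first (partition lo lo≤1 L)
          where
          vsL : vs ↭ L ++ X
          vsL = ↭-trans (↭-sym A-part) (++-comm X L)
          X-small : ∀ j → j ≤ 4 → (j + length X) * 100 ≤ n
          X-small j j≤4 = ≤-trans (*-monoˡ-≤ 100 (≤-trans (+-mono-≤ j≤4 (≤-trans (≤-reflexive (length-flat A)) (*-monoˡ-≤ 3 A-length)))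
            (≤-reflexive (+-comm 4 (k * 3))))) room
          first : (∃₂ λ Y H → L ↭ Y ++ H × All (λ x → lo x ≡ 1) Y × All (λ x → lo x ≡ 0) H) → ∃ λ N′ → State (k + 2) N′ × N′ * 1000 ≤ N * 999
          first (Y , H , pL , Y-lo , H-hi) = second (popular-pair Ts (λ _ → 1) (λ t → E (proj₁ t)) (λ t → E-irr (proj₁ t)) H
              (size H (Y ++ X) (↭-trans vsHY (↭-reflexive (++-assoc H Y X))))
              (≤-trans Ts-pos (≤-reflexive Ts≤))
              (λ {t} i → weigh 1 {b = ∑∑ H (E (proj₁ t))} (high-pairs (proj₁ t) Y H X (proj₁ (All.lookup Ts-high i)) Y-lo vsHY (X-small 0 z≤n))))
            where
            size : ∀ S R → vs ↭ S ++ R → length S ≤ n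
            size S R σ = ≤-trans (m≤m+n _ (length R)) (≤-reflexive (sym (trans (↭-length σ) (length-++ S))))
            vsHY : vs ↭ (H ++ Y) ++ X
            vsHY = ↭-trans vsL (++⁺ʳ X (↭-trans pL (++-comm Y H)))
            Ts≤ : length Ts ≡ ∑ Ts (λ _ → 1)
            Ts≤ = sym (trans (∑-const Ts 1) (*-identityʳ _))
            Ts-pos : 1 ≤ length Ts
            Ts-pos = ≤-trans (s≤s z≤n) (≤-reflexive (sym (cong length eq)))
            pos : ∀ {a b} → 1 ≤ a → a ≤ b * 10 → 0 < b
            pos {b = suc _} _ _ = s≤s z≤n
            pos {b = zero} p q = ≤-trans p q
            second : (∃₂ λ u v → ∃ λ r → H ↭ u ∷ v ∷ r × ∑ Ts (λ _ → 1) ≤ ∑ Ts (λ t → 1 * E (proj₁ t) u v) * 10) →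
              ∃ λ N′ → State (k + 2) N′ × N′ * 1000 ≤ N * 999
            second (u , v , r , pH , le₁) = third (popular-pair Ts w₁ (λ t a b → E u a b * E (proj₁ (proj₂ t)) a b) (λ t → E·E-irr u (proj₁ (proj₂ t))) L₁
                (size L₁ (u ∷ v ∷ X) vs₁) (pos Ts-pos le₁′)
                (λ {t} i → weigh (w₁ t) {b = ∑∑ L₁ (λ a b → E u a b * E (proj₁ (proj₂ t)) a b)} (common-pairs u (proj₁ (proj₂ t)) L₁ (u ∷ v ∷ X) (All.head hs) (proj₁ (proj₂ (All.lookup Ts-high i))) vs₁ (X-small 2 (s≤s (s≤s z≤n))))))
              where
              w₁ : T₃ → ℕ
              w₁ t = 1 * E (proj₁ t) u v
              le₁′ : length Ts ≤ ∑ Ts w₁ * 10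
              le₁′ = ≤-trans (≤-reflexive Ts≤) le₁
              hs : All (λ x → lo x ≡ 0) (u ∷ v ∷ r)
              hs = All-resp-↭ pH H-hi
              L₁ = r ++ Y
              L↭ : L ↭ u ∷ v ∷ L₁
              L↭ = ↭-trans pL (↭-trans (++-comm Y H) (++⁺ʳ Y pH))
              vs₁ : vs ↭ L₁ ++ u ∷ v ∷ X
              vs₁ = ↭-trans vsL (↭-trans (++⁺ʳ X L↭) (shifts (u ∷ v ∷ []) L₁))
              third : (∃₂ λ a b → ∃ λ r → L₁ ↭ a ∷ b ∷ r × ∑ Ts w₁ ≤ ∑ Ts (λ t → w₁ t * (E u a b * E (proj₁ (proj₂ t)) a b)) * 10) →
                ∃ λ N′ → State (k + 2) N′ × N′ * 1000 ≤ N * 999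
              third (a , b , L₂ , p₂ , le₂) = fourth (popular-pair Ts w₂ (λ t c e → E v c e * E (proj₂ (proj₂ t)) c e) (λ t → E·E-irr v (proj₂ (proj₂ t))) L₂
                  (size L₂ (a ∷ b ∷ u ∷ v ∷ X) vs₂) (pos (pos Ts-pos le₁′) le₂)
                  (λ {t} i → weigh (w₂ t) {b = ∑∑ L₂ (λ c e → E v c e * E (proj₂ (proj₂ t)) c e)} (common-pairs v (proj₂ (proj₂ t)) L₂ (a ∷ b ∷ u ∷ v ∷ X) (All.head (All.tail hs)) (proj₂ (proj₂ (All.lookup Ts-high i))) vs₂ (X-small 4 ≤-refl))))
                where
                w₂ : T₃ → ℕ
                w₂ t = w₁ t * (E u a b * E (proj₁ (proj₂ t)) a b)
                vs₂ : vs ↭ L₂ ++ a ∷ b ∷ u ∷ v ∷ X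
                vs₂ = ↭-trans vs₁ (↭-trans (++⁺ʳ (u ∷ v ∷ X) p₂) (shifts (a ∷ b ∷ []) L₂))
                fourth : (∃₂ λ c e → ∃ λ r → L₂ ↭ c ∷ e ∷ r × ∑ Ts w₂ ≤ ∑ Ts (λ t → w₂ t * (E v c e * E (proj₂ (proj₂ t)) c e)) * 10) →
                  ∃ λ N′ → State (k + 2) N′ × N′ * 1000 ≤ N * 999
                fourth (c , e , L₃ , p₃ , le₃) = finish (partition w₃ w₃≤1 Ts)
                  where
                  w₃ : T₃ → ℕ
                  w₃ t = w₂ t * (E v c e * E (proj₂ (proj₂ t)) c e)
                  w₃≤1 : ∀ t → w₃ t ≤ 1
                  w₃≤1 (x , y , z) = *-mono-≤ (*-mono-≤ (*-mono-≤ (≤-refl {1}) (E≤1 x u v)) (E·E≤1 u y a b)) (E·E≤1 v z c e)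
                  s₁ s₂ : T₃
                  s₁ = u , a , b
                  s₂ = v , c , e
                  A′ = s₁ ∷ s₂ ∷ A
                  part′ : flat A′ ++ L₃ ↭ vs
                  part′ = ↭-trans (↭-trans (++⁺ʳ (X ++ L₃) (permBy (u ∷ a ∷ b ∷ v ∷ c ∷ e ∷ []) (0F ∷ 3F ∷ 1F ∷ 2F ∷ 4F ∷ 5F ∷ [])))
                    (↭-trans (shifts (u ∷ v ∷ a ∷ b ∷ c ∷ e ∷ []) X) (++⁺ˡ X (↭-sym
                      (↭-trans L↭ (prep u (prep v (↭-trans p₂ (prep a (prep b p₃)))))))))) A-part
                  new : ∀ t → w₃ t ≡ 1 → Absorbed A′ t
                  new (x , y , z) h = s₁ , s₂ , A , ↭-refl ,
                    *≡1ʳ 1 (*≡1ˡ (E u a b * E y a b) (*≡1ˡ (E v c e * E z c e) h)) ,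
                    *≡1ʳ (E u a b) (*≡1ʳ (1 * E x u v) (*≡1ˡ (E v c e * E z c e) h)) ,
                    *≡1ʳ (E v c e) (*≡1ʳ ((1 * E x u v) * (E u a b * E y a b)) h)
                  edges : ∀ t → w₃ t ≡ 1 → E u a b ≡ 1 × E v c e ≡ 1
                  edges (x , y , z) h = *≡1ˡ (E y a b) (*≡1ʳ (1 * E x u v) (*≡1ˡ (E v c e * E z c e) h)) ,
                    *≡1ˡ (E z c e) (*≡1ʳ ((1 * E x u v) * (E u a b * E y a b)) h)
                  old : ∀ t → Absorbed A t → Absorbed A′ t
                  old (x , y , z) (s , t , A″ , p , es) = s , t , s₁ ∷ s₂ ∷ A″ , ↭-trans (prep s₁ (prep s₂ p)) (shifts (s₁ ∷ s₂ ∷ []) (s ∷ t ∷ [])) , es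
                  finish : (∃₂ λ Ts₁ Ts₀ → Ts ↭ Ts₁ ++ Ts₀ × All (λ t → w₃ t ≡ 1) Ts₁ × All (λ t → w₃ t ≡ 0) Ts₀) →
                    ∃ λ N′ → State (k + 2) N′ × N′ * 1000 ≤ N * 999
                  finish ([] , Ts₀ , pT , ones , zeros) = ⊥-elim (1+n≰n (≤-trans (pos (pos (pos Ts-pos le₁′) le₂) le₃)
                    (≤-reflexive (trans (∑-↭ w₃ pT) (∑-zeros w₃ zeros)))))
                  finish (Ts₁@(t₁ ∷ _) , Ts₀ , pT , ones , zeros) = length Ts₀ , record
                    { A = A′ ; Ts = Ts₀ ; L = L₃ ; A-edge = proj₁ es ∷ proj₂ es ∷ A-edge ; A-part = part′
                    ; A-length = ≤-trans (+-monoʳ-≤ 2 A-length) (≤-reflexive (+-comm 2 k))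
                    ; Ts-length = ≤-refl ; Ts-high = All.++⁻ʳ Ts₁ (All-resp-↭ pT Ts-high)
                    ; covers = cov } , shrink
                    where
                    es = edges t₁ (All.head ones)
                    cov : ∀ t → High t → t ∈ Ts₀ ⊎ Absorbed A′ t
                    cov t h with covers t h
                    ... | inj₂ ab = inj₂ (old t ab)
                    ... | inj₁ i with Any.++⁻ Ts₁ (∈-resp-↭ pT i)
                    ...   | inj₁ j = inj₂ (new t (All.lookup ones j))
                    ...   | inj₂ j = inj₁ j
                    w₃-sum : ∑ Ts w₃ ≡ length Ts₁
                    w₃-sum = trans (∑-↭ w₃ pT) (trans (∑-++ w₃ Ts₁ Ts₀) (trans (cong₂ _+_ (∑-ones w₃ ones) (∑-zeros w₃ zeros)) (+-identityʳ _)))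
                    shrink : length Ts₀ * 1000 ≤ N * 999
                    shrink = polyle (length Ts₀ ∷ length Ts₁ ∷ length Ts ∷ ∑ Ts w₁ ∷ ∑ Ts w₂ ∷ ∑ Ts w₃ ∷ N ∷ [])
                      ((var 2 , var 3 :* con 10 , con 1) ∷ (var 3 , var 4 :* con 10 , con 10) ∷ (var 4 , var 5 :* con 10 , con 100) ∷
                       (var 5 , var 1 , con 1000) ∷ (var 1 :+ var 0 , var 2 , con 1000) ∷ (var 2 , var 6 , con 999) ∷ [])
                      (var 0 :* con 1000) (var 6 :* con 999)
                      (le₁′ , le₂ , le₃ , ≤-reflexive w₃-sum , ≤-reflexive (sym (trans (↭-length pT) (length-++ Ts₁))) , Ts-length , tt)

      -- (999 / 1000)ʳ ≤ 1000 / (1000 + r), so that four rounds of r steps beat the n³ triples.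
      run : ∀ r k N → ((k + r * 2) * 3 + 4) * 100 ≤ n → State k N → ∃ λ N′ → State (k + r * 2) N′ × N′ * (r + 1000) ≤ N * 1000
      run zero k N room st = N , subst (λ j → State j N) (sym (+-identityʳ k)) st , ≤-refl
      run (suc r) k N room st =
        let N₁ , st₁ , h₁ = run r k N (≤-trans (polyle (k ∷ r ∷ []) [] (((var 0 :+ var 1 :* con 2) :* con 3 :+ con 4) :* con 100)
              (((var 0 :+ (con 1 :+ var 1) :* con 2) :* con 3 :+ con 4) :* con 100) tt) room) st
            N₂ , st₂ , h₂ = step (k + r * 2) N₁ (≤-trans (polyle (k ∷ r ∷ []) [] (((var 0 :+ var 1 :* con 2) :* con 3 :+ con 4) :* con 100)
              (((var 0 :+ (con 1 :+ var 1) :* con 2) :* con 3 :+ con 4) :* con 100) tt) room) st₁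
        in N₂ , subst (λ j → State j N₂) (trans (+-assoc k (r * 2) 2) (cong (k +_) (+-comm (r * 2) 2))) st₂ ,
          *-cancelˡ-≤ 1000 (polyle (N ∷ N₁ ∷ N₂ ∷ r ∷ [])
            ((var 2 :* con 1000 , var 1 :* con 999 , var 3 :+ con 1001) ∷ (var 1 :* (var 3 :+ con 1000) , var 0 :* con 1000 , con 1000) ∷ [])
            (con 1000 :* (var 2 :* (con 1 :+ (var 3 :+ con 1000)))) (con 1000 :* (var 0 :* con 1000)) (h₂ , h₁ , tt))

      -- Four rounds leave at most n³ (1000 / (r + 1000))⁴ < 1 triples. They take 4 r steps of two
      -- edges each, which gives the bound 8 r.
      absorbing : ∀ r → n * n * n * 1000000000000 < r * r * r * r → (r * 24 + 4) * 100 ≤ n →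
        ∃ λ A → All Edge A × length A ≤ r * 8 × (∃ λ L → flat A ++ L ↭ vs) × (∀ t → High t → Absorbed A t)
      absorbing r large room =
        let N₁ , st₁ , h₁ = run r 0 N₀ (≤-trans (polyle (r ∷ []) [] (((con 0 :+ var 0 :* con 2) :* con 3 :+ con 4) :* con 100) ((var 0 :* con 24 :+ con 4) :* con 100) tt) room) st₀
            N₂ , st₂ , h₂ = run r (0 + r * 2) N₁ (≤-trans (polyle (r ∷ []) [] (((con 0 :+ var 0 :* con 2 :+ var 0 :* con 2) :* con 3 :+ con 4) :* con 100) ((var 0 :* con 24 :+ con 4) :* con 100) tt) room) st₁
            N₃ , st₃ , h₃ = run r (0 + r * 2 + r * 2) N₂ (≤-trans (polyle (r ∷ []) [] (((con 0 :+ var 0 :* con 2 :+ var 0 :* con 2 :+ var 0 :* con 2) :* con 3 :+ con 4) :* con 100) ((var 0 :* con 24 :+ con 4) :* con 100) tt) room) st₂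
            N₄ , st₄ , h₄ = run r (0 + r * 2 + r * 2 + r * 2) N₃ (≤-trans (polyle (r ∷ []) [] (((con 0 :+ var 0 :* con 2 :+ var 0 :* con 2 :+ var 0 :* con 2 :+ var 0 :* con 2) :* con 3 :+ con 4) :* con 100) ((var 0 :* con 24 :+ con 4) :* con 100) tt) room) st₃
        in done N₄ st₄ (n<1⇒n≡0 (≰⇒> λ pos → 1+n≰n (polyle (n ∷ r ∷ N₀ ∷ N₁ ∷ N₂ ∷ N₃ ∷ N₄ ∷ [])
             ((con 1 :+ var 0 :* var 0 :* var 0 :* con 1000000000000 , var 1 :* var 1 :* var 1 :* var 1 , con 1) ∷
              (con 1 , var 6 , var 1 :* var 1 :* var 1 :* var 1) ∷
              (var 6 :* (var 1 :+ con 1000) , var 5 :* con 1000 , var 1 :* var 1 :* var 1) ∷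
              (var 5 :* (var 1 :+ con 1000) , var 4 :* con 1000 , con 1000 :* (var 1 :* var 1)) ∷
              (var 4 :* (var 1 :+ con 1000) , var 3 :* con 1000 , con 1000000 :* var 1) ∷
              (var 3 :* (var 1 :+ con 1000) , var 2 :* con 1000 , con 1000000000) ∷
              (var 2 , var 0 :* var 0 :* var 0 , con 1000000000000) ∷ [])
             (con 1) (con 0) (large , pos , h₄ , h₃ , h₂ , h₁ , N₀≤ , tt))))
        where
        Ts₀ = cartesianProduct U (cartesianProduct U U)
        N₀ = length Ts₀
        η≤n : length U ≤ n
        η≤n = ≤-trans (m≤n+m _ (length W)) (≤-reflexive (sym length-WU))
        N₀≤ : N₀ ≤ n * n * n
        N₀≤ = ≤-trans (≤-reflexive (trans (length-cartesianProduct U (cartesianProduct U U)) (cong (length U *_) (length-cartesianProduct U U))))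
          (≤-trans (*-mono-≤ η≤n (*-mono-≤ η≤n η≤n)) (≤-reflexive (sym (*-assoc n n n))))
        st₀ : State 0 N₀
        st₀ = record { A = [] ; Ts = Ts₀ ; L = vs ; A-edge = [] ; A-part = ↭-refl ; A-length = z≤n ; Ts-length = ≤-refl
          ; Ts-high = All.tabulate (λ {t} i → let p , q = ∈-cartesianProduct⁻ U (cartesianProduct U U) i
                                                  q₁ , q₂ = ∈-cartesianProduct⁻ U U q in
              All.lookup U-hi p , All.lookup U-hi q₁ , All.lookup U-hi q₂)
          ; covers = λ { (x , y , z) (p , q , r) → inj₁ (∈-cartesianProduct⁺ (in-U p) (∈-cartesianProduct⁺ (in-U q) (in-U r))) } }
        done : ∀ N → State (0 + r * 2 + r * 2 + r * 2 + r * 2) N → N ≡ 0 →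
          ∃ λ A → All Edge A × length A ≤ r * 8 × (∃ λ L → flat A ++ L ↭ vs) × (∀ t → High t → Absorbed A t)
        done N st N≡0 = State.A st , State.A-edge st ,
          ≤-trans (State.A-length st) (polyle (r ∷ []) [] (con 0 :+ var 0 :* con 2 :+ var 0 :* con 2 :+ var 0 :* con 2 :+ var 0 :* con 2) (var 0 :* con 8) tt) ,
          (State.L st , State.A-part st) , λ t h → get t (State.covers st t h)
          where
          none : ∀ Ts → length Ts ≤ 0 → ∀ {t : T₃} → t ∈ Ts → ⊥
          none (_ ∷ _) () _
          get : ∀ t → t ∈ State.Ts st ⊎ Absorbed (State.A st) t → Absorbed (State.A st) t
          get t (inj₂ ab) = ab
          get t (inj₁ i) = ⊥-elim (none (State.Ts st) (≤-trans (State.Ts-length st) (≤-reflexive N≡0)) i)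

      absorb : (∀ M L → All Edge M → Part M [] L → length M ≡ suc m → ⊥) → ∀ A → All Edge A → (∀ t → High t → Absorbed A t) →
        ∀ M x y z → All Edge M → lo x ≡ 0 → lo y ≡ 0 → lo z ≡ 0 → Part M (flat A) (x ∷ y ∷ z ∷ []) → ⊥
      absorb no-matching A A-edge abs M x y z M-edge hx hy hz part with abs (x , y , z) (hx , hy , hz)
      ... | (u , a , b) , (v , c , e) , A′ , p , e₁ , e₂ , e₃ =
        no-matching ((x , u , v) ∷ (y , a , b) ∷ (z , c , e) ∷ M ++ A′) []
          (e₁ ∷ e₂ ∷ e₃ ∷ All.++⁺ M-edge (All.tail (All.tail (All-resp-↭ p A-edge)))) part′ size
        where
        part′ : Part ((x , u , v) ∷ (y , a , b) ∷ (z , c , e) ∷ M ++ A′) [] []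
        part′ = ↭-trans (↭-reflexive (++-identityʳ _)) (↭-trans (++⁺ (permBy (x ∷ u ∷ v ∷ y ∷ a ∷ b ∷ z ∷ c ∷ e ∷ [])
            (1F ∷ 4F ∷ 5F ∷ 2F ∷ 7F ∷ 8F ∷ 0F ∷ 3F ∷ 6F ∷ [])) (↭-reflexive (flat-++ M A′)))
          (↭-trans (shifts (u ∷ a ∷ b ∷ v ∷ c ∷ e ∷ x ∷ y ∷ z ∷ []) (flat M))
          (↭-trans (++⁺ˡ (flat M) (↭-trans (++⁺ˡ (u ∷ a ∷ b ∷ v ∷ c ∷ e ∷ []) (++-comm (x ∷ y ∷ z ∷ []) (flat A′)))
             (++⁺ʳ (x ∷ y ∷ z ∷ []) (flat-↭ (↭-sym p))))) part)))
        -- The new triples cover all n = 3 (m + 1) vertices, which determines their number.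
        size : 3 + length (M ++ A′) ≡ suc m
        size = *-cancelʳ-≡ (3 + length (M ++ A′)) (suc m) 3 (trans (cong (λ w → (3 + w) * 3) (length-++ M))
          (trans (sym (length-flat′)) (trans n≡ (trans (+-comm (3 * m) 3) (cong (3 +_) (*-comm 3 m))))))
          where
          length-flat′ : n ≡ (3 + (length M + length A′)) * 3
          length-flat′ = trans (sym (↭-length part′)) (trans (cong length (++-identityʳ (flat ((x , u , v) ∷ (y , a , b) ∷ (z , c , e) ∷ M ++ A′))))
            (trans (length-flat ((x , u , v) ∷ (y , a , b) ∷ (z , c , e) ∷ M ++ A′)) (cong (λ w → (3 + w) * 3) (length-++ M))))

-- Choice of the scales, and the distinction of cases.

module Main (G : Hypergraph) (m : ℕ) where

  open Hypergraph G
  open Setting G m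

  module _ (degree-sum : ∀ u v w → E u v w ≡ 1 → 4 * (m * n) + 2 ≤ d u + d v + 4 * m)
    (no-matching : ∀ M L → All Edge M → Part M [] L → length M ≡ suc m → ⊥)
    (n-large : 3 * m + 3 ≤ n) (r : ℕ) (r-large : 10 ^ 94 ≤ r) (r≤n : r * 10 ^ 27 ≤ n) (n≤r : n ≤ r * (2 * 10 ^ 27)) where

    private
      -- n ≫ κ ≫ r and κ² ≫ n r, where r bounds the absorbing family and n r is the tolerance for low degrees.
      κ : ℕ
      κ = r * 10 ^ 15

      r-pos : 1 ≤ r
      r-pos = ≤-trans (s≤s z≤n) r-large

      m≤n : m ≤ n
      m≤n = polyle (m ∷ n ∷ []) ((con 3 :* var 0 :+ con 3 , var 1 , con 1) ∷ []) (var 0) (var 1) (n-large , tt)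

      no-matching-of-size-one : m ≡ 0 → ⊥
      no-matching-of-size-one refl = go vs refl
        where
        go : ∀ vs′ → vs ≡ vs′ → ⊥
        go [] eq = 1+n≰n (≤-trans n-large (≤-trans (≤-reflexive (cong length eq)) z≤n))
        go (v ∷ _) eq = let a , b , e = covered v ; N , p = edge-↭ (complete v) (complete a) (complete b) e in
          no-matching ((v , a , b) ∷ []) N (e ∷ []) (↭-sym p) refl

    module _ (m-pos : 1 ≤ m) (n-small : n < m * 20000 + 20000) where

      n≤m : n ≤ m * 40000
      n≤m = polyle (n ∷ m ∷ []) ((con 1 :+ var 0 , var 1 :* con 20000 :+ con 20000 , con 1) ∷ (con 1 , var 1 , con 20000) ∷ [])
        (var 0) (var 1 :* con 40000) (n-small , m-pos , tt)

      -- The factor is 10^27 / 40000, from r 10^27 ≤ n ≤ 40000 m.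
      r≤m : r * (25 * 10 ^ 21) ≤ m
      r≤m = *-cancelʳ-≤ (r * (25 * 10 ^ 21)) m 40000 (polyle (r ∷ m ∷ n ∷ [])
        ((var 0 :* con (10 ^ 27) , var 2 , con 1) ∷ (var 2 , var 1 :* con 40000 , con 1) ∷ [])
        (var 0 :* con (25 * 10 ^ 21) :* con 40000) (var 1 :* con 40000) (r≤n , n≤m , tt))

      κ-small : κ * 100 ≤ m
      κ-small = polyle (r ∷ m ∷ []) ((var 0 :* con (25 * 10 ^ 21) , var 1 , con 1) ∷ []) (var 0 :* con (10 ^ 15) :* con 100) (var 1) (r≤m , tt)

      m-large : 1000 ≤ m
      m-large = polyle (r ∷ m ∷ []) ((var 0 :* con (25 * 10 ^ 21) , var 1 , con 1) ∷ (con 1 , var 0 , con 1000) ∷ []) (con 1000) (var 1) (r≤m , r-pos , tt)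

      g : ℕ
      g = n * r

      module Bounds (a : ℕ) (a≤ : a ≤ r * 8) where

        vars : List ℕ
        vars = r ∷ m ∷ n ∷ a ∷ []

        K : Ex
        K = var 0 :* con (10 ^ 15)

        c₁ : 12 * g + 24 * m + (72 * (κ + a) + 220) * n < m * m
        c₁ = polyle vars
          ((var 0 :* con (25 * 10 ^ 21) , var 1 , var 1) ∷
           (var 2 , var 1 :* con 40000 , var 0 :* con (12 + 72 * 10 ^ 15 + 576) :+ con 244) ∷
           (var 3 , var 0 :* con 8 , con 72 :* var 2) ∷ (con 1 , var 0 , con (10 ^ 10) :* var 1 :+ con 1) ∷
           (con 1 , var 1 , con 1 :+ var 0) ∷ (con 3 :* var 1 :+ con 3 , var 2 , con 24) ∷ [])
          (con 1 :+ (con 12 :* (var 2 :* var 0) :+ con 24 :* var 1 :+ (con 72 :* (K :+ var 3) :+ con 220) :* var 2)) (var 1 :* var 1)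
          (r≤m , n≤m , a≤ , r-pos , m-pos , n-large , tt)

        c₂ : g + 6 * m + (18 * a + 77) * n < 2 * (κ * κ)
        c₂ = polyle vars
          ((var 2 , var 0 :* con (2 * 10 ^ 27) , con 145 :* var 0 :+ con 83) ∷ (var 3 , var 0 :* con 8 , con 18 :* var 2) ∷
           (con 1 , var 0 , con (166 * 10 ^ 27) :* var 0 :+ con 1) ∷ (con 1 , var 0 , var 0) ∷ (con 3 :* var 1 :+ con 3 , var 2 , con 6) ∷ [])
          (con 1 :+ (var 2 :* var 0 :+ con 6 :* var 1 :+ (con 18 :* var 3 :+ con 77) :* var 2)) (con 2 :* (K :* K))
          (n≤r , a≤ , r-pos , r-pos , n-large , tt)

        c₃ : (12 * (κ + a) + 22) * n ≤ m * n
        c₃ = polyle vars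
          ((var 0 :* con (25 * 10 ^ 21) , var 1 , var 2) ∷ (var 3 , var 0 :* con 8 , con 12 :* var 2) ∷ (con 1 , var 0 , con 22 :* var 2) ∷ [])
          ((con 12 :* (K :+ var 3) :+ con 22) :* var 2) (var 1 :* var 2) (r≤m , a≤ , r-pos , tt)

        c₄ : 2 * (a + 3) ≤ κ
        c₄ = polyle vars ((var 3 , var 0 :* con 8 , con 2) ∷ (con 1 , var 0 , con 6) ∷ []) (con 2 :* (var 3 :+ con 3)) K (a≤ , r-pos , tt)

        c₅ : (12 * a + 16) * n * 4 ≤ 3 * (κ * κ)
        c₅ = polyle vars
          ((var 2 , var 0 :* con (2 * 10 ^ 27) , con 384 :* var 0 :+ con 64) ∷ (var 3 , var 0 :* con 8 , con 48 :* var 2) ∷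
           (con 1 , var 0 , con (128 * 10 ^ 27) :* var 0) ∷ [])
          ((con 12 :* var 3 :+ con 16) :* var 2 :* con 4) (con 3 :* (K :* K)) (n≤r , a≤ , r-pos , tt)

      far : ∀ W U → vs ↭ W ++ U → All (λ v → Low.lo 0 degree-sum v ≡ 1) W → All (λ v → Low.lo 0 degree-sum v ≡ 0) U →
        2 * m + κ < length U → ⊥
      far W₀ U₀ WU₀ W₀-lo U₀-hi many₀ = go (partition lo lo≤1 vs)
        where
        open Low g degree-sum
        lo₀ = Low.lo 0 degree-sum
        lo≤lo₀ : ∀ v → lo v ≤ lo₀ v
        lo≤lo₀ v with low? v | Low.low? 0 degree-sum v
        ... | no _ | _ = z≤n
        ... | yes _ | yes _ = ≤-refl
        ... | yes p | no ¬p = ⊥-elim (¬p (polyle (d v ∷ g ∷ m ∷ m * n ∷ []) ((var 0 :+ var 1 :+ con 2 :* var 2 , con 2 :* var 3 , con 1) ∷ [])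
                (var 0 :+ con 0 :+ con 2 :* var 2) (con 2 :* var 3) (p , tt)))
        go : (∃₂ λ W U → vs ↭ W ++ U × All (λ v → lo v ≡ 1) W × All (λ v → lo v ≡ 0) U) → ⊥
        go (W , U , WU , W-lo , U-hi) = choose (n ≟ 3 * m + 3)
          where
          -- A larger `g` lowers the threshold for low vertices, so passing from 0 to `g` can only
          -- add high vertices.
          many : 2 * m + κ < length U
          many = ≤-trans many₀ (+-cancelˡ-≤ (length W₀) _ _ (≤-trans (≤-reflexive (trans (sym (trans (↭-length WU₀) (length-++ W₀))) (trans (↭-length WU) (length-++ W))))
            (+-monoˡ-≤ (length U) (begin
              length W ≡⟨ count lo W U WU W-lo U-hi ⟩
              ∑ vs lo ≤⟨ ∑-mono vs (λ {v} _ → lo≤lo₀ v) ⟩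
              ∑ vs lo₀ ≡⟨ count lo₀ W₀ U₀ WU₀ W₀-lo U₀-hi ⟨
              length W₀ ∎))))
            where
            open ≤-Reasoning
            count : ∀ (f : V → ℕ) W U → vs ↭ W ++ U → All (λ v → f v ≡ 1) W → All (λ v → f v ≡ 0) U → length W ≡ ∑ vs f
            count f W U p h k = sym (trans (∑-↭ f p) (trans (∑-++ f W U) (trans (cong₂ _+_ (∑-ones f h) (∑-zeros f k)) (+-identityʳ _))))
          conclude : ∀ A → All Edge A → length A ≤ r * 8 →
            (∀ M x y z → All Edge M → lo x ≡ 0 → lo y ≡ 0 → lo z ≡ 0 → Part M (flat A) (x ∷ y ∷ z ∷ []) → ⊥) →
            (∃ λ L → flat A ++ L ↭ vs) → ⊥
          conclude A A-edge a≤ absorb (L , p) = Far.far-impossible G m g degree-sum no-matching n-large (record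
            { A = A ; A-edge = A-edge ; absorb = absorb ; W = W ; U = U ; WU = WU ; W-lo = W-lo ; U-hi = U-hi ; κ = κ ; τ = κ
            ; many-high = many ; c₁ = c₁ ; c₂ = c₂ ; c₃ = c₃ ; c₄ = c₄ ; c₅ = c₅ }) L p
            where open Bounds (length A) a≤
          choose : Dec (n ≡ 3 * m + 3) → ⊥
          -- Three uncovered vertices beside at most m triples occur only if n = 3 m + 3; otherwise
          -- the empty family absorbs vacuously.
          choose (no n≢) = conclude [] [] z≤n (λ M x y z es _ _ _ p → n≢ (≤-antisym (polyle (length M ∷ m ∷ n ∷ [])
              ((var 2 , var 0 :* con 3 :+ con 3 , con 1) ∷ (var 0 , var 1 , con 3) ∷ []) (var 2) (con 3 :* var 1 :+ con 3)
              (≤-reflexive (sym (length-Part {M} {[]} p)) , matching-bound no-matching M (x ∷ y ∷ z ∷ []) es p , tt)) n-large)) (vs , ↭-refl)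
          choose (yes n≡) =
            let A , A-edge , a≤ , rest , abs = absorbing W U WU W-lo U-hi r large room
            in conclude A A-edge a≤ (absorb W U WU W-lo U-hi no-matching A A-edge abs) rest
            where
            n-1000 : 1000 ≤ n
            n-1000 = ≤-trans m-large m≤n
            g-small : g * 100 ≤ n * n
            g-small = polyle (r ∷ n ∷ []) ((var 0 :* con (10 ^ 27) , var 1 , var 1) ∷ []) (var 1 :* var 0 :* con 100) (var 1 :* var 1) (r≤n , tt)
            room : (r * 24 + 4) * 100 ≤ n
            room = polyle (r ∷ n ∷ []) ((var 0 :* con (10 ^ 27) , var 1 , con 1) ∷ (con 1 , var 0 , con 400) ∷ []) ((var 0 :* con 24 :+ con 4) :* con 100) (var 1) (r≤n , r-pos , tt)
            -- From n ≤ 2 · 10^27 r the left side is at most 8 · 10^93 r³, which is where the bound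
            -- 10^94 for r comes from.
            large : n * n * n * 1000000000000 < r * r * r * r
            large = polyle (r ∷ n ∷ [])
              ((var 1 , b , con (10 ^ 12) :* (var 1 :* var 1 :+ var 1 :* b :+ b :* b)) ∷ (con (10 ^ 94) , var 0 , var 0 :* var 0 :* var 0) ∷
               (con 1 , var 0 , var 0 :* var 0 :+ var 0 :+ con 1) ∷ [])
              (con 1 :+ var 1 :* var 1 :* var 1 :* con 1000000000000) (var 0 :* var 0 :* var 0 :* var 0)
              (n≤r , r-large , r-pos , tt)
              where
              b : Ex
              b = var 0 :* con (2 * 10 ^ 27)
            absorbing = Absorption.absorbing G m g degree-sum n≡ n-1000 g-small
            absorb = Absorption.absorb G m g degree-sum n≡ n-1000 g-small

    impossible : ⊥
    impossible = by-m (m ≟ 0)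
      where
      lo₀ = Low.lo 0 degree-sum
      D : ℕ
      D = suc m * n * 6
      large : V → ℕ
      large v = indicator (D ≤? d v)
      by-m : Dec (m ≡ 0) → ⊥
      by-m (yes m≡0) = no-matching-of-size-one m≡0
      by-m (no m≢0) = by-n (m * 20000 + 20000 ≤? n) (partition lo₀ (Low.lo≤1 0 degree-sum) vs)
        where
        m-pos : 1 ≤ m
        m-pos = n≢0⇒n>0 m≢0
        by-n : Dec (m * 20000 + 20000 ≤ n) → (∃₂ λ W U → vs ↭ W ++ U × All (λ v → lo₀ v ≡ 1) W × All (λ v → lo₀ v ≡ 0) U) → ⊥
        by-n (yes n-huge) (W , U , WU , W-lo , U-hi) = small (partition large (λ v → indicator≤1 (D ≤? d v)) vs)
          where
          small : (∃₂ λ Z N → vs ↭ Z ++ N × All (λ v → large v ≡ 1) Z × All (λ v → large v ≡ 0) N) → ⊥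
          small (Z , N , ZN , Z-large , N-small) = FewHigh.small-impossible G m degree-sum no-matching m-pos n-huge W U WU W-lo U-hi
            (SmallMatching.few-high G m degree-sum no-matching m-pos n-huge Z N ZN
              (All.map (λ {v} → indicator-1 (D ≤? d v)) Z-large)
              (All.map (λ {v} h → <⇒≤ (≰⇒> (indicator-0 (D ≤? d v) h))) N-small) W U WU W-lo U-hi)
        by-n (no n-small) (W , U , WU , W-lo , U-hi) = by-U (length U ≤? 2 * m + κ)
          where
          by-U : Dec (length U ≤ 2 * m + κ) → ⊥
          by-U (yes few) = Near.near-impossible G m degree-sum no-matching κ (κ-small m-pos (≰⇒> n-small)) (m-large m-pos (≰⇒> n-small)) n-large W U WU W-lo U-hi few
          by-U (no many) = far m-pos (≰⇒> n-small) W U WU W-lo U-hi (≰⇒> many)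

open import Defs

-- From the given edge lists to 0/1-valued incidences.

indicator-yes : ∀ {P : Set} (p : Dec P) → P → indicator p ≡ 1
indicator-yes (yes _) _ = refl
indicator-yes (no ¬p) p = ⊥-elim (¬p p)

indicator-no : ∀ {P : Set} (p : Dec P) → ¬ P → indicator p ≡ 0
indicator-no (yes p) ¬p = ⊥-elim (¬p p)
indicator-no (no _) _ = refl

indicator-cong : ∀ {P Q : Set} (p : Dec P) (q : Dec Q) → (P → Q) → (Q → P) → indicator p ≡ indicator q
indicator-cong (yes p) q f g = sym (indicator-yes q (f p))
indicator-cong (no ¬p) (yes q) f g = ⊥-elim (¬p (g q))
indicator-cong (no _) (no _) f g = refl

length-filter : ∀ {A : Set} {P : A → Set} (P? : ∀ x → Dec (P x)) xs → length (filter P? xs) ≡ ∑ xs (λ x → indicator (P? x))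
length-filter P? [] = refl
length-filter P? (x ∷ xs) with P? x
... | yes _ = cong suc (length-filter P? xs)
... | no _ = length-filter P? xs

∑-unique-≤1 : ∀ {A : Set} (f : A → ℕ) → (∀ x → f x ≤ 1) → (∀ x y → f x ≡ 1 → f y ≡ 1 → x ≡ y) → ∀ {xs} → Unique xs → ∑ xs f ≤ 1
∑-unique-≤1 f f≤1 inj [] = z≤n
∑-unique-≤1 f f≤1 inj {x ∷ xs} (h ∷ u) with f x in eq | f≤1 x
... | 0 | _ = ∑-unique-≤1 f f≤1 inj u
... | suc (suc _) | s≤s ()
... | 1 | _ = s≤s (≤-trans (∑-≤-const xs 0 (λ {y} i → bit-0 (f≤1 y) (λ fy → All.lookup h i (inj x y eq fy)))) (≤-reflexive (*-zeroʳ (length xs))))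

module Translate {n : ℕ} (H : Hypergraph3 n) where

  Spans : Edge n → Fin n → Fin n → Fin n → Set
  Spans e u v w = u ∈ₑ e × v ∈ₑ e × w ∈ₑ e × u ≢ v × v ≢ w × u ≢ w

  spans? : ∀ e u v w → Dec (Spans e u v w)
  spans? e u v w = (u ∈ₑ? e) ×-dec (v ∈ₑ? e) ×-dec (w ∈ₑ? e) ×-dec ¬? (u F.≟ v) ×-dec ¬? (v F.≟ w) ×-dec ¬? (u F.≟ w)

  swap₁₂ : ∀ e {u v w} → Spans e u v w → Spans e v u w
  swap₁₂ e (p , q , r , x , y , z) = q , p , r , ≢-sym x , z , y

  swap₂₃ : ∀ e {u v w} → Spans e u v w → Spans e u w v
  swap₂₃ e (p , q , r , x , y , z) = p , r , q , z , ≢-sym y , x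

  δ : Fin n → Fin n → Fin n → Edge n → ℕ
  δ u v w e = indicator (spans? e u v w)

  δ≤1 : ∀ u v w e → δ u v w e ≤ 1
  δ≤1 u v w e = indicator≤1 (spans? e u v w)

  at : Edge n → Fin 3 → Fin n
  at e 0F = a e
  at e 1F = b e
  at e 2F = c e

  position : ∀ (e : Edge n) {v} → v ∈ₑ e → ∃ λ i → v ≡ at e i
  position e (inj₁ p) = 0F , p
  position e (inj₂ (inj₁ p)) = 1F , p
  position e (inj₂ (inj₂ p)) = 2F , p

  -- Three distinct vertices of an edge exhaust it. On positions this is a finite statement, decided
  -- by evaluation.
  three-cover? : Dec (∀ (i j k l : Fin 3) → i ≢ j → j ≢ k → i ≢ k → l ≡ i ⊎ l ≡ j ⊎ l ≡ k)
  three-cover? = F.all? λ i → F.all? λ j → F.all? λ k → F.all? λ l →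
    ¬? (i F.≟ j) →-dec (¬? (j F.≟ k) →-dec (¬? (i F.≟ k) →-dec ((l F.≟ i) ⊎-dec ((l F.≟ j) ⊎-dec (l F.≟ k)))))

  spans-all : ∀ e {u v w} → Spans e u v w → ∀ {x} → x ∈ₑ e → x ≡ u ⊎ x ≡ v ⊎ x ≡ w
  spans-all e (p , q , r , uv , vw , uw) s with position e p | position e q | position e r | position e s
  ... | i , refl | j , refl | k , refl | l , refl with from-yes three-cover? i j k l (λ h → uv (cong (at e) h)) (λ h → vw (cong (at e) h)) (λ h → uw (cong (at e) h))
  ...   | inj₁ refl = inj₁ refl
  ...   | inj₂ (inj₁ refl) = inj₂ (inj₁ refl)
  ...   | inj₂ (inj₂ refl) = inj₂ (inj₂ refl)

  _⊆ₑ_ : Edge n → Edge n → Set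
  e ⊆ₑ f = ∀ {x} → x ∈ₑ e → x ∈ₑ f

  spans-⊆ : ∀ e f {u v w} → Spans e u v w → Spans f u v w → e ⊆ₑ f
  spans-⊆ e f s (p , q , r , _) i with spans-all e s i
  ... | inj₁ refl = p
  ... | inj₂ (inj₁ refl) = q
  ... | inj₂ (inj₂ refl) = r

  a-least : ∀ (e : Edge n) {x} → x ∈ₑ e → a e F.≤ x
  a-least e (inj₁ refl) = ≤-refl
  a-least e (inj₂ (inj₁ refl)) = <⇒≤ (a<b e)
  a-least e (inj₂ (inj₂ refl)) = <⇒≤ (<-trans (a<b e) (b<c e))

  c-greatest : ∀ (e : Edge n) {x} → x ∈ₑ e → x F.≤ c e
  c-greatest e (inj₁ refl) = <⇒≤ (<-trans (a<b e) (b<c e))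
  c-greatest e (inj₂ (inj₁ refl)) = <⇒≤ (b<c e)
  c-greatest e (inj₂ (inj₂ refl)) = ≤-refl

  edge-≡ : ∀ (e f : Edge n) → a e ≡ a f → b e ≡ b f → c e ≡ c f → e ≡ f
  edge-≡ (edge _ _ _ p q) (edge _ _ _ p′ q′) refl refl refl = cong₂ (edge _ _ _) (<-irrelevant p p′) (<-irrelevant q q′)

  ⊆-antisym : ∀ e f → e ⊆ₑ f → f ⊆ₑ e → e ≡ f
  ⊆-antisym e f p q = middle (p (inj₂ (inj₁ refl)))
    where
    ae : a e ≡ a f
    ae = F.≤-antisym (a-least e (q (inj₁ refl))) (a-least f (p (inj₁ refl)))
    ce : c e ≡ c f
    ce = F.≤-antisym (c-greatest f (p (inj₂ (inj₂ refl)))) (c-greatest e (q (inj₂ (inj₂ refl))))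
    middle : b e ∈ₑ f → e ≡ f
    middle (inj₁ be) = ⊥-elim (<-irrefl (cong F.toℕ (trans ae (sym be))) (a<b e))
    middle (inj₂ (inj₁ be)) = edge-≡ e f ae be ce
    middle (inj₂ (inj₂ be)) = ⊥-elim (<-irrefl (cong F.toℕ (trans be (sym ce))) (b<c e))

  -- The number of listed edges with these three distinct vertices. It is at most 1, since an edge
  -- with sorted entries is determined by its vertices and the list has no repetition.
  E : Fin n → Fin n → Fin n → ℕ
  E u v w = ∑ (edges H) (δ u v w)

  E⇒edge : ∀ {u v w} → E u v w ≡ 1 → ∃ λ e → e ∈ edges H × Spans e u v w
  E⇒edge {u} {v} {w} h with ∑>0⇒∃ (δ u v w) (edges H) (≤-reflexive (sym h))
  ... | e , i , p = e , i , indicator-1 (spans? e u v w) (≤-antisym (δ≤1 u v w e) p)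

  E≤1 : ∀ u v w → E u v w ≤ 1
  E≤1 u v w = ∑-unique-≤1 (δ u v w) (δ≤1 u v w) (λ e f p q →
    let s = indicator-1 (spans? e u v w) p ; t = indicator-1 (spans? f u v w) q in ⊆-antisym e f (spans-⊆ e f s t) (spans-⊆ f e t s)) (unique H)

  edge⇒E : ∀ e {u v w} → e ∈ edges H → Spans e u v w → E u v w ≡ 1
  edge⇒E e {u} {v} {w} i s = ≤-antisym (E≤1 u v w) (≤-trans (≤-reflexive (sym (indicator-yes (spans? e u v w) s))) (∈⇒≤∑ (δ u v w) i))

  others : ∀ v e → v ∈ₑ e → ∃₂ λ p q → Spans e v p q
  others v e (inj₁ refl) = b e , c e , inj₁ refl , inj₂ (inj₁ refl) , inj₂ (inj₂ refl) ,
    F.<⇒≢ (a<b e) , F.<⇒≢ (b<c e) , F.<⇒≢ (<-trans (a<b e) (b<c e))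
  others v e (inj₂ (inj₁ refl)) = a e , c e , inj₂ (inj₁ refl) , inj₁ refl , inj₂ (inj₂ refl) ,
    ≢-sym (F.<⇒≢ (a<b e)) , F.<⇒≢ (<-trans (a<b e) (b<c e)) , F.<⇒≢ (b<c e)
  others v e (inj₂ (inj₂ refl)) = a e , b e , inj₂ (inj₂ refl) , inj₁ refl , inj₂ (inj₁ refl) ,
    ≢-sym (F.<⇒≢ (<-trans (a<b e) (b<c e))) , F.<⇒≢ (a<b e) , ≢-sym (F.<⇒≢ (b<c e))

  graph : NoIsolated H → Hypergraph
  graph no-isolated = record
    { V = Fin n
    ; E = E
    ; E≤1 = E≤1
    ; E₁₂ = λ u v w → ∑-cong (edges H) (λ e → indicator-cong (spans? e u v w) (spans? e v u w) (swap₁₂ e) (swap₁₂ e))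
    ; E₂₃ = λ u v w → ∑-cong (edges H) (λ e → indicator-cong (spans? e u v w) (spans? e u w v) (swap₂₃ e) (swap₂₃ e))
    ; E-irr = λ u v → trans (∑-cong (edges H) (λ e → indicator-no (spans? e u v v) (λ { (_ , _ , _ , _ , h , _) → h refl })))
        (∑-zero (edges H))
    ; vs = allFin n
    ; complete = ∈-allFin
    ; covered = λ v → let e , i , j = no-isolated v ; p , q , s = others v e j in p , q , edge⇒E e i s
    }

  degree : Fin n → ℕ
  degree v = ∑∑ (allFin n) (E v)

  -- An edge at `v` contributes both orders of its other two vertices. The hypothesis bounds degrees
  -- from below, so this inequality is the direction that transfers it.
  2deg≤degree : ∀ v → 2 * deg H v ≤ degree v
  2deg≤degree v = begin
    2 * deg H v ≡⟨ trans (cong (2 *_) (length-filter (v ∈ₑ?_) (edges H))) (sym (∑-*ˡ (λ e → indicator (v ∈ₑ? e)) 2 (edges H))) ⟩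
    ∑ (edges H) (λ e → 2 * indicator (v ∈ₑ? e)) ≤⟨ ∑-mono (edges H) (λ {e} _ → at-edge e (v ∈ₑ? e)) ⟩
    ∑ (edges H) (λ e → ∑∑ (allFin n) (λ p q → δ v p q e))
      ≡⟨ trans (∑-cong (allFin n) (λ p → ∑-swap (λ q → δ v p q) (allFin n) (edges H)))
           (∑-swap (λ p e → ∑ (allFin n) (λ q → δ v p q e)) (allFin n) (edges H)) ⟨
    degree v ∎
    where
    open ≤-Reasoning
    at-edge : ∀ e (d : Dec (v ∈ₑ e)) → 2 * indicator d ≤ ∑∑ (allFin n) (λ p q → δ v p q e)
    at-edge e (no _) = z≤n
    at-edge e (yes i) with others v e i
    ... | p , q , s@(_ , _ , _ , _ , p≢q , _) with ∈⇒↭ (∈-allFin p)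
    ...   | r , σ with ∈⇒↭ (∈-tail (∈-resp-↭ σ (∈-allFin q)) (λ h → p≢q (sym h)))
    ...     | r′ , τ = begin
      2 ≡⟨ cong₂ _+_ (indicator-yes (spans? e v p q) s) (indicator-yes (spans? e v q p) (swap₂₃ e s)) ⟨
      δ v p q e + δ v q p e ≤⟨ +-mono-≤ (∈⇒≤∑ (λ y → δ v p y e) (∈-allFin q)) (∈⇒≤∑ (λ y → δ v q y e) (∈-allFin p)) ⟩
      ∑ (allFin n) (λ y → δ v p y e) + ∑ (allFin n) (λ y → δ v q y e) ≤⟨ +-monoʳ-≤ (∑ (allFin n) (λ y → δ v p y e)) (m≤m+n _ _) ⟩
      ∑ (allFin n) (λ y → δ v p y e) + (∑ (allFin n) (λ y → δ v q y e) + ∑ r′ (λ x → ∑ (allFin n) (λ y → δ v x y e)))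
        ≡⟨ trans (∑-↭ row σ) (cong (row p +_) (∑-↭ row τ)) ⟨
      ∑∑ (allFin n) (λ x y → δ v x y e) ∎
      where
      row : Fin n → ℕ
      row x = ∑ (allFin n) (λ y → δ v x y e)

  disjoint-blocks : ∀ (xs : List (Fin n)) {ys x} → Unique (xs ++ ys) → x ∈ xs → x ∈ ys → ⊥
  disjoint-blocks (x ∷ xs) (h ∷ u) (here refl) j = All.lookup h (Any.++⁺ʳ xs j) refl
  disjoint-blocks (x ∷ xs) (h ∷ u) (there i) j = disjoint-blocks xs u i j

  Unique-++ʳ : ∀ (xs : List (Fin n)) {ys} → Unique (xs ++ ys) → Unique ys
  Unique-++ʳ [] u = u
  Unique-++ʳ (x ∷ xs) (_ ∷ u) = Unique-++ʳ xs u

  to-matching : ∀ (M : List (Tri (Fin n))) L → All (λ (u , v , w) → E u v w ≡ 1) M → Unique (flat M ++ L) →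
    ∃ λ es → All (_∈ edges H) es × AllPairs Disjoint es × length es ≡ length M × All (λ e → ∀ x → x ∈ₑ e → x ∈ flat M) es
  to-matching [] L [] u = [] , [] , [] , refl , []
  to-matching (t@(p , q , r) ∷ M) L (h ∷ hs) u with E⇒edge h | to-matching M L hs (Unique-++ʳ (vx t) u)
  ... | e , i , s | es , is , ds , len , cov = e ∷ es , i ∷ is ,
      All.map (λ f x je jf → disjoint-blocks (vx t) u (in-t x je) (Any.++⁺ˡ (f x jf))) cov ∷ ds ,
      cong suc len , (λ x j → Any.++⁺ˡ (in-t x j)) ∷ All.map (λ f x j → Any.++⁺ʳ (vx t) (f x j)) cov
    where
    in-t : ∀ x → x ∈ₑ e → x ∈ vx t
    in-t x j with spans-all e s j
    ... | inj₁ refl = here refl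
    ... | inj₂ (inj₁ refl) = there (here refl)
    ... | inj₂ (inj₂ refl) = there (there (here refl))

  -- A search that picks one edge after another from the finite list. Unlike `HasMatching`, which
  -- quantifies over lists, it is decidable by its shape.
  Extends : ℕ → List (Edge n) → Set
  Extends zero acc = ⊤
  Extends (suc k) acc = Any (λ e → All (Disjoint e) acc × Extends k (e ∷ acc)) (edges H)

  disjoint? : ∀ (e f : Edge n) → Dec (Disjoint e f)
  disjoint? e f = F.all? (λ v → (v ∈ₑ? e) →-dec ¬? (v ∈ₑ? f))

  extends? : ∀ k acc → Dec (Extends k acc)
  extends? zero acc = yes tt
  extends? (suc k) acc = any? (λ e → all? (disjoint? e) acc ×-dec extends? k (e ∷ acc)) (edges H)

  extends⇒matching : ∀ k acc → All (_∈ edges H) acc → AllPairs Disjoint acc → Extends k acc → HasMatching H (k + length acc)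
  extends⇒matching zero acc is ds _ = acc , All.lookup is , distinct ds , ds , refl
    where
    distinct : ∀ {es} → AllPairs Disjoint es → Unique es
    distinct [] = []
    distinct {e ∷ es} (h ∷ ds) = All.map (λ { disj refl → disj (a e) (inj₁ refl) (inj₁ refl) }) h ∷ distinct ds
  extends⇒matching (suc k) acc is ds x with find x
  ... | e , i , disj , y = subst (HasMatching H) (+-suc k (length acc)) (extends⇒matching k (e ∷ acc) (i ∷ is) (disj ∷ ds) y)

  disjoint-sym : ∀ {e f : Edge n} → Disjoint e f → Disjoint f e
  disjoint-sym d v p q = d v q p

  matching⇒extends : ∀ es acc → All (_∈ edges H) es → AllPairs Disjoint es → All (λ e → All (Disjoint e) acc) es → Extends (length es) acc
  matching⇒extends [] acc _ _ _ = tt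
  matching⇒extends (e ∷ es) acc (i ∷ is) (h ∷ ds) (k ∷ ks) =
    lose i (k , matching⇒extends es (e ∷ acc) is ds (All.zipWith (λ { {f} (d , ds) → disjoint-sym {e} {f} d ∷ ds }) (h , ks)))

  -- The combinatorial proof only refutes the absence of a matching. Decidability of `Extends` turns
  -- this into a matching.
  matching-stable : ∀ s → ((∀ es → All (_∈ edges H) es → AllPairs Disjoint es → length es ≡ s → ⊥) → ⊥) → HasMatching H s
  matching-stable s h = subst (HasMatching H) (+-identityʳ s) (extends⇒matching s [] [] []
    (decidable-stable (extends? s []) (λ ¬x → h (λ es is ds len → ¬x (subst (λ k → Extends k []) len
      (matching⇒extends es [] is ds (All.tabulate (λ _ → []))))))))

-- The constants and the theorem.

quotient-bounds : ∀ n c R .⦃ _ : NonZero R ⦄ → 1 ≤ c → c * R ≤ n → c ≤ n / R × n / R * R ≤ n × n ≤ n / R * (2 * R)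
quotient-bounds n c R 1≤c cR≤n = c≤q , m/n*n≤m n R , (begin
  n                     ≡⟨ m≡m%n+[m/n]*n n R ⟩
  n % R + n / R * R     ≤⟨ +-monoˡ-≤ (n / R * R) (<⇒≤ (m%n<n n R)) ⟩
  R + n / R * R         ≤⟨ polyle (R ∷ n / R ∷ []) ((con 1 , var 1 , var 0) ∷ []) (var 0 :+ var 1 :* var 0) (var 1 :* (con 2 :* var 0)) (≤-trans 1≤c c≤q , tt) ⟩
  n / R * (2 * R)       ∎)
  where
  open ≤-Reasoning
  c≤q : c ≤ n / R
  c≤q = ≤-trans (≤-reflexive (sym (m*n/n≡m c R))) (/-monoˡ-≤ R cR≤n)

theorem3 : ∃ λ (n₁ : ℕ) → ∀ (n s : ℕ) → n₁ ≤ n → 0 < s → 3 * s ≤ n →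
    (H : Hypergraph3 n) → NoIsolated H →
    σ₂> H (2 * (s ∸ 1) * (n ∸ 1)) →
    HasMatching H s
-- With r = n / 10^27 rounded down, this bound gives r ≥ 10^94. The factor 10^27 leaves room between
-- r and n for κ = 10^15 r.
theorem3 = 10 ^ 94 * 10 ^ 27 , large
  where
  large : ∀ n s → 10 ^ 94 * 10 ^ 27 ≤ n → 0 < s → 3 * s ≤ n → (H : Hypergraph3 n) → NoIsolated H →
    σ₂> H (2 * (s ∸ 1) * (n ∸ 1)) → HasMatching H s
  large zero (suc m) _ _ () H no-isolated σ
  large n@(suc n′) (suc m) n-large _ s≤ H no-isolated σ = matching-stable (suc m) λ none →
    let c≤r , r≤n , n≤r = quotient-bounds n (10 ^ 94) (10 ^ 27) (s≤s z≤n) n-large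
    in Main.impossible (graph no-isolated) m degree-sum (no-matching none)
      (≤-trans (polyle (m ∷ []) [] (con 3 :* var 0 :+ con 3) (con 3 :* (con 1 :+ var 0)) tt) (≤-trans s≤ (≤-reflexive (sym len))))
      (n / 10 ^ 27) c≤r (≤-trans r≤n (≤-reflexive (sym len))) (≤-trans (≤-reflexive len) n≤r)
    where
    open Translate H
    len : length (allFin n) ≡ n
    len = length-tabulate (λ (i : Fin n) → i)
    -- The strict bound 2 m (n - 1) becomes 4 m (n - 1) + 2 for doubled degrees, and 4 m moves to
    -- the other side.
    degree-sum : ∀ u v w → E u v w ≡ 1 → 4 * (m * length (allFin n)) + 2 ≤ degree u + degree v + 4 * m
    degree-sum u v w h = subst (λ N → 4 * (m * N) + 2 ≤ degree u + degree v + 4 * m) (sym len)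
      (polyle (deg H u ∷ deg H v ∷ degree u ∷ degree v ∷ m ∷ n′ ∷ [])
        ((con 1 :+ con 2 :* var 4 :* var 5 , var 0 :+ var 1 , con 2) ∷ (con 2 :* var 0 , var 2 , con 1) ∷ (con 2 :* var 1 , var 3 , con 1) ∷ [])
        (con 4 :* (var 4 :* (con 1 :+ var 5)) :+ con 2) (var 2 :+ var 3 :+ con 4 :* var 4)
        (σ u v (adjacent (E⇒edge h)) , 2deg≤degree u , 2deg≤degree v , tt))
      where
      adjacent : (∃ λ e → e ∈ edges H × Spans e u v w) → Adjacent H u v
      adjacent (e , i , p , q , _ , u≢v , _) = u≢v , e , i , p , q
    no-matching : (∀ es → All (_∈ edges H) es → AllPairs Disjoint es → length es ≡ suc m → ⊥) →
      ∀ M L → All (λ (u , v , w) → E u v w ≡ 1) M → flat M ++ L ↭ allFin n → length M ≡ suc m → ⊥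
    no-matching none M L hs p size =
      let es , is , ds , length-es , _ = to-matching M L hs (Permutation.Unique-resp-↭ (setoid (Fin n)) (↭⇒↭ₛ (↭-sym p)) (Unique.allFin⁺ n))
      in none es is ds (trans length-es size)
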